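{- Let $d\ge 3$ be odd, and for a positive integer $n$ let $V_n:=(\mathbb{C}^n)^{\otimes d}$. Let $k$ be a positive integer and let $\pmb{\lambda}=(\lambda^{(1)},\ldots,\lambda^{(d)})$ be a $d$-tuple of partitions with $\pmb{\lambda}\subseteq(k^{d-1}\times k)^d$, i.e. each $\lambda^{(i)}$ has at most $k^{d-1}$ parts, all at most $k$. If the map $$L_k:\ \mathrm{HWV}_{\pmb{\lambda}'}\bigwedge V_k\longrightarrow\mathrm{HWV}_{(\rho_k\pmb{\lambda})'}\bigwedge V_k,\qquad L_k(v)=\omega_{d,k}\wedge v,$$ is injective, then for each integer $\ell>k$ the map $$L_\ell:\ \mathrm{HWV}_{\pmb{\lambda}'}\bigwedge V_\ell\longrightarrow\mathrm{HWV}_{(\rho_\ell\pmb{\lambda})'}\bigwedge V_\ell,\qquad L_\ell(v)=\omega_{d,\ell}\wedge v,$$ is also injective.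
   Context: $\lambda'$ denotes the conjugate partition (componentwise on tuples). For a partition $\lambda$ with parts at most $n$, $\rho_n\lambda=(n,\lambda_1,\lambda_2,\ldots)$ adds a first part equal to $n$; on tuples it acts componentwise. For each $n$, the group $\mathrm{GL}(n)^{\times d}$ acts on $V_n$ multilinearly and hence on $\bigwedge V_n$. A vector $v\in\bigwedge V_n$ is a weight vector of weight $\pmb{\mu}=(\mu^{(1)},\ldots,\mu^{(d)})$, $\mu^{(j)}\in\mathbb{Z}^n$, if every tuple of diagonal matrices $(\mathrm{diag}(a^{(1)}_1,\ldots,a^{(1)}_n),\ldots,\mathrm{diag}(a^{(d)}_1,\ldots,a^{(d)}_n))$ acts on $v$ as the scalar $\prod_j\prod_i (a^{(j)}_i)^{\mu^{(j)}_i}$. $\mathrm{HWV}_{\pmb{\mu}}\bigwedge V_n$ is the space consisting of $0$ and the nonzero weight vectors of weight $\pmb{\mu}$ invariant under $U(n)^{\times d}$, with $U(n)$ the group of upper unitriangular matrices. Partitions of length at most $n$ are padded with zeros to vectors in $\mathbb{Z}^n$. The Cayley form is $$\omega_{d,n}=\sum_{\pi_1,\ldots,\pi_d\in S_n}\mathrm{sgn}(\pi_1\cdots\pi_d)\bigwedge_{i=1}^n \left(e_{\pi_1(i)}\otimes\cdots\otimes e_{\pi_d(i)}\right)\in\bigwedge^n V_n,$$ where $e_1,\ldots,e_n$ is the standard basis of $\mathbb{C}^n$. -}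

module Defs where

open import Level using (0ℓ)
open import Algebra.Bundles using (CommutativeRing)
open import Algebra.Structures using (IsCommutativeRing)
open import Algebra.Module.Bundles using (Module)
open import Algebra.Module.Structures.Biased using (IsModuleFromLeft)
import Algebra.Properties.CommutativeMonoid.Sum as CMSum
import Algebra.Properties.Ring as RingProperties
import Algebra.Properties.Semiring.Exp as Exp
import Algebra.Properties.Semiring.Sum as SemiringSum
open import Data.Bool.Base using (Bool; true; false; if_then_else_)
open import Data.Fin.Base as Fin using (Fin; zero; suc; toℕ; fromℕ<; inject₁; punchIn; punchOut)
import Data.Fin.Permutation as Perm
open import Data.Fin.Permutation.Components using (transpose; transpose-inverse)
open import Data.Fin.Properties as Finₚ
  using (_≟_; _<?_; any?; toℕ-injective; punchOut-injective; pigeonhole)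
open import Data.Integer.Base using (ℤ; +_; -[1+_])
open import Data.List.Base as List using (List; []; _∷_; allFin; cartesianProductWith; filter)
open import Data.List.Relation.Unary.All as All using (All; []; _∷_)
open import Data.List.Relation.Unary.All.Properties using (all-filter; ++⁺; map⁺)
open import Data.Nat.Base as ℕ using (ℕ; zero; suc)
import Data.Nat.Properties as ℕₚ
import Data.Nat.Solver as ℕSolver
open import Data.Product.Base using (_×_; _,_; ∃; proj₁; proj₂)
open import Data.Rational.Base as ℚ using (ℚ; 0ℚ; 1ℚ; ½; ∣_∣)
import Data.Rational.Properties as ℚₚ
import Data.Rational.Solver as ℚSolver
open import Data.Sum.Base using (_⊎_; inj₁; inj₂)
open import Data.Vec.Base as Vec using (Vec; []; _∷_; lookup; count)
open import Data.Vec.Functional using (Vector; updateAt)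
open import Data.Vec.Functional.Properties using (updateAt-updates; updateAt-minimal)
import Data.Vec.Properties as Vecₚ
import Data.Vec.Relation.Unary.All.Properties as VAllₚ
open import Data.Vec.Relation.Unary.AllPairs using ([]; _∷_; allPairs?)
open import Data.Vec.Relation.Unary.Unique.Propositional using (Unique)
open import Data.Vec.Relation.Unary.Unique.Propositional.Properties as Uniqueₚ using (lookup-injective)
open import Function.Base using (_∘_)
open import Relation.Binary.PropositionalEquality as ≡ using (_≡_; _≢_; _≗_)
import Relation.Binary.Reasoning.Setoid as SetoidReasoning
open import Relation.Binary.Structures using (IsEquivalence)
open import Relation.Nullary using (Dec; yes; no; does; ¬_; contradiction)
open import Relation.Nullary.Decidable using (¬?; dec-true; dec-false)

module Complex where

  open ≡ using (refl; sym; trans; cong; subst)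
  open ℚSolver.+-*-Solver

  Vanishing : (ℕ → ℕ → ℚ) → Set
  Vanishing f = ∀ ε → 0ℚ ℚ.< ε → ∃ λ N → ∀ m n → N ℕ.≤ m → N ℕ.≤ n → ∣ f m n ∣ ℚ.< ε

  infix 4 _~_ _≈ᴿ_ _≈_

  -- For Cauchy sequences this is the usual "x n - y n tends to 0"; on the
  -- diagonal it is the Cauchy condition.
  record _~_ (x y : ℕ → ℚ) : Set where
    constructor vanishes
    field
      vanishing : Vanishing λ m n → x m ℚ.- y n
  open _~_

  -- Each Cauchy sequence carries a modulus of convergence (the witness in
  -- Vanishing); _~_ is the equality of real numbers.
  record ℝ : Set where
    constructor real
    field
      seq    : ℕ → ℚ
      cauchy : seq ~ seq
  open ℝ

  _≈ᴿ_ : ℝ → ℝ → Set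
  x ≈ᴿ y = seq x ~ seq y

  vanishing-≗ : ∀ {f g} → (∀ m n → f m n ≡ g m n) → Vanishing f → Vanishing g
  vanishing-≗ e v ε 0<ε with v ε 0<ε
  ... | N , b = N , λ m n N≤m N≤n → subst (λ q → ∣ q ∣ ℚ.< ε) (e m n) (b m n N≤m N≤n)

  vanishing-+ : ∀ {f g} → Vanishing f → Vanishing g → Vanishing (λ m n → f m n ℚ.+ g m n)
  vanishing-+ {f} {g} v w ε 0<ε with v (½ ℚ.* ε) 0<ε/2 | w (½ ℚ.* ε) 0<ε/2
    where
    0<ε/2 : 0ℚ ℚ.< ½ ℚ.* ε
    0<ε/2 = subst (ℚ._< ½ ℚ.* ε) (ℚₚ.*-zeroʳ ½) (ℚₚ.*-monoʳ-<-pos ½ 0<ε)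
  ... | N , b | M , c = N ℕ.⊔ M , λ m n p q →
    ℚₚ.≤-<-trans (ℚₚ.∣p+q∣≤∣p∣+∣q∣ (f m n) (g m n))
      (subst (∣ f m n ∣ ℚ.+ ∣ g m n ∣ ℚ.<_) halves
        (ℚₚ.+-mono-<
          (b m n (ℕₚ.≤-trans (ℕₚ.m≤m⊔n N M) p) (ℕₚ.≤-trans (ℕₚ.m≤m⊔n N M) q))
          (c m n (ℕₚ.≤-trans (ℕₚ.m≤n⊔m N M) p) (ℕₚ.≤-trans (ℕₚ.m≤n⊔m N M) q))))
    where
    halves : ½ ℚ.* ε ℚ.+ ½ ℚ.* ε ≡ ε
    halves = solve 1 (λ e → con ½ :* e :+ con ½ :* e := e) refl ε

  vanishing-neg : ∀ {f} → Vanishing f → Vanishing (λ m n → ℚ.- f m n)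
  vanishing-neg {f} v ε 0<ε with v ε 0<ε
  ... | N , b = N , λ m n p q →
    subst (ℚ._< ε) (sym (ℚₚ.∣-p∣≡∣p∣ (f m n))) (b m n p q)

  vanishing-flip : ∀ {f} → Vanishing f → Vanishing (λ m n → f n m)
  vanishing-flip v ε 0<ε with v ε 0<ε
  ... | N , b = N , λ m n p q → b n m q p

  vanishing-* : ∀ (x : ℝ) {g} → Vanishing g → Vanishing (λ m n → seq x m ℚ.* g m n)
  vanishing-* x {g} v ε 0<ε with vanishing (cauchy x) 1ℚ (ℚₚ.positive⁻¹ 1ℚ)
  ... | N , b = N ℕ.⊔ proj₁ w , λ m n p q →
    subst (ℚ._< ε) (sym (ℚₚ.∣p*q∣≡∣p∣*∣q∣ (seq x m) (g m n)))
      (ℚₚ.≤-<-trans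
        (ℚₚ.*-monoʳ-≤-nonNeg ∣ g m n ∣ {{ℚₚ.∣-∣-nonNeg (g m n)}}
          (bound m (ℕₚ.≤-trans (ℕₚ.m≤m⊔n N _) p)))
        (subst (B ℚ.* ∣ g m n ∣ ℚ.<_) B*δ
          (ℚₚ.*-monoʳ-<-pos B {{posB}}
            (proj₂ w m n (ℕₚ.≤-trans (ℕₚ.m≤n⊔m N _) p) (ℕₚ.≤-trans (ℕₚ.m≤n⊔m N _) q)))))
    where
    B : ℚ
    B = 1ℚ ℚ.+ ∣ seq x N ∣
    posB : ℚ.Positive B
    posB = ℚₚ.pos+nonNeg⇒pos 1ℚ ∣ seq x N ∣ {{ℚₚ.∣-∣-nonNeg (seq x N)}}
    nzB : ℚ.NonZero B
    nzB = ℚₚ.pos⇒nonZero B {{posB}}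
    1/B : ℚ
    1/B = (ℚ.1/ B) {{nzB}}
    δ : ℚ
    δ = 1/B ℚ.* ε
    0<δ : 0ℚ ℚ.< δ
    0<δ = subst (ℚ._< δ) (ℚₚ.*-zeroʳ 1/B)
            (ℚₚ.*-monoʳ-<-pos 1/B {{ℚₚ.1/pos⇒pos B {{posB}}}} 0<ε)
    B*δ : B ℚ.* δ ≡ ε
    B*δ = trans (sym (ℚₚ.*-assoc B 1/B ε))
            (trans (cong (ℚ._* ε) (ℚₚ.*-inverseʳ B {{nzB}})) (ℚₚ.*-identityˡ ε))
    w = v δ 0<δ
    bound : ∀ m → N ℕ.≤ m → ∣ seq x m ∣ ℚ.≤ B
    bound m N≤m = subst (λ q → ∣ q ∣ ℚ.≤ B)
      (solve 2 (λ a c → (a :- c) :+ c := a) refl (seq x m) (seq x N))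
      (ℚₚ.≤-trans (ℚₚ.∣p+q∣≤∣p∣+∣q∣ (seq x m ℚ.- seq x N) (seq x N))
        (ℚₚ.+-monoˡ-≤ ∣ seq x N ∣ (ℚₚ.<⇒≤ (b m N N≤m ℕₚ.≤-refl))))

  ~-sym : ∀ {x y} → x ~ y → y ~ x
  ~-sym {x} {y} (vanishes p) = vanishes (vanishing-≗
    (λ m n → solve 2 (λ a b → :- (a :- b) := b :- a) refl (x n) (y m))
    (vanishing-neg (vanishing-flip p)))

  ~-trans : ∀ {x y z} → x ~ y → y ~ z → x ~ z
  ~-trans {x} {y} {z} (vanishes p) (vanishes q) = vanishes (vanishing-≗
      (λ m n → solve 3 (λ a b c → (a :- b) :+ (b :- c) := a :- c) refl (x m) (y m) (z n))
      (vanishing-+ diagonal q))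
    where
    diagonal : Vanishing λ m n → x m ℚ.- y m
    diagonal ε 0<ε with p ε 0<ε
    ... | N , b = N , λ m n N≤m N≤n → b m m N≤m N≤m

  ~-+ : ∀ {x x′ y y′} → x ~ x′ → y ~ y′ → (λ n → x n ℚ.+ y n) ~ (λ n → x′ n ℚ.+ y′ n)
  ~-+ {x} {x′} {y} {y′} (vanishes p) (vanishes q) = vanishes (vanishing-≗
    (λ m n → solve 4 (λ a a′ b b′ → (a :- a′) :+ (b :- b′) := (a :+ b) :- (a′ :+ b′)) refl
      (x m) (x′ n) (y m) (y′ n))
    (vanishing-+ p q))

  ~-neg : ∀ {x x′} → x ~ x′ → (λ n → ℚ.- x n) ~ (λ n → ℚ.- x′ n)
  ~-neg {x} {x′} (vanishes p) = vanishes (vanishing-≗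
    (λ m n → solve 2 (λ a a′ → :- (a :- a′) := (:- a) :- (:- a′)) refl (x m) (x′ n))
    (vanishing-neg p))

  ~-* : ∀ (x x′ y y′ : ℝ) → seq x ~ seq x′ → seq y ~ seq y′ →
        (λ n → seq x n ℚ.* seq y n) ~ (λ n → seq x′ n ℚ.* seq y′ n)
  ~-* x x′ y y′ (vanishes p) (vanishes q) = vanishes (vanishing-≗
    (λ m n → solve 4 (λ a a′ b b′ → a :* (b :- b′) :+ b′ :* (a :- a′) := a :* b :- a′ :* b′)
      refl (seq x m) (seq x′ n) (seq y m) (seq y′ n))
    (vanishing-+ (vanishing-* x q)
                 (vanishing-flip (vanishing-* y′ (vanishing-flip p)))))

  ≗⇒≈ᴿ : ∀ {x y} → (∀ n → seq x n ≡ seq y n) → x ≈ᴿ y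
  ≗⇒≈ᴿ {x} {y} e = vanishes (vanishing-≗ (λ m n → cong (λ q → seq x m ℚ.- q) (e n))
                                           (vanishing (cauchy x)))

  infixl 6 _+ᴿ_
  infixl 7 _*ᴿ_

  _+ᴿ_ : ℝ → ℝ → ℝ
  x +ᴿ y = real (λ n → seq x n ℚ.+ seq y n) (~-+ (cauchy x) (cauchy y))

  _*ᴿ_ : ℝ → ℝ → ℝ
  x *ᴿ y = real (λ n → seq x n ℚ.* seq y n) (~-* x x y y (cauchy x) (cauchy y))

  -ᴿ_ : ℝ → ℝ
  -ᴿ x = real (λ n → ℚ.- seq x n) (~-neg (cauchy x))

  fromℚ : ℚ → ℝ
  fromℚ q = real (λ _ → q) (vanishes λ ε 0<ε → 0 , λ _ _ _ _ →
    subst (λ r → ∣ r ∣ ℚ.< ε) (sym (ℚₚ.+-inverseʳ q)) 0<ε)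

  record ℂ : Set where
    constructor _+i_
    field
      re im : ℝ
  open ℂ

  record _≈_ (z w : ℂ) : Set where
    constructor _,_
    field
      re-≈ : re z ≈ᴿ re w
      im-≈ : im z ≈ᴿ im w

  _+_ _*_ : ℂ → ℂ → ℂ
  z + w = (re z +ᴿ re w) +i (im z +ᴿ im w)
  z * w = (re z *ᴿ re w +ᴿ -ᴿ (im z *ᴿ im w)) +i (re z *ᴿ im w +ᴿ im z *ᴿ re w)

  -_ : ℂ → ℂ
  - z = (-ᴿ re z) +i (-ᴿ im z)

  0# 1# : ℂ
  0# = fromℚ 0ℚ +i fromℚ 0ℚ
  1# = fromℚ 1ℚ +i fromℚ 0ℚ

  ≗⇒≈ : ∀ {z w} → (∀ n → seq (re z) n ≡ seq (re w) n) →
        (∀ n → seq (im z) n ≡ seq (im w) n) → z ≈ w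
  ≗⇒≈ {z} {w} p q = ≗⇒≈ᴿ {re z} {re w} p , ≗⇒≈ᴿ {im z} {im w} q

  private
    r i : ℂ → ℕ → ℚ
    r z = seq (re z)
    i z = seq (im z)

    isCommutativeRing : IsCommutativeRing _≈_ _+_ _*_ -_ 0# 1#
    isCommutativeRing = record
      { isRing = record
        { +-isAbelianGroup = record
          { isGroup = record
            { isMonoid = record
              { isSemigroup = record
                { isMagma = record
                  { isEquivalence = record
                    { refl  = λ {z} → cauchy (re z) , cauchy (im z)
                    ; sym   = λ { {z} {w} (p , q) → ~-sym p , ~-sym q }
                    ; trans = λ { (p , q) (p′ , q′) → ~-trans p p′ , ~-trans q q′ }
                    }
                  ; ∙-cong = λ { (p , q) (p′ , q′) → ~-+ p p′ , ~-+ q q′ }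
                  }
                ; assoc = λ a b c → ≗⇒≈ (λ n → ℚₚ.+-assoc (r a n) (r b n) (r c n))
                                        (λ n → ℚₚ.+-assoc (i a n) (i b n) (i c n))
                }
              ; identity = (λ a → ≗⇒≈ (λ n → ℚₚ.+-identityˡ (r a n)) (λ n → ℚₚ.+-identityˡ (i a n)))
                         , (λ a → ≗⇒≈ (λ n → ℚₚ.+-identityʳ (r a n)) (λ n → ℚₚ.+-identityʳ (i a n)))
              }
            ; inverse = (λ a → ≗⇒≈ (λ n → ℚₚ.+-inverseˡ (r a n)) (λ n → ℚₚ.+-inverseˡ (i a n)))
                      , (λ a → ≗⇒≈ (λ n → ℚₚ.+-inverseʳ (r a n)) (λ n → ℚₚ.+-inverseʳ (i a n)))
            ; ⁻¹-cong = λ { (p , q) → ~-neg p , ~-neg q }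
            }
          ; comm = λ a b → ≗⇒≈ (λ n → ℚₚ.+-comm (r a n) (r b n)) (λ n → ℚₚ.+-comm (i a n) (i b n))
          }
        ; *-cong = λ { {a} {a′} {b} {b′} (p , q) (p′ , q′) →
              ~-+ (~-* (re a) (re a′) (re b) (re b′) p p′)
                  (~-neg (~-* (im a) (im a′) (im b) (im b′) q q′))
            , ~-+ (~-* (re a) (re a′) (im b) (im b′) p q′)
                  (~-* (im a) (im a′) (re b) (re b′) q p′) }
        ; *-assoc = λ a b c → ≗⇒≈
            (λ n → solve 6 (λ x y z u v w →
                (x :* z :+ :- (y :* u)) :* v :+ :- ((x :* u :+ y :* z) :* w)
                  := x :* (z :* v :+ :- (u :* w)) :+ :- (y :* (z :* w :+ u :* v)))
              refl (r a n) (i a n) (r b n) (i b n) (r c n) (i c n))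
            (λ n → solve 6 (λ x y z u v w →
                (x :* z :+ :- (y :* u)) :* w :+ (x :* u :+ y :* z) :* v
                  := x :* (z :* w :+ u :* v) :+ y :* (z :* v :+ :- (u :* w)))
              refl (r a n) (i a n) (r b n) (i b n) (r c n) (i c n))
        ; *-identity =
              (λ a → ≗⇒≈
                (λ n → solve 2 (λ x y → con 1ℚ :* x :+ :- (con 0ℚ :* y) := x) refl (r a n) (i a n))
                (λ n → solve 2 (λ x y → con 1ℚ :* y :+ con 0ℚ :* x := y) refl (r a n) (i a n)))
            , (λ a → ≗⇒≈
                (λ n → solve 2 (λ x y → x :* con 1ℚ :+ :- (y :* con 0ℚ) := x) refl (r a n) (i a n))
                (λ n → solve 2 (λ x y → x :* con 0ℚ :+ y :* con 1ℚ := y) refl (r a n) (i a n)))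
        ; distrib =
              (λ a b c → ≗⇒≈
                (λ n → solve 6 (λ x y z u v w →
                    x :* (z :+ v) :+ :- (y :* (u :+ w))
                      := (x :* z :+ :- (y :* u)) :+ (x :* v :+ :- (y :* w)))
                  refl (r a n) (i a n) (r b n) (i b n) (r c n) (i c n))
                (λ n → solve 6 (λ x y z u v w →
                    x :* (u :+ w) :+ y :* (z :+ v)
                      := (x :* u :+ y :* z) :+ (x :* w :+ y :* v))
                  refl (r a n) (i a n) (r b n) (i b n) (r c n) (i c n)))
            , (λ a b c → ≗⇒≈
                (λ n → solve 6 (λ x y z u v w →
                    (z :+ v) :* x :+ :- ((u :+ w) :* y)
                      := (z :* x :+ :- (u :* y)) :+ (v :* x :+ :- (w :* y)))
                  refl (r a n) (i a n) (r b n) (i b n) (r c n) (i c n))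
                (λ n → solve 6 (λ x y z u v w →
                    (z :+ v) :* y :+ (u :+ w) :* x
                      := (z :* y :+ u :* x) :+ (v :* y :+ w :* x))
                  refl (r a n) (i a n) (r b n) (i b n) (r c n) (i c n)))
        }
      ; *-comm = λ a b → ≗⇒≈
          (λ n → solve 4 (λ x y z u → x :* z :+ :- (y :* u) := z :* x :+ :- (u :* y))
            refl (r a n) (i a n) (r b n) (i b n))
          (λ n → solve 4 (λ x y z u → x :* u :+ y :* z := z :* y :+ u :* x)
            refl (r a n) (i a n) (r b n) (i b n))
      }

  ℂ-commutativeRing : CommutativeRing 0ℓ 0ℓ
  ℂ-commutativeRing = record { isCommutativeRing = isCommutativeRing }

  ½ℂ : ℂ
  ½ℂ = fromℚ ½ +i fromℚ 0ℚ

  ½+½≈1 : (½ℂ + ½ℂ) ≈ 1#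
  ½+½≈1 = ≗⇒≈ (λ _ → refl) (λ _ → refl)

module Permutations where

  open ≡ using (refl; sym; trans; cong; cong₂; subst; module ≡-Reasoning)

  tuples : ∀ {A : Set} m → List A → List (Vec A m)
  tuples zero    L = [] ∷ []
  tuples (suc m) L = cartesianProductWith _∷_ L (tuples m L)

  unique? : ∀ {n m} (v : Vec (Fin n) m) → Dec (Unique v)
  unique? = allPairs? λ x y → ¬? (x ≟ y)

  -- π ∈ S_n is encoded as the vector (π(1),…,π(n)).
  permutations : ∀ n → List (Vec (Fin n) n)
  permutations n = filter unique? (tuples n (allFin n))

  inversions : ∀ {n m} → Vec (Fin n) m → ℕ
  inversions []       = 0
  inversions (x ∷ xs) = count (_<? x) xs ℕ.+ inversions xs

  all-tuples : ∀ {A : Set} {P : A → Set} m {L} → All P L →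
               All (λ v → ∀ j → P (lookup v j)) (tuples m L)
  all-tuples zero    ps = (λ ()) ∷ []
  all-tuples {A} {P} (suc m) {L} ps = go ps
    where
    go : ∀ {L′} → All P L′ →
         All (λ v → ∀ j → P (lookup v j)) (cartesianProductWith _∷_ L′ (tuples m L))
    go []        = []
    go (p ∷ ps′) = ++⁺
      (map⁺ (All.map (λ q → λ { zero → p ; (suc j) → q j }) (all-tuples m ps)))
      (go ps′)

  all-permutations : ∀ n → All Unique (permutations n)
  all-permutations n = all-filter unique? (tuples n (allFin n))

  unique⇒surjective : ∀ {n} {v : Vec (Fin n) n} → Unique v → ∀ a → ∃ λ i → lookup v i ≡ a
  unique⇒surjective {suc n} {v} u a with any? (λ i → lookup v i ≟ a)
  ... | yes p = p
  ... | no ¬p with pigeonhole ℕₚ.≤-refl (λ i → punchOut {i = a} {lookup v i} (λ e → ¬p (i , sym e)))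
  ...   | i , j , i<j , e =
    contradiction (cong toℕ (lookup-injective u i j (punchOut-injective {i = a} _ _ e))) (ℕₚ.<⇒≢ i<j)

  ⟦_⟧ : ∀ {P : Set} → Dec P → ℕ
  ⟦ p ⟧ = if does p then 1 else 0

  ⟦yes⟧ : ∀ {P : Set} (p : Dec P) → P → ⟦ p ⟧ ≡ 1
  ⟦yes⟧ p x = cong (if_then 1 else 0) (dec-true p x)

  ⟦no⟧ : ∀ {P : Set} (p : Dec P) → ¬ P → ⟦ p ⟧ ≡ 0
  ⟦no⟧ p x = cong (if_then 1 else 0) (dec-false p x)

  ⟦⟧-⇔ : ∀ {P Q : Set} (p : Dec P) (q : Dec Q) → (P → Q) → (Q → P) → ⟦ p ⟧ ≡ ⟦ q ⟧
  ⟦⟧-⇔ (yes x) q f g = sym (⟦yes⟧ q (f x))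
  ⟦⟧-⇔ (no x)  q f g = sym (⟦no⟧ q (x ∘ g))

  Σᵛ : ∀ {A : Set} {m} → (A → ℕ) → Vec A m → ℕ
  Σᵛ f []       = 0
  Σᵛ f (x ∷ xs) = f x ℕ.+ Σᵛ f xs

  count≡Σᵛ : ∀ {A : Set} {P : A → Set} (P? : ∀ x → Dec (P x)) {m} (xs : Vec A m) →
             count P? xs ≡ Σᵛ (λ x → ⟦ P? x ⟧) xs
  count≡Σᵛ P? []       = refl
  count≡Σᵛ P? (x ∷ xs) with does (P? x)
  ... | true  = cong suc (count≡Σᵛ P? xs)
  ... | false = count≡Σᵛ P? xs

  module Adjacent {n} (τ : Fin n → Fin n) (a b : Fin n) (b≡1+a : toℕ b ≡ suc (toℕ a))
    (τa : τ a ≡ b) (τb : τ b ≡ a) (τ-fix : ∀ x → x ≢ a → x ≢ b → τ x ≡ x) where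

    lt : Fin n → Fin n → ℕ
    lt y x = ⟦ y <? x ⟧

    is : Fin n → Fin n → ℕ
    is x y = ⟦ x ≟ y ⟧

    isa isb : Fin n → ℕ
    isa x = is x a
    isb x = is x b

    a≢b : a ≢ b
    a≢b a≡b = ℕₚ.1+n≢n (trans (sym b≡1+a) (cong toℕ (sym a≡b)))

    a<b : toℕ a ℕ.< toℕ b
    a<b = ℕₚ.≤-reflexive (sym b≡1+a)

    irr : ∀ x → lt x x ≡ 0
    irr x = ⟦no⟧ (x <? x) (ℕₚ.<-irrefl refl)

    below : ∀ y → y ≢ a → y ≢ b → lt y b ≡ lt y a
    below y y≢a y≢b = ⟦⟧-⇔ (y <? b) (y <? a)
      (λ y<b → ℕₚ.≤∧≢⇒< (ℕₚ.≤-pred (subst (toℕ y ℕ.<_) b≡1+a y<b)) (y≢a ∘ toℕ-injective))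
      (λ y<a → ℕₚ.<-trans y<a a<b)

    above : ∀ x → x ≢ a → x ≢ b → lt b x ≡ lt a x
    above x x≢a x≢b = ⟦⟧-⇔ (b <? x) (a <? x)
      (λ b<x → ℕₚ.<-trans a<b b<x)
      (λ a<x → ℕₚ.≤∧≢⇒< (subst (ℕ._≤ toℕ x) (sym b≡1+a) a<x) (x≢b ∘ sym ∘ toℕ-injective))

    core : ∀ x y → lt (τ y) (τ x) ℕ.+ isb x ℕ.* isa y ≡ lt y x ℕ.+ isa x ℕ.* isb y
    core x y with x ≟ a | x ≟ b | y ≟ a | y ≟ b
    ... | yes refl | yes a≡b  | _        | _        = contradiction a≡b a≢b
    ... | _        | _        | yes refl | yes a≡b  = contradiction a≡b a≢b
    ... | yes refl | no _     | yes refl | no _     rewrite irr (τ a) | irr a = refl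
    ... | yes refl | no _     | no _     | yes refl
      rewrite τa | τb | ⟦yes⟧ (a <? b) a<b | ⟦no⟧ (b <? a) (ℕₚ.<-asym a<b) = refl
    ... | yes refl | no _     | no y≢a   | no y≢b
      rewrite τa | τ-fix y y≢a y≢b = cong (ℕ._+ 0) (below y y≢a y≢b)
    ... | no _     | yes refl | yes refl | no _
      rewrite τa | τb | ⟦yes⟧ (a <? b) a<b | ⟦no⟧ (b <? a) (ℕₚ.<-asym a<b) = refl
    ... | no _     | yes refl | no _     | yes refl rewrite irr (τ b) | irr b = refl
    ... | no _     | yes refl | no y≢a   | no y≢b
      rewrite τb | τ-fix y y≢a y≢b = cong (ℕ._+ 0) (sym (below y y≢a y≢b))
    ... | no x≢a   | no x≢b   | yes refl | no _
      rewrite τa | τ-fix x x≢a x≢b = cong (ℕ._+ 0) (above x x≢a x≢b)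
    ... | no x≢a   | no x≢b   | no _     | yes refl
      rewrite τb | τ-fix x x≢a x≢b = cong (ℕ._+ 0) (sym (above x x≢a x≢b))
    ... | no x≢a   | no x≢b   | no y≢a   | no y≢b
      rewrite τ-fix x x≢a x≢b | τ-fix y y≢a y≢b = refl

    ab ba : ∀ {m} → Vec (Fin n) m → ℕ
    ab []       = 0
    ab (x ∷ xs) = isa x ℕ.* Σᵛ isb xs ℕ.+ ab xs
    ba []       = 0
    ba (x ∷ xs) = isb x ℕ.* Σᵛ isa xs ℕ.+ ba xs

    open ℕSolver.+-*-Solver

    row : ∀ {m} x (xs : Vec (Fin n) m) →
          Σᵛ (λ y → lt y (τ x)) (Vec.map τ xs) ℕ.+ isb x ℕ.* Σᵛ isa xs
            ≡ Σᵛ (λ y → lt y x) xs ℕ.+ isa x ℕ.* Σᵛ isb xs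
    row x []       = cong₂ ℕ._+_ (refl {x = 0})
      (trans (ℕₚ.*-zeroʳ (isb x)) (sym (ℕₚ.*-zeroʳ (isa x))))
    row x (y ∷ ys) = begin
      (lt (τ y) (τ x) ℕ.+ S) ℕ.+ isb x ℕ.* (isa y ℕ.+ Σᵛ isa ys)
        ≡⟨ solve 5 (λ p s c i t → (p :+ s) :+ c :* (i :+ t) := (p :+ c :* i) :+ (s :+ c :* t))
             refl (lt (τ y) (τ x)) S (isb x) (isa y) (Σᵛ isa ys) ⟩
      (lt (τ y) (τ x) ℕ.+ isb x ℕ.* isa y) ℕ.+ (S ℕ.+ isb x ℕ.* Σᵛ isa ys)
        ≡⟨ cong₂ ℕ._+_ (core x y) (row x ys) ⟩
      (lt y x ℕ.+ isa x ℕ.* isb y) ℕ.+ (T ℕ.+ isa x ℕ.* Σᵛ isb ys)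
        ≡⟨ solve 5 (λ p s c i t → (p :+ s) :+ c :* (i :+ t) := (p :+ c :* i) :+ (s :+ c :* t))
             refl (lt y x) T (isa x) (isb y) (Σᵛ isb ys) ⟨
      (lt y x ℕ.+ T) ℕ.+ isa x ℕ.* (isb y ℕ.+ Σᵛ isb ys) ∎
      where
      open ≡-Reasoning
      S = Σᵛ (λ z → lt z (τ x)) (Vec.map τ ys)
      T = Σᵛ (λ z → lt z x) ys

    change : ∀ {m} (v : Vec (Fin n) m) →
             inversions (Vec.map τ v) ℕ.+ ba v ≡ inversions v ℕ.+ ab v
    change []       = refl
    change (x ∷ xs) = begin
      (count (_<? τ x) (Vec.map τ xs) ℕ.+ I′) ℕ.+ (B ℕ.+ ba xs)
        ≡⟨ cong (λ q → (q ℕ.+ I′) ℕ.+ (B ℕ.+ ba xs)) (count≡Σᵛ (_<? τ x) (Vec.map τ xs)) ⟩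
      (S ℕ.+ I′) ℕ.+ (B ℕ.+ ba xs)
        ≡⟨ interchange S I′ B (ba xs) ⟩
      (S ℕ.+ B) ℕ.+ (I′ ℕ.+ ba xs)
        ≡⟨ cong₂ ℕ._+_ (row x xs) (change xs) ⟩
      (T ℕ.+ A) ℕ.+ (I ℕ.+ ab xs)
        ≡⟨ interchange T I A (ab xs) ⟨
      (T ℕ.+ I) ℕ.+ (A ℕ.+ ab xs)
        ≡⟨ cong (λ q → (q ℕ.+ I) ℕ.+ (A ℕ.+ ab xs)) (count≡Σᵛ (_<? x) xs) ⟨
      (count (_<? x) xs ℕ.+ I) ℕ.+ (A ℕ.+ ab xs) ∎
      where
      open ≡-Reasoning
      interchange = solve 4 (λ p q r s → (p :+ q) :+ (r :+ s) := (p :+ r) :+ (q :+ s)) refl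
      S = Σᵛ (λ y → lt y (τ x)) (Vec.map τ xs)
      T = Σᵛ (λ y → lt y x) xs
      I = inversions xs
      I′ = inversions (Vec.map τ xs)
      A = isa x ℕ.* Σᵛ isb xs
      B = isb x ℕ.* Σᵛ isa xs

    exclusive : ∀ x → isa x ℕ.* isb x ≡ 0
    exclusive x with x ≟ a | x ≟ b
    ... | yes refl | yes a≡b = contradiction a≡b a≢b
    ... | yes _    | no _    = refl
    ... | no _     | _       = refl

    total : ∀ {m} (v : Vec (Fin n) m) → ab v ℕ.+ ba v ≡ Σᵛ isa v ℕ.* Σᵛ isb v
    total []       = refl
    total (x ∷ xs) = begin
      (p ℕ.* B ℕ.+ ab xs) ℕ.+ (q ℕ.* A ℕ.+ ba xs)
        ≡⟨ solve 6 (λ p q A B s t → (p :* B :+ s) :+ (q :* A :+ t)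
                                      := (p :* B :+ q :* A) :+ (s :+ t))
             refl p q A B (ab xs) (ba xs) ⟩
      (p ℕ.* B ℕ.+ q ℕ.* A) ℕ.+ (ab xs ℕ.+ ba xs)
        ≡⟨ cong₂ (λ s t → s ℕ.+ (p ℕ.* B ℕ.+ q ℕ.* A) ℕ.+ t) (sym (exclusive x)) (total xs) ⟩
      p ℕ.* q ℕ.+ (p ℕ.* B ℕ.+ q ℕ.* A) ℕ.+ A ℕ.* B
        ≡⟨ solve 4 (λ p q A B → p :* q :+ (p :* B :+ q :* A) :+ A :* B
                                  := (p :+ A) :* (q :+ B)) refl p q A B ⟩
      (p ℕ.+ A) ℕ.* (q ℕ.+ B) ∎
      where
      open ≡-Reasoning
      p = isa x
      q = isb x
      A = Σᵛ isa xs
      B = Σᵛ isb xs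

  absent : ∀ {n m} (c : Fin n) (v : Vec (Fin n) m) → (∀ i → lookup v i ≢ c) →
           Σᵛ (λ x → ⟦ x ≟ c ⟧) v ≡ 0
  absent c []       ∉ = refl
  absent c (x ∷ xs) ∉ = cong₂ ℕ._+_ (⟦no⟧ (x ≟ c) (∉ zero)) (absent c xs (∉ ∘ suc))

  once : ∀ {n m} (c : Fin n) (v : Vec (Fin n) m) → Unique v → ∀ i → lookup v i ≡ c →
         Σᵛ (λ x → ⟦ x ≟ c ⟧) v ≡ 1
  once c (x ∷ xs) (x∉ ∷ u) zero e = cong₂ ℕ._+_ (⟦yes⟧ (x ≟ c) e)
    (absent c xs λ i e′ → VAllₚ.lookup⁺ x∉ i (trans e (sym e′)))
  once c (x ∷ xs) (x∉ ∷ u) (suc i) e = cong₂ ℕ._+_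
    (⟦no⟧ (x ≟ c) λ e′ → VAllₚ.lookup⁺ x∉ i (trans e′ (sym e)))
    (once c xs u i e)

  inversions-swap : ∀ {n} (τ : Fin n → Fin n) (a b : Fin n) → toℕ b ≡ suc (toℕ a) →
    τ a ≡ b → τ b ≡ a → (∀ x → x ≢ a → x ≢ b → τ x ≡ x) →
    (v : Vec (Fin n) n) → Unique v →
    (inversions (Vec.map τ v) ≡ suc (inversions v)) ⊎ (inversions v ≡ suc (inversions (Vec.map τ v)))
  inversions-swap τ a b b≡ τa τb fix v u = parity (ab v) (ba v) one (change v)
    where
    open Adjacent τ a b b≡ τa τb fix
    one : ab v ℕ.+ ba v ≡ 1
    one = trans (total v) (cong₂ ℕ._*_
      (once a v u _ (proj₂ (unique⇒surjective u a)))
      (once b v u _ (proj₂ (unique⇒surjective u b))))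
    parity : ∀ s t → s ℕ.+ t ≡ 1 → inversions (Vec.map τ v) ℕ.+ t ≡ inversions v ℕ.+ s →
      (inversions (Vec.map τ v) ≡ suc (inversions v)) ⊎ (inversions v ≡ suc (inversions (Vec.map τ v)))
    parity 0 1 _ e = inj₂ (sym (trans (ℕₚ.+-comm 1 _) (trans e (ℕₚ.+-identityʳ _))))
    parity 1 0 _ e = inj₁ (trans (sym (ℕₚ.+-identityʳ _)) (trans e (ℕₚ.+-comm _ 1)))
    parity 0 0 () _
    parity 0 (suc (suc _)) () _
    parity 1 (suc _) () _
    parity (suc (suc _)) _ () _

module Partitions where

  open import Data.Nat.Base using (_≤_; _<_; _+_)

  -- A weakly decreasing sequence λ₁ ≥ λ₂ ≥ ⋯ of naturals that is eventually
  -- zero, indexed from 0: part i = λᵢ₊₁.  The field bound is only some upper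
  -- bound for the number of nonzero parts.
  record Partition : Set where
    field
      part      : ℕ → ℕ
      decreasing : ∀ i → part (suc i) ≤ part i
      bound     : ℕ
      vanishing : ∀ i → bound ≤ i → part i ≡ 0
  open Partition public

  part≤part₀ : ∀ λ′ i → part λ′ i ≤ part λ′ 0
  part≤part₀ λ′ zero    = ℕₚ.≤-refl
  part≤part₀ λ′ (suc i) = ℕₚ.≤-trans (decreasing λ′ i) (part≤part₀ λ′ i)

  -- #{i < b : f i > j}
  countAbove : (ℕ → ℕ) → ℕ → ℕ → ℕ
  countAbove f zero    j = 0
  countAbove f (suc b) j = (if does (j ℕₚ.<? f 0) then 1 else 0) + countAbove (f ∘ suc) b j

  countAbove-decreasing : ∀ f b j → countAbove f b (suc j) ≤ countAbove f b j
  countAbove-decreasing f zero    j = ℕₚ.≤-refl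
  countAbove-decreasing f (suc b) j =
    ℕₚ.+-mono-≤ (head (suc j ℕₚ.<? f 0) (j ℕₚ.<? f 0)) (countAbove-decreasing (f ∘ suc) b j)
    where
    head : (p : Dec (suc j < f 0)) (q : Dec (j < f 0)) →
           (if does p then 1 else 0) ≤ (if does q then 1 else 0)
    head (yes p) (yes q) = ℕₚ.≤-refl
    head (yes p) (no ¬q) = contradiction (ℕₚ.<-trans (ℕₚ.n<1+n j) p) ¬q
    head (no ¬p) q       = ℕ.z≤n

  countAbove-zero : ∀ f b j → (∀ i → f i ≤ j) → countAbove f b j ≡ 0
  countAbove-zero f zero    j h = ≡.refl
  countAbove-zero f (suc b) j h
    rewrite dec-false (j ℕₚ.<? f 0) (ℕₚ.≤⇒≯ (h 0)) = countAbove-zero (f ∘ suc) b j (h ∘ suc)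

  conj : Partition → Partition
  conj λ′ = record
    { part       = countAbove (part λ′) (bound λ′)
    ; decreasing = countAbove-decreasing (part λ′) (bound λ′)
    ; bound      = part λ′ 0
    ; vanishing  = λ j λ₁≤j → countAbove-zero (part λ′) (bound λ′) j
                     λ i → ℕₚ.≤-trans (part≤part₀ λ′ i) λ₁≤j
    }

  PartsAtMost : ℕ → Partition → Set
  PartsAtMost n λ′ = ∀ i → part λ′ i ≤ n

  ρ : ∀ n λ′ → PartsAtMost n λ′ → Partition
  ρ n λ′ λ≤n = record
    { part       = λ { zero → n ; (suc i) → part λ′ i }
    ; decreasing = λ { zero → λ≤n 0 ; (suc i) → decreasing λ′ i }
    ; bound      = suc (bound λ′)
    ; vanishing  = λ { (suc i) (ℕ.s≤s b≤i) → vanishing λ′ i b≤i }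
    }

  -- The diagram fits in the a × b rectangle: at most a parts, all at most b.
  infix 4 _⊆_×_
  record _⊆_×_ (λ′ : Partition) (a b : ℕ) : Set where
    field
      length≤ : ∀ i → a ≤ i → part λ′ i ≡ 0
      parts≤  : PartsAtMost b λ′
  open _⊆_×_ public

  conj-ρ : ∀ n λ′ (λ≤n : PartsAtMost n λ′) j → j < n →
           part (conj (ρ n λ′ λ≤n)) j ≡ suc (part (conj λ′) j)
  conj-ρ n λ′ λ≤n j j<n rewrite dec-true (j ℕₚ.<? n) j<n = ≡.refl

infixl 9 _[_]≔_
_[_]≔_ : ∀ {A : Set} {n} → Vector A n → Fin n → A → Vector A n
x [ j ]≔ w = updateAt x j λ _ → w

open Permutations

module Multilinear (K : CommutativeRing 0ℓ 0ℓ) where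

  open CommutativeRing K renaming (Carrier to 𝕜) hiding (zero)
  open Exp semiring using (_^_)
  open SemiringSum semiring using (sum; sum-cong-≋; ∑-distrib-+; *-distribˡ-sum)
  open CMSum *-commutativeMonoid public using ()
    renaming (sum to ∏; sum-cong-≋ to ∏-cong; ∑-distrib-+ to ∏-distrib-*)
  open Module using (Carrierᴹ)

  Mod : Set₁
  Mod = Module K 0ℓ 0ℓ

  record ModuleLaws {A : Set} (_≋_ : A → A → Set) (_⊕_ : A → A → A) (𝟎 : A)
                    (_·_ : 𝕜 → A → A) : Set where
    field
      ≋-isEquivalence : IsEquivalence _≋_
      ⊕-cong        : ∀ {x x′ y y′} → x ≋ x′ → y ≋ y′ → (x ⊕ y) ≋ (x′ ⊕ y′)
      ·-cong        : ∀ {r r′ x x′} → r ≈ r′ → x ≋ x′ → (r · x) ≋ (r′ · x′)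
      ⊕-assoc       : ∀ x y z → ((x ⊕ y) ⊕ z) ≋ (x ⊕ (y ⊕ z))
      ⊕-comm        : ∀ x y → (x ⊕ y) ≋ (y ⊕ x)
      ⊕-identityˡ   : ∀ x → (𝟎 ⊕ x) ≋ x
      ·-zeroˡ       : ∀ x → (0# · x) ≋ 𝟎
      ·-distribʳ    : ∀ x r s → ((r + s) · x) ≋ ((r · x) ⊕ (s · x))
      ·-distribˡ    : ∀ r x y → (r · (x ⊕ y)) ≋ ((r · x) ⊕ (r · y))
      ·-identityˡ   : ∀ x → (1# · x) ≋ x
      ·-assoc       : ∀ r s x → ((r * s) · x) ≋ (r · (s · x))

  toModule : ∀ {A : Set} {_≋_ : A → A → Set} {_⊕_ : A → A → A} {𝟎 : A} {_·_ : 𝕜 → A → A} →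
             ModuleLaws _≋_ _⊕_ 𝟎 _·_ → Mod
  toModule {A} {_≋_} {_⊕_} {𝟎} {_·_} laws = record
    { Carrierᴹ = A
    ; _≈ᴹ_ = _≋_
    ; _+ᴹ_ = _⊕_
    ; _*ₗ_ = _·_
    ; _*ᵣ_ = λ x r → r · x
    ; 0ᴹ = 𝟎
    ; -ᴹ_ = λ x → (- 1#) · x
    ; isModule = IsModuleFromLeft.isModule {commutativeRing = K} record
      { isLeftModule = record
        { isLeftSemimodule = record
          { +ᴹ-isCommutativeMonoid = record
            { isMonoid = record
              { isSemigroup = record
                { isMagma = record { isEquivalence = ≋-isEquivalence ; ∙-cong = ⊕-cong }
                ; assoc = ⊕-assoc
                }
              ; identity = ⊕-identityˡ , λ x → ≋-trans (⊕-comm x 𝟎) (⊕-identityˡ x)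
              }
            ; comm = ⊕-comm
            }
          ; isPreleftSemimodule = record
            { *ₗ-cong = ·-cong
            ; *ₗ-zeroˡ = ·-zeroˡ
            ; *ₗ-distribʳ = ·-distribʳ
            ; *ₗ-identityˡ = ·-identityˡ
            ; *ₗ-assoc = ·-assoc
            ; *ₗ-zeroʳ = λ r →
                ≋-trans (·-cong refl (≋-sym (·-zeroˡ 𝟎)))
                  (≋-trans (≋-sym (·-assoc r 0# 𝟎))
                    (≋-trans (·-cong (zeroʳ r) ≋-refl) (·-zeroˡ 𝟎)))
            ; *ₗ-distribˡ = ·-distribˡ
            }
          }
        ; -ᴹ‿cong = ·-cong refl
        ; -ᴹ‿inverse = inverse , λ x → ≋-trans (⊕-comm x _) (inverse x)
        }
      }
    }
    where
    open ModuleLaws laws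
    open IsEquivalence ≋-isEquivalence renaming (refl to ≋-refl; sym to ≋-sym; trans to ≋-trans)
    inverse : ∀ x → (((- 1#) · x) ⊕ x) ≋ 𝟎
    inverse x = ≋-trans (⊕-cong ≋-refl (≋-sym (·-identityˡ x)))
      (≋-trans (≋-sym (·-distribʳ x (- 1#) 1#))
        (≋-trans (·-cong (-‿inverseˡ 1#) ≋-refl) (·-zeroˡ x)))

  record IsLinear (M N : Mod) (f : Carrierᴹ M → Carrierᴹ N) : Set where
    private
      module M = Module M
      module N = Module N
    field
      f-cong : ∀ {x y} → x M.≈ᴹ y → f x N.≈ᴹ f y
      f-+    : ∀ x y → f (x M.+ᴹ y) N.≈ᴹ (f x N.+ᴹ f y)
      f-·    : ∀ r x → f (r M.*ₗ x) N.≈ᴹ (r N.*ₗ f x)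

  record LinearMap (M N : Mod) : Set where
    field
      fun      : Carrierᴹ M → Carrierᴹ N
      isLinear : IsLinear M N fun
    open IsLinear isLinear public
  open LinearMap using (fun)

  𝕜^ : ℕ → Mod
  𝕜^ n = toModule {A = Vector 𝕜 n} {λ x y → ∀ i → x i ≈ y i}
    {λ x y i → x i + y i} {λ _ → 0#} {λ r x i → r * x i} record
    { ≋-isEquivalence = record
      { refl = λ i → refl ; sym = λ p i → sym (p i) ; trans = λ p q i → trans (p i) (q i) }
    ; ⊕-cong = λ p q i → +-cong (p i) (q i)
    ; ·-cong = λ p q i → *-cong p (q i)
    ; ⊕-assoc = λ x y z i → +-assoc (x i) (y i) (z i)
    ; ⊕-comm = λ x y i → +-comm (x i) (y i)
    ; ⊕-identityˡ = λ x i → +-identityˡ (x i)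
    ; ·-zeroˡ = λ x i → zeroˡ (x i)
    ; ·-distribʳ = λ x r s i → distribʳ (x i) r s
    ; ·-distribˡ = λ r x y i → distribˡ r (x i) (y i)
    ; ·-identityˡ = λ x i → *-identityˡ (x i)
    ; ·-assoc = λ r s x i → *-assoc r s (x i)
    }

  e : ∀ {n} → Fin n → Vector 𝕜 n
  e i j = if does (i ≟ j) then 1# else 0#

  Matrix : ℕ → Set
  Matrix n = Fin n → Fin n → 𝕜

  matrixMap : ∀ {n} → Matrix n → LinearMap (𝕜^ n) (𝕜^ n)
  matrixMap A = record
    { fun = λ x i → sum (λ j → A i j * x j)
    ; isLinear = record
      { f-cong = λ p i → sum-cong-≋ λ j → *-congˡ (p j)
      ; f-+ = λ x y i → trans (sum-cong-≋ λ j → distribˡ (A i j) (x j) (y j))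
                              (∑-distrib-+ (λ j → A i j * x j) (λ j → A i j * y j))
      ; f-· = λ r x i → trans (sum-cong-≋ λ j → swap (A i j) r (x j))
                              (sym (*-distribˡ-sum r λ j → A i j * x j))
      }
    }
    where
    swap : ∀ a r x → a * (r * x) ≈ r * (a * x)
    swap a r x = trans (sym (*-assoc a r x)) (trans (*-congʳ (*-comm a r)) (*-assoc r a x))

  -- M ⊗ ⋯ ⊗ M (d factors): the module generated by pure tensors subject to
  -- multilinearity, presented as terms modulo the least congruence.

  infixl 6 _+ᵀ_
  infixr 7 _·ᵀ_
  infix  4 _≈ᵀ_

  data Tensor (d : ℕ) (M : Mod) : Set where
    ⨂    : Vector (Carrierᴹ M) d → Tensor d M
    0ᵀ   : Tensor d M
    _+ᵀ_ : Tensor d M → Tensor d M → Tensor d M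
    _·ᵀ_ : 𝕜 → Tensor d M → Tensor d M

  data _≈ᵀ_ {d : ℕ} {M : Mod} : Tensor d M → Tensor d M → Set where
    reflᵀ        : ∀ {x} → x ≈ᵀ x
    symᵀ         : ∀ {x y} → x ≈ᵀ y → y ≈ᵀ x
    transᵀ       : ∀ {x y z} → x ≈ᵀ y → y ≈ᵀ z → x ≈ᵀ z
    +ᵀ-cong      : ∀ {x x′ y y′} → x ≈ᵀ x′ → y ≈ᵀ y′ → x +ᵀ y ≈ᵀ x′ +ᵀ y′
    ·ᵀ-cong      : ∀ {r r′ x x′} → r ≈ r′ → x ≈ᵀ x′ → r ·ᵀ x ≈ᵀ r′ ·ᵀ x′
    +ᵀ-assoc     : ∀ x y z → (x +ᵀ y) +ᵀ z ≈ᵀ x +ᵀ (y +ᵀ z)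
    +ᵀ-comm      : ∀ x y → x +ᵀ y ≈ᵀ y +ᵀ x
    +ᵀ-identityˡ : ∀ x → 0ᵀ +ᵀ x ≈ᵀ x
    ·ᵀ-zeroˡ     : ∀ x → 0# ·ᵀ x ≈ᵀ 0ᵀ
    ·ᵀ-distribʳ  : ∀ x r s → (r + s) ·ᵀ x ≈ᵀ r ·ᵀ x +ᵀ s ·ᵀ x
    ·ᵀ-distribˡ  : ∀ r x y → r ·ᵀ (x +ᵀ y) ≈ᵀ r ·ᵀ x +ᵀ r ·ᵀ y
    ·ᵀ-identityˡ : ∀ x → 1# ·ᵀ x ≈ᵀ x
    ·ᵀ-assoc     : ∀ r s x → (r * s) ·ᵀ x ≈ᵀ r ·ᵀ (s ·ᵀ x)
    ⨂-cong       : ∀ {x y} → (∀ j → Module._≈ᴹ_ M (x j) (y j)) → ⨂ x ≈ᵀ ⨂ y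
    ⨂-+          : ∀ x j u v → ⨂ (x [ j ]≔ Module._+ᴹ_ M u v) ≈ᵀ ⨂ (x [ j ]≔ u) +ᵀ ⨂ (x [ j ]≔ v)
    ⨂-·          : ∀ x j r u → ⨂ (x [ j ]≔ Module._*ₗ_ M r u) ≈ᵀ r ·ᵀ ⨂ (x [ j ]≔ u)

  TensorPower : ℕ → Mod → Mod
  TensorPower d M = toModule {A = Tensor d M} {_≈ᵀ_} {_+ᵀ_} {0ᵀ} {_·ᵀ_} record
    { ≋-isEquivalence = record { refl = reflᵀ ; sym = symᵀ ; trans = transᵀ }
    ; ⊕-cong = +ᵀ-cong
    ; ·-cong = ·ᵀ-cong
    ; ⊕-assoc = +ᵀ-assoc
    ; ⊕-comm = +ᵀ-comm
    ; ⊕-identityˡ = +ᵀ-identityˡ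
    ; ·-zeroˡ = ·ᵀ-zeroˡ
    ; ·-distribʳ = ·ᵀ-distribʳ
    ; ·-distribˡ = ·ᵀ-distribˡ
    ; ·-identityˡ = ·ᵀ-identityˡ
    ; ·-assoc = ·ᵀ-assoc
    }

  tensorMap : ∀ {d M N} → (Fin d → LinearMap M N) → LinearMap (TensorPower d M) (TensorPower d N)
  tensorMap {d} {M} {N} f = record
    { fun = go
    ; isLinear = record { f-cong = go-cong ; f-+ = λ _ _ → reflᵀ ; f-· = λ _ _ → reflᵀ }
    }
    where
    module N = Module N
    apply : Vector (Carrierᴹ M) d → Vector (Carrierᴹ N) d
    apply x j = fun (f j) (x j)

    go : Tensor d M → Tensor d N
    go (⨂ x)    = ⨂ (apply x)
    go 0ᵀ       = 0ᵀ
    go (x +ᵀ y) = go x +ᵀ go y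
    go (r ·ᵀ x) = r ·ᵀ go x

    apply-≔ : ∀ x j u w → N._≈ᴹ_ (fun (f j) u) w →
              ⨂ (apply (x [ j ]≔ u)) ≈ᵀ ⨂ (apply x [ j ]≔ w)
    apply-≔ x j u w p = ⨂-cong pointwise
      where
      pointwise : ∀ i → N._≈ᴹ_ (apply (x [ j ]≔ u) i) ((apply x [ j ]≔ w) i)
      pointwise i with i ≟ j
      ... | yes ≡.refl = N.≈ᴹ-trans
        (N.≈ᴹ-reflexive (≡.cong (fun (f j)) (updateAt-updates j x)))
        (N.≈ᴹ-trans p (N.≈ᴹ-reflexive (≡.sym (updateAt-updates j (apply x)))))
      ... | no i≢j = N.≈ᴹ-reflexive
        (≡.trans (≡.cong (fun (f i)) (updateAt-minimal i j x i≢j))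
                 (≡.sym (updateAt-minimal i j (apply x) i≢j)))

    go-cong : ∀ {x y} → x ≈ᵀ y → go x ≈ᵀ go y
    go-cong reflᵀ               = reflᵀ
    go-cong (symᵀ p)            = symᵀ (go-cong p)
    go-cong (transᵀ p q)        = transᵀ (go-cong p) (go-cong q)
    go-cong (+ᵀ-cong p q)       = +ᵀ-cong (go-cong p) (go-cong q)
    go-cong (·ᵀ-cong r p)       = ·ᵀ-cong r (go-cong p)
    go-cong (+ᵀ-assoc _ _ _)    = +ᵀ-assoc _ _ _
    go-cong (+ᵀ-comm _ _)       = +ᵀ-comm _ _
    go-cong (+ᵀ-identityˡ _)    = +ᵀ-identityˡ _
    go-cong (·ᵀ-zeroˡ _)        = ·ᵀ-zeroˡ _
    go-cong (·ᵀ-distribʳ _ _ _) = ·ᵀ-distribʳ _ _ _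
    go-cong (·ᵀ-distribˡ _ _ _) = ·ᵀ-distribˡ _ _ _
    go-cong (·ᵀ-identityˡ _)    = ·ᵀ-identityˡ _
    go-cong (·ᵀ-assoc _ _ _)    = ·ᵀ-assoc _ _ _
    go-cong (⨂-cong p)          = ⨂-cong λ j → LinearMap.f-cong (f j) (p j)
    go-cong (⨂-+ x j u v)       = transᵀ
      (apply-≔ x j _ _ (LinearMap.f-+ (f j) u v))
      (transᵀ (⨂-+ (apply x) j _ _)
        (+ᵀ-cong (symᵀ (apply-≔ x j u _ N.≈ᴹ-refl)) (symᵀ (apply-≔ x j v _ N.≈ᴹ-refl))))
    go-cong (⨂-· x j r u)       = transᵀ
      (apply-≔ x j _ _ (LinearMap.f-· (f j) r u))
      (transᵀ (⨂-· (apply x) j r _) (·ᵀ-cong refl (symᵀ (apply-≔ x j u _ N.≈ᴹ-refl))))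

  -- ⋀ V: the unital associative algebra generated by V
  -- subject to the linear relations of V and v ∧ v = 0, presented likewise.

  infixl 6 _+ᴱ_
  infixr 7 _·ᴱ_
  infixr 8 _∧_
  infix  4 _≈ᴱ_

  data Exterior (V : Mod) : Set where
    ι    : Carrierᴹ V → Exterior V
    0ᴱ   : Exterior V
    1ᴱ   : Exterior V
    _+ᴱ_ : Exterior V → Exterior V → Exterior V
    _·ᴱ_ : 𝕜 → Exterior V → Exterior V
    _∧_  : Exterior V → Exterior V → Exterior V

  data _≈ᴱ_ {V : Mod} : Exterior V → Exterior V → Set where
    reflᴱ        : ∀ {x} → x ≈ᴱ x
    symᴱ         : ∀ {x y} → x ≈ᴱ y → y ≈ᴱ x
    transᴱ       : ∀ {x y z} → x ≈ᴱ y → y ≈ᴱ z → x ≈ᴱ z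
    +ᴱ-cong      : ∀ {x x′ y y′} → x ≈ᴱ x′ → y ≈ᴱ y′ → x +ᴱ y ≈ᴱ x′ +ᴱ y′
    ·ᴱ-cong      : ∀ {r r′ x x′} → r ≈ r′ → x ≈ᴱ x′ → r ·ᴱ x ≈ᴱ r′ ·ᴱ x′
    ∧-cong       : ∀ {x x′ y y′} → x ≈ᴱ x′ → y ≈ᴱ y′ → x ∧ y ≈ᴱ x′ ∧ y′
    +ᴱ-assoc     : ∀ x y z → (x +ᴱ y) +ᴱ z ≈ᴱ x +ᴱ (y +ᴱ z)
    +ᴱ-comm      : ∀ x y → x +ᴱ y ≈ᴱ y +ᴱ x
    +ᴱ-identityˡ : ∀ x → 0ᴱ +ᴱ x ≈ᴱ x
    ·ᴱ-zeroˡ     : ∀ x → 0# ·ᴱ x ≈ᴱ 0ᴱ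
    ·ᴱ-distribʳ  : ∀ x r s → (r + s) ·ᴱ x ≈ᴱ r ·ᴱ x +ᴱ s ·ᴱ x
    ·ᴱ-distribˡ  : ∀ r x y → r ·ᴱ (x +ᴱ y) ≈ᴱ r ·ᴱ x +ᴱ r ·ᴱ y
    ·ᴱ-identityˡ : ∀ x → 1# ·ᴱ x ≈ᴱ x
    ·ᴱ-assoc     : ∀ r s x → (r * s) ·ᴱ x ≈ᴱ r ·ᴱ (s ·ᴱ x)
    ∧-assoc      : ∀ x y z → (x ∧ y) ∧ z ≈ᴱ x ∧ (y ∧ z)
    ∧-identityˡ  : ∀ x → 1ᴱ ∧ x ≈ᴱ x
    ∧-identityʳ  : ∀ x → x ∧ 1ᴱ ≈ᴱ x
    ∧-distribˡ   : ∀ x y z → x ∧ (y +ᴱ z) ≈ᴱ x ∧ y +ᴱ x ∧ z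
    ∧-distribʳ   : ∀ x y z → (y +ᴱ z) ∧ x ≈ᴱ y ∧ x +ᴱ z ∧ x
    ·ᴱ-∧ˡ        : ∀ r x y → (r ·ᴱ x) ∧ y ≈ᴱ r ·ᴱ (x ∧ y)
    ·ᴱ-∧ʳ        : ∀ r x y → x ∧ (r ·ᴱ y) ≈ᴱ r ·ᴱ (x ∧ y)
    ι-cong       : ∀ {u v} → Module._≈ᴹ_ V u v → ι u ≈ᴱ ι v
    ι-+          : ∀ u v → ι (Module._+ᴹ_ V u v) ≈ᴱ ι u +ᴱ ι v
    ι-·          : ∀ r v → ι (Module._*ₗ_ V r v) ≈ᴱ r ·ᴱ ι v
    ι-square     : ∀ v → ι v ∧ ι v ≈ᴱ 0ᴱ

  ⋀ : Mod → Mod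
  ⋀ V = toModule {A = Exterior V} {_≈ᴱ_} {_+ᴱ_} {0ᴱ} {_·ᴱ_} record
    { ≋-isEquivalence = record { refl = reflᴱ ; sym = symᴱ ; trans = transᴱ }
    ; ⊕-cong = +ᴱ-cong
    ; ·-cong = ·ᴱ-cong
    ; ⊕-assoc = +ᴱ-assoc
    ; ⊕-comm = +ᴱ-comm
    ; ⊕-identityˡ = +ᴱ-identityˡ
    ; ·-zeroˡ = ·ᴱ-zeroˡ
    ; ·-distribʳ = ·ᴱ-distribʳ
    ; ·-distribˡ = ·ᴱ-distribˡ
    ; ·-identityˡ = ·ᴱ-identityˡ
    ; ·-assoc = ·ᴱ-assoc
    }

  exteriorMap : ∀ {V W} → LinearMap V W → LinearMap (⋀ V) (⋀ W)
  exteriorMap {V} {W} f = record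
    { fun = go
    ; isLinear = record { f-cong = go-cong ; f-+ = λ _ _ → reflᴱ ; f-· = λ _ _ → reflᴱ }
    }
    where
    go : Exterior V → Exterior W
    go (ι v)    = ι (fun f v)
    go 0ᴱ       = 0ᴱ
    go 1ᴱ       = 1ᴱ
    go (x +ᴱ y) = go x +ᴱ go y
    go (r ·ᴱ x) = r ·ᴱ go x
    go (x ∧ y)  = go x ∧ go y

    go-cong : ∀ {x y} → x ≈ᴱ y → go x ≈ᴱ go y
    go-cong reflᴱ               = reflᴱ
    go-cong (symᴱ p)            = symᴱ (go-cong p)
    go-cong (transᴱ p q)        = transᴱ (go-cong p) (go-cong q)
    go-cong (+ᴱ-cong p q)       = +ᴱ-cong (go-cong p) (go-cong q)
    go-cong (·ᴱ-cong r p)       = ·ᴱ-cong r (go-cong p)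
    go-cong (∧-cong p q)        = ∧-cong (go-cong p) (go-cong q)
    go-cong (+ᴱ-assoc _ _ _)    = +ᴱ-assoc _ _ _
    go-cong (+ᴱ-comm _ _)       = +ᴱ-comm _ _
    go-cong (+ᴱ-identityˡ _)    = +ᴱ-identityˡ _
    go-cong (·ᴱ-zeroˡ _)        = ·ᴱ-zeroˡ _
    go-cong (·ᴱ-distribʳ _ _ _) = ·ᴱ-distribʳ _ _ _
    go-cong (·ᴱ-distribˡ _ _ _) = ·ᴱ-distribˡ _ _ _
    go-cong (·ᴱ-identityˡ _)    = ·ᴱ-identityˡ _
    go-cong (·ᴱ-assoc _ _ _)    = ·ᴱ-assoc _ _ _
    go-cong (∧-assoc _ _ _)     = ∧-assoc _ _ _
    go-cong (∧-identityˡ _)     = ∧-identityˡ _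
    go-cong (∧-identityʳ _)     = ∧-identityʳ _
    go-cong (∧-distribˡ _ _ _)  = ∧-distribˡ _ _ _
    go-cong (∧-distribʳ _ _ _)  = ∧-distribʳ _ _ _
    go-cong (·ᴱ-∧ˡ _ _ _)       = ·ᴱ-∧ˡ _ _ _
    go-cong (·ᴱ-∧ʳ _ _ _)       = ·ᴱ-∧ʳ _ _ _
    go-cong (ι-cong p)          = ι-cong (LinearMap.f-cong f p)
    go-cong (ι-+ u v)           = transᴱ (ι-cong (LinearMap.f-+ f u v)) (ι-+ _ _)
    go-cong (ι-· r v)           = transᴱ (ι-cong (LinearMap.f-· f r v)) (ι-· r _)
    go-cong (ι-square v)        = ι-square _

  ⋀ᵢ : ∀ {V n} → Vector (Exterior V) n → Exterior V
  ⋀ᵢ {n = zero}  x = 1ᴱ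
  ⋀ᵢ {n = suc n} x = x zero ∧ ⋀ᵢ (x ∘ suc)

  Σᴱ : ∀ {V} {I : Set} → List I → (I → Exterior V) → Exterior V
  Σᴱ []      f = 0ᴱ
  Σᴱ (x ∷ L) f = f x +ᴱ Σᴱ L f

  V : ℕ → ℕ → Mod
  V d n = TensorPower d (𝕜^ n)

  -- A d-tuple of n × n matrices acts on pure tensors factor by factor and
  -- on wedge products diagonally; the action of GL(n)^d is the restriction
  -- to invertible matrices.
  act : ∀ {d n} → (Fin d → Matrix n) → LinearMap (⋀ (V d n)) (⋀ (V d n))
  act g = exteriorMap (tensorMap (matrixMap ∘ g))

  infixr 8 _•_
  _•_ : ∀ {d n} → (Fin d → Matrix n) → Exterior (V d n) → Exterior (V d n)
  g • v = fun (act g) v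

  record Unit : Set where
    field
      value inverse : 𝕜
      value*inverse : value * inverse ≈ 1#
  open Unit public

  infixr 8 _^ᶻ_
  _^ᶻ_ : Unit → ℤ → 𝕜
  a ^ᶻ (+ m)    = value a ^ m
  a ^ᶻ -[1+ m ] = inverse a ^ suc m

  diag : ∀ {n} → (Fin n → Unit) → Matrix n
  diag a i j = if does (i ≟ j) then value (a i) else 0#

  record IsUpperUnitriangular {n} (u : Matrix n) : Set where
    field
      on-diagonal : ∀ i → u i i ≈ 1#
      below       : ∀ {i j} → j Fin.< i → u i j ≈ 0#

  Weight : ℕ → ℕ → Set
  Weight d n = Fin d → Fin n → ℤ

  IsWeightVector : ∀ {d n} → Weight d n → Exterior (V d n) → Set
  IsWeightVector {d} {n} μ v = (a : Fin d → Fin n → Unit) →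
    (λ j → diag (a j)) • v ≈ᴱ ∏ (λ j → ∏ (λ i → a j i ^ᶻ μ j i)) ·ᴱ v

  IsUnipotentInvariant : ∀ {d n} → Exterior (V d n) → Set
  IsUnipotentInvariant {d} {n} v = (u : Fin d → Matrix n) →
    (∀ j → IsUpperUnitriangular (u j)) → u • v ≈ᴱ v

  -- The vector 0 satisfies both conditions, so it belongs to every HWV space.
  record HWV (d n : ℕ) (μ : Weight d n) : Set where
    field
      vector    : Exterior (V d n)
      weight    : IsWeightVector μ vector
      invariant : IsUnipotentInvariant vector
  open HWV public

  infix 4 _≈ᴴ_
  _≈ᴴ_ : ∀ {d n μ} → HWV d n μ → HWV d n μ → Set
  v ≈ᴴ w = vector v ≈ᴱ vector w

  sgn : ∀ {n m} → Vec (Fin n) m → 𝕜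
  sgn π = (- 1#) ^ inversions π

  -- ⋀ᵢ x₁(π₁(i)) ⊗ ⋯ ⊗ x_d(π_d(i))
  cayleyTerm : ∀ {d n} → (Fin d → Fin n → Vector 𝕜 n) → Vec (Vec (Fin n) n) d → Exterior (V d n)
  cayleyTerm x π = ⋀ᵢ λ i → ι (⨂ λ j → x j (lookup (lookup π j) i))

  -- The Cayley form with an arbitrary n-tuple of vectors in each tensor slot;
  -- sgn(π₁⋯π_d) is written as the product of the signs of the π_j.
  cayleySum : ∀ {d n} → (Fin d → Fin n → Vector 𝕜 n) → Exterior (V d n)
  cayleySum {d} {n} x = Σᴱ (tuples d (permutations n)) λ π →
    ∏ (λ j → sgn (lookup π j)) ·ᴱ cayleyTerm x π

  ω : ∀ d n → Exterior (V d n)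
  ω d n = cayleySum λ _ → e

  module ≈ᴱ-Reasoning {V : Mod} = SetoidReasoning (Module.≈ᴹ-setoid (⋀ V))

  reflexiveᴱ : ∀ {V} {x y : Exterior V} → x ≡ y → x ≈ᴱ y
  reflexiveᴱ ≡.refl = reflᴱ

  sumᴱ : ∀ {V n} → Vector (Exterior V) n → Exterior V
  sumᴱ {V} = CMSum.sum (Module.+ᴹ-commutativeMonoid (⋀ V))

  +ᴱ-identityʳ : ∀ {V} (x : Exterior V) → x +ᴱ 0ᴱ ≈ᴱ x
  +ᴱ-identityʳ {V} = Module.+ᴹ-identityʳ (⋀ V)

  ·ᴱ-zeroʳ : ∀ {V} r → r ·ᴱ 0ᴱ ≈ᴱ 0ᴱ {V}
  ·ᴱ-zeroʳ {V} = Module.*ₗ-zeroʳ (⋀ V)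

  interchangeᴱ : ∀ {V} (x y z w : Exterior V) → (x +ᴱ y) +ᴱ (z +ᴱ w) ≈ᴱ (x +ᴱ z) +ᴱ (y +ᴱ w)
  interchangeᴱ x y z w = transᴱ (+ᴱ-assoc x y _) (transᴱ (+ᴱ-cong reflᴱ
    (transᴱ (symᴱ (+ᴱ-assoc y z w)) (transᴱ (+ᴱ-cong (+ᴱ-comm y z) reflᴱ) (+ᴱ-assoc z y w))))
    (symᴱ (+ᴱ-assoc x z _)))

  Σᴱ-cong-All : ∀ {V} {I : Set} {P : I → Set} {L} {f g : I → Exterior V} → All P L →
                (∀ x → P x → f x ≈ᴱ g x) → Σᴱ L f ≈ᴱ Σᴱ L g
  Σᴱ-cong-All []       h = reflᴱ
  Σᴱ-cong-All (p ∷ ps) h = +ᴱ-cong (h _ p) (Σᴱ-cong-All ps h)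

  Σᴱ-cong : ∀ {V} {I : Set} (L : List I) {f g : I → Exterior V} →
            (∀ x → f x ≈ᴱ g x) → Σᴱ L f ≈ᴱ Σᴱ L g
  Σᴱ-cong []      h = reflᴱ
  Σᴱ-cong (x ∷ L) h = +ᴱ-cong (h x) (Σᴱ-cong L h)

  Σᴱ-++ : ∀ {V} {I : Set} (L L′ : List I) (f : I → Exterior V) →
          Σᴱ (L List.++ L′) f ≈ᴱ Σᴱ L f +ᴱ Σᴱ L′ f
  Σᴱ-++ []      L′ f = symᴱ (+ᴱ-identityˡ _)
  Σᴱ-++ (x ∷ L) L′ f = transᴱ (+ᴱ-cong reflᴱ (Σᴱ-++ L L′ f)) (symᴱ (+ᴱ-assoc _ _ _))

  Σᴱ-map : ∀ {V} {I J : Set} (h : I → J) (L : List I) (f : J → Exterior V) →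
           Σᴱ (List.map h L) f ≈ᴱ Σᴱ L (f ∘ h)
  Σᴱ-map h []      f = reflᴱ
  Σᴱ-map h (x ∷ L) f = +ᴱ-cong reflᴱ (Σᴱ-map h L f)

  Σᴱ-product : ∀ {V} {I : Set} {m} (L : List I) (M : List (Vec I m)) (f : Vec I (suc m) → Exterior V) →
               Σᴱ (cartesianProductWith _∷_ L M) f ≈ᴱ Σᴱ L λ x → Σᴱ M λ v → f (x ∷ v)
  Σᴱ-product []      M f = reflᴱ
  Σᴱ-product (x ∷ L) M f = transᴱ (Σᴱ-++ (List.map (x ∷_) M) _ f)
    (+ᴱ-cong (Σᴱ-map (x ∷_) M f) (Σᴱ-product L M f))

  Σᴱ-filter : ∀ {V} {I : Set} {P : I → Set} (P? : ∀ x → Dec (P x)) (L : List I) (f : I → Exterior V) →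
              Σᴱ (filter P? L) f ≈ᴱ Σᴱ L λ x → if does (P? x) then f x else 0ᴱ
  Σᴱ-filter P? []      f = reflᴱ
  Σᴱ-filter P? (x ∷ L) f with does (P? x)
  ... | true  = +ᴱ-cong reflᴱ (Σᴱ-filter P? L f)
  ... | false = transᴱ (Σᴱ-filter P? L f) (symᴱ (+ᴱ-identityˡ _))

  Σᴱ-· : ∀ {V} {I : Set} r (L : List I) (f : I → Exterior V) →
         Σᴱ L (λ x → r ·ᴱ f x) ≈ᴱ r ·ᴱ Σᴱ L f
  Σᴱ-· r []      f = symᴱ (·ᴱ-zeroʳ r)
  Σᴱ-· r (x ∷ L) f = transᴱ (+ᴱ-cong reflᴱ (Σᴱ-· r L f)) (symᴱ (·ᴱ-distribˡ r _ _))

  Σᴱ-+ : ∀ {V} {I : Set} (L : List I) (f g : I → Exterior V) →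
         Σᴱ L (λ x → f x +ᴱ g x) ≈ᴱ Σᴱ L f +ᴱ Σᴱ L g
  Σᴱ-+ []      f g = symᴱ (+ᴱ-identityˡ _)
  Σᴱ-+ (x ∷ L) f g = transᴱ (+ᴱ-cong reflᴱ (Σᴱ-+ L f g)) (interchangeᴱ _ _ _ _)

  Σᴱ-linear : ∀ {M V} {I : Set} {P : I → Set} {L} {f : I → Carrierᴹ M → Exterior V} → All P L →
              (∀ x → P x → IsLinear M (⋀ V) (f x)) → IsLinear M (⋀ V) (λ w → Σᴱ L (λ x → f x w))
  Σᴱ-linear ps h = record
    { f-cong = λ p → Σᴱ-cong-All ps λ x px → IsLinear.f-cong (h x px) p
    ; f-+ = λ u w → transᴱ (Σᴱ-cong-All ps λ x px → IsLinear.f-+ (h x px) u w) (Σᴱ-+ _ _ _)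
    ; f-· = λ r w → transᴱ (Σᴱ-cong-All ps λ x px → IsLinear.f-· (h x px) r w) (Σᴱ-· r _ _)
    }

  Σᴱ-allFin : ∀ {V n} (f : Fin n → Exterior V) → Σᴱ (allFin n) f ≡ sumᴱ f
  Σᴱ-allFin {V} {n} f = go (λ i → i)
    where
    go : ∀ {m} (g : Fin m → Fin n) → Σᴱ (List.tabulate g) f ≡ sumᴱ (f ∘ g)
    go {zero}  g = ≡.refl
    go {suc m} g = ≡.cong (f (g zero) +ᴱ_) (go (g ∘ suc))

  module _ {n} (a b : Fin n) where

    private
      τ = transpose a b

      τ-injective : ∀ {x y} → τ x ≡ τ y → x ≡ y
      τ-injective {x} {y} p = ≡.trans (≡.sym (transpose-inverse b a))
        (≡.trans (≡.cong (transpose b a) p) (transpose-inverse b a))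

    Σᴱ-transpose : ∀ {V} (f : Fin n → Exterior V) → Σᴱ (allFin n) (f ∘ τ) ≈ᴱ Σᴱ (allFin n) f
    Σᴱ-transpose {V} f = transᴱ (reflexiveᴱ (Σᴱ-allFin (f ∘ τ))) (transᴱ
      (symᴱ (CMSum.sum-permute (Module.+ᴹ-commutativeMonoid (⋀ V)) f (Perm.transpose a b)))
      (reflexiveᴱ (≡.sym (Σᴱ-allFin f))))

    Σᴱ-tuples-transpose : ∀ {V} m (f : Vec (Fin n) m → Exterior V) →
      Σᴱ (tuples m (allFin n)) (f ∘ Vec.map τ) ≈ᴱ Σᴱ (tuples m (allFin n)) f
    Σᴱ-tuples-transpose zero    f = reflᴱ
    Σᴱ-tuples-transpose (suc m) f = transᴱ (Σᴱ-product (allFin n) T _) (transᴱ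
      (Σᴱ-cong (allFin n) λ x → Σᴱ-tuples-transpose m λ v → f (τ x ∷ v)) (transᴱ
      (Σᴱ-transpose λ x → Σᴱ T λ v → f (x ∷ v))
      (symᴱ (Σᴱ-product (allFin n) T f))))
      where T = tuples m (allFin n)

    Σᴱ-permutations-transpose : ∀ {V} (f : Vec (Fin n) n → Exterior V) →
      Σᴱ (permutations n) (f ∘ Vec.map τ) ≈ᴱ Σᴱ (permutations n) f
    Σᴱ-permutations-transpose f = transᴱ (Σᴱ-filter unique? T _) (transᴱ
      (Σᴱ-cong T λ v → reflexiveᴱ
        (≡.cong (λ q → if q then f (Vec.map τ v) else 0ᴱ) (same v)))
      (transᴱ (Σᴱ-tuples-transpose n λ v → if does (unique? v) then f v else 0ᴱ)
      (symᴱ (Σᴱ-filter unique? T f))))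
      where
      T = tuples n (allFin n)
      unmap : ∀ {m} (v : Vec (Fin n) m) → Vec.map (transpose b a) (Vec.map τ v) ≡ v
      unmap v = ≡.trans (≡.sym (Vecₚ.map-∘ (transpose b a) τ v))
        (≡.trans (Vecₚ.map-cong (λ _ → transpose-inverse b a) v) (Vecₚ.map-id v))
      inj′ : ∀ {x y} → transpose b a x ≡ transpose b a y → x ≡ y
      inj′ p = ≡.trans (≡.sym (transpose-inverse a b))
        (≡.trans (≡.cong τ p) (transpose-inverse a b))
      same : ∀ {m} (v : Vec (Fin n) m) → does (unique? v) ≡ does (unique? (Vec.map τ v))
      same v with unique? v
      ... | yes u = ≡.sym (dec-true (unique? _) (Uniqueₚ.map⁺ τ-injective u))
      ... | no ¬u = ≡.sym (dec-false (unique? _)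
        λ u → ¬u (≡.subst Unique (unmap v) (Uniqueₚ.map⁺ inj′ u)))

  Σᴱ-tuples-updateAt : ∀ {V} {I : Set} {L : List I} {φ : I → I} →
    (∀ (f : I → Exterior V) → Σᴱ L (f ∘ φ) ≈ᴱ Σᴱ L f) →
    ∀ {m} j (f : Vec I m → Exterior V) →
    Σᴱ (tuples m L) (λ v → f (Vec.updateAt v j φ)) ≈ᴱ Σᴱ (tuples m L) f
  Σᴱ-tuples-updateAt {L = L} {φ} h {suc m} zero f = transᴱ (Σᴱ-product L T _) (transᴱ
    (h λ x → Σᴱ T λ v → f (x ∷ v)) (symᴱ (Σᴱ-product L T f)))
    where T = tuples m L
  Σᴱ-tuples-updateAt {L = L} {φ} h {suc m} (suc j) f = transᴱ (Σᴱ-product L T _) (transᴱ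
    (Σᴱ-cong L λ x → Σᴱ-tuples-updateAt h j λ v → f (x ∷ v)) (symᴱ (Σᴱ-product L T f)))
    where T = tuples m L

  ∘-linear : ∀ {M N P f g} → IsLinear N P g → IsLinear M N f → IsLinear M P (g ∘ f)
  ∘-linear {P = P} G F = record
    { f-cong = λ p → IsLinear.f-cong G (IsLinear.f-cong F p)
    ; f-+ = λ x y → Module.≈ᴹ-trans P (IsLinear.f-cong G (IsLinear.f-+ F x y)) (IsLinear.f-+ G _ _)
    ; f-· = λ r x → Module.≈ᴹ-trans P (IsLinear.f-cong G (IsLinear.f-· F r x)) (IsLinear.f-· G r _)
    }

  ≗-linear : ∀ {M N f g} → (∀ w → Module._≈ᴹ_ N (f w) (g w)) → IsLinear M N g → IsLinear M N f
  ≗-linear {M} {N} h G = record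
    { f-cong = λ p → h _ ⟨≈⟩ IsLinear.f-cong G p ⟨≈⟩ N.≈ᴹ-sym (h _)
    ; f-+ = λ x y → h _ ⟨≈⟩ IsLinear.f-+ G x y ⟨≈⟩ N.≈ᴹ-sym (N.+ᴹ-cong (h x) (h y))
    ; f-· = λ r x → h _ ⟨≈⟩ IsLinear.f-· G r x ⟨≈⟩ N.≈ᴹ-sym (N.*ₗ-cong refl (h x))
    }
    where
    module N = Module N
    infixr 2 _⟨≈⟩_
    _⟨≈⟩_ = N.≈ᴹ-trans

  ι-linear : ∀ {V} → IsLinear V (⋀ V) ι
  ι-linear = record { f-cong = ι-cong ; f-+ = ι-+ ; f-· = ι-· }

  ·-linear : ∀ {V} s → IsLinear (⋀ V) (⋀ V) (s ·ᴱ_)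
  ·-linear s = record
    { f-cong = ·ᴱ-cong refl
    ; f-+ = ·ᴱ-distribˡ s
    ; f-· = λ r x → transᴱ (symᴱ (·ᴱ-assoc s r x))
                      (transᴱ (·ᴱ-cong (*-comm s r) reflᴱ) (·ᴱ-assoc r s x))
    }

  ⨂-linear : ∀ {d M} (x : Vector (Carrierᴹ M) d) j →
             IsLinear M (TensorPower d M) (λ u → ⨂ (x [ j ]≔ u))
  ⨂-linear {M = M} x j = record
    { f-cong = λ p → ⨂-cong (pointwise p) ; f-+ = ⨂-+ x j ; f-· = ⨂-· x j }
    where
    pointwise : ∀ {u v} → Module._≈ᴹ_ M u v → ∀ i → Module._≈ᴹ_ M ((x [ j ]≔ u) i) ((x [ j ]≔ v) i)
    pointwise {u} {v} p i with i ≟ j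
    ... | yes ≡.refl rewrite updateAt-updates j {λ _ → u} x | updateAt-updates j {λ _ → v} x = p
    ... | no i≢j rewrite updateAt-minimal i j {λ _ → u} x i≢j
                       | updateAt-minimal i j {λ _ → v} x i≢j = Module.≈ᴹ-refl M

  ⋀ᵢ-cong : ∀ {V n} {x y : Vector (Exterior V) n} → (∀ i → x i ≈ᴱ y i) → ⋀ᵢ x ≈ᴱ ⋀ᵢ y
  ⋀ᵢ-cong {n = zero}  p = reflᴱ
  ⋀ᵢ-cong {n = suc n} p = ∧-cong (p zero) (⋀ᵢ-cong (p ∘ suc))

  ⋀ᵢ-linear : ∀ {V n} (x : Vector (Exterior V) n) i →
              IsLinear (⋀ V) (⋀ V) (λ w → ⋀ᵢ (x [ i ]≔ w))
  ⋀ᵢ-linear x zero = record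
    { f-cong = λ p → ∧-cong p reflᴱ
    ; f-+ = λ u v → ∧-distribʳ _ u v
    ; f-· = λ r u → ·ᴱ-∧ˡ r u _
    }
  ⋀ᵢ-linear {V} x (suc i) = ∘-linear {⋀ V} {⋀ V} {⋀ V} record
    { f-cong = ∧-cong reflᴱ
    ; f-+ = ∧-distribˡ (x zero)
    ; f-· = λ r u → ·ᴱ-∧ʳ r (x zero) u
    } (⋀ᵢ-linear (x ∘ suc) i)

  module _ {d n : ℕ} where

    Columns : Set
    Columns = Fin n → Vector 𝕜 n

    infix 4 _≋_
    _≋_ : Vector 𝕜 n → Vector 𝕜 n → Set
    _≋_ = Module._≈ᴹ_ (𝕜^ n)

    ≋-reflexive : ∀ {x y} → x ≡ y → x ≋ y
    ≋-reflexive = Module.≈ᴹ-reflexive (𝕜^ n)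

    AllUnique : Vec (Vec (Fin n) n) d → Set
    AllUnique π = ∀ j → Unique (lookup π j)

    allUnique : All AllUnique (tuples d (permutations n))
    allUnique = all-tuples d (all-permutations n)

    cayleyTerm-cong : ∀ {x y : Fin d → Columns} → (∀ j i → x j i ≋ y j i) →
                      ∀ π → cayleyTerm x π ≈ᴱ cayleyTerm y π
    cayleyTerm-cong p π = ⋀ᵢ-cong λ i → ι-cong (⨂-cong λ j → p j _)

    cayleySum-cong : ∀ {x y : Fin d → Columns} → (∀ j i → x j i ≋ y j i) →
                     cayleySum x ≈ᴱ cayleySum y
    cayleySum-cong p = Σᴱ-cong (tuples d (permutations n)) λ π → ·ᴱ-cong refl (cayleyTerm-cong p π)

    ≔-cong : ∀ (x : Fin d → Columns) j {y z : Columns} → (∀ i → y i ≋ z i) →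
             ∀ j′ i → (x [ j ]≔ y) j′ i ≋ (x [ j ]≔ z) j′ i
    ≔-cong x j {y} {z} p j′ i with j′ ≟ j
    ... | yes ≡.refl rewrite updateAt-updates j {λ _ → y} x | updateAt-updates j {λ _ → z} x = p i
    ... | no j′≢j rewrite updateAt-minimal j′ j {λ _ → y} x j′≢j
                        | updateAt-minimal j′ j {λ _ → z} x j′≢j = λ _ → refl

    cayleyTerm-linear : ∀ (x : Fin d → Columns) j y a π → AllUnique π →
      IsLinear (𝕜^ n) (⋀ (V d n)) (λ w → cayleyTerm (x [ j ]≔ (y [ a ]≔ w)) π)
    cayleyTerm-linear x j y a π u with unique⇒surjective (u j) a
    ... | i₀ , π[i₀]≡a = ≗-linear {𝕜^ n} {⋀ (V d n)} (λ w → ⋀ᵢ-cong (factor w))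
            (∘-linear {𝕜^ n} {⋀ (V d n)} {⋀ (V d n)} (⋀ᵢ-linear z i₀)
              (∘-linear {𝕜^ n} {V d n} {⋀ (V d n)} ι-linear (⨂-linear x₀ j)))
      where
      at : Fin d → Fin n → Fin n
      at j′ i = lookup (lookup π j′) i
      z : Vector (Exterior (V d n)) n
      z i = ι (⨂ λ j′ → (x [ j ]≔ y) j′ (at j′ i))
      x₀ : Vector (Vector 𝕜 n) d
      x₀ j′ = (x [ j ]≔ y) j′ (at j′ i₀)
      inner : ∀ w j′ → (x [ j ]≔ (y [ a ]≔ w)) j′ (at j′ i₀) ≡ (x₀ [ j ]≔ w) j′
      inner w j′ with j′ ≟ j
      ... | yes ≡.refl = ≡.trans (≡.cong (λ f → f (at j i₀)) (updateAt-updates j x))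
        (≡.trans (≡.cong (y [ a ]≔ w) π[i₀]≡a)
        (≡.trans (updateAt-updates a y) (≡.sym (updateAt-updates j x₀))))
      ... | no j′≢j = ≡.trans (≡.cong (λ f → f (at j′ i₀)) (updateAt-minimal j′ j x j′≢j))
        (≡.trans (≡.cong (λ f → f (at j′ i₀)) (≡.sym (updateAt-minimal j′ j x j′≢j)))
        (≡.sym (updateAt-minimal j′ j x₀ j′≢j)))
      outer : ∀ w i → i ≢ i₀ → ∀ j′ →
              (x [ j ]≔ (y [ a ]≔ w)) j′ (at j′ i) ≡ (x [ j ]≔ y) j′ (at j′ i)
      outer w i i≢i₀ j′ with j′ ≟ j
      ... | yes ≡.refl = ≡.trans (≡.cong (λ f → f (at j i)) (updateAt-updates j x))
        (≡.trans (updateAt-minimal (at j i) a y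
          λ e → i≢i₀ (lookup-injective (u j) i i₀ (≡.trans e (≡.sym π[i₀]≡a))))
        (≡.cong (λ f → f (at j i)) (≡.sym (updateAt-updates j x))))
      ... | no j′≢j = ≡.cong (λ f → f (at j′ i))
        (≡.trans (updateAt-minimal j′ j x j′≢j) (≡.sym (updateAt-minimal j′ j x j′≢j)))
      factor : ∀ w i → ι (⨂ λ j′ → (x [ j ]≔ (y [ a ]≔ w)) j′ (at j′ i))
                         ≈ᴱ (z [ i₀ ]≔ ι (⨂ (x₀ [ j ]≔ w))) i
      factor w i with i ≟ i₀
      ... | yes ≡.refl = transᴱ (ι-cong (⨂-cong λ j′ → ≋-reflexive (inner w j′)))
                                (reflexiveᴱ (≡.sym (updateAt-updates i₀ z)))
      ... | no i≢i₀ = transᴱ (ι-cong (⨂-cong λ j′ → ≋-reflexive (outer w i i≢i₀ j′)))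
                             (reflexiveᴱ (≡.sym (updateAt-minimal i i₀ z i≢i₀)))

    cayleySum-linear : ∀ (x : Fin d → Columns) j y a →
      IsLinear (𝕜^ n) (⋀ (V d n)) (λ w → cayleySum (x [ j ]≔ (y [ a ]≔ w)))
    cayleySum-linear x j y a = Σᴱ-linear {𝕜^ n} {V d n} allUnique λ π u →
      ∘-linear {𝕜^ n} {⋀ (V d n)} {⋀ (V d n)} (·-linear _) (cayleyTerm-linear x j y a π u)

  -1*-1* : ∀ x → (- 1#) * ((- 1#) * x) ≈ x
  -1*-1* x = trans (-1*x≈-x _) (trans (-‿cong (-1*x≈-x x)) (-‿involutive x))
    where open RingProperties ring

  ∏-flip : ∀ {d} (f g : Vector 𝕜 d) j → f j ≈ (- 1#) * g j → (∀ i → i ≢ j → f i ≈ g i) →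
           ∏ f ≈ (- 1#) * ∏ g
  ∏-flip f g zero    p q = trans (*-cong p (∏-cong λ i → q (suc i) λ ())) (*-assoc _ _ _)
  ∏-flip f g (suc j) p q = trans
    (*-cong (q zero λ ()) (∏-flip (f ∘ suc) (g ∘ suc) j p λ i i≢j → q (suc i) λ { ≡.refl → i≢j ≡.refl }))
    (trans (sym (*-assoc _ _ _)) (trans (*-congʳ (*-comm _ _)) (*-assoc _ _ _)))

  module _ {n : ℕ} (a : Fin n) where

    lower upper : Fin (suc n)
    lower = inject₁ a
    upper = suc a

    σ : Fin (suc n) → Fin (suc n)
    σ = transpose lower upper

    upper≡1+lower : toℕ upper ≡ suc (toℕ lower)
    upper≡1+lower = ≡.cong suc (≡.sym (Finₚ.toℕ-inject₁ a))

    lower≢upper : lower ≢ upper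
    lower≢upper e = ℕₚ.1+n≢n (≡.trans (≡.sym upper≡1+lower) (≡.cong toℕ (≡.sym e)))

    σ-lower : σ lower ≡ upper
    σ-lower rewrite dec-true (lower ≟ lower) ≡.refl = ≡.refl

    σ-upper : σ upper ≡ lower
    σ-upper rewrite dec-false (upper ≟ lower) (lower≢upper ∘ ≡.sym)
                  | dec-true (upper ≟ upper) ≡.refl = ≡.refl

    σ-fix : ∀ x → x ≢ lower → x ≢ upper → σ x ≡ x
    σ-fix x p q rewrite dec-false (x ≟ lower) p | dec-false (x ≟ upper) q = ≡.refl

    sgn-σ : ∀ (v : Vec (Fin (suc n)) (suc n)) → Unique v → sgn v ≈ (- 1#) * sgn (Vec.map σ v)
    sgn-σ v u with inversions-swap σ lower upper upper≡1+lower σ-lower σ-upper σ-fix v u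
    ... | inj₁ e rewrite e = sym (-1*-1* (sgn v))
    ... | inj₂ e rewrite e = refl

    cayleySum-swap : ∀ {d} (x : Fin d → Fin (suc n) → Vector 𝕜 (suc n)) j y →
      cayleySum (x [ j ]≔ (y ∘ σ)) ≈ᴱ (- 1#) ·ᴱ cayleySum (x [ j ]≔ y)
    cayleySum-swap {d} x j y = begin
      cayleySum (x [ j ]≔ (y ∘ σ))
        ≈⟨ Σᴱ-cong-All allUnique (λ π u → transᴱ (·ᴱ-cong (signs π u) (terms π)) (·ᴱ-assoc _ _ _)) ⟩
      Σᴱ L (λ π → (- 1#) ·ᴱ F (swapped π))
        ≈⟨ Σᴱ-· (- 1#) L (F ∘ swapped) ⟩
      (- 1#) ·ᴱ Σᴱ L (F ∘ swapped)
        ≈⟨ ·ᴱ-cong refl (Σᴱ-tuples-updateAt (Σᴱ-permutations-transpose lower upper) j F) ⟩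
      (- 1#) ·ᴱ Σᴱ L F ∎
      where
      open ≈ᴱ-Reasoning
      L = tuples d (permutations (suc n))
      swapped : Vec (Vec (Fin (suc n)) (suc n)) d → Vec (Vec (Fin (suc n)) (suc n)) d
      swapped π = Vec.updateAt π j (Vec.map σ)
      F : Vec (Vec (Fin (suc n)) (suc n)) d → Exterior (V d (suc n))
      F π = ∏ (λ j′ → sgn (lookup π j′)) ·ᴱ cayleyTerm (x [ j ]≔ y) π
      signs : ∀ π → AllUnique π →
        ∏ (λ j′ → sgn (lookup π j′)) ≈ (- 1#) * ∏ (λ j′ → sgn (lookup (swapped π) j′))
      signs π u = ∏-flip _ _ j
        (trans (sgn-σ (lookup π j) (u j))
          (*-congˡ (reflexive (≡.cong sgn (≡.sym (Vecₚ.lookup∘updateAt j π))))))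
        (λ i i≢j → reflexive (≡.cong sgn (≡.sym (Vecₚ.lookup∘updateAt′ i j i≢j π))))
      terms : ∀ π → cayleyTerm (x [ j ]≔ (y ∘ σ)) π ≈ᴱ cayleyTerm (x [ j ]≔ y) (swapped π)
      terms π = ⋀ᵢ-cong λ i → ι-cong (⨂-cong λ j′ → ≋-reflexive {d} (entry i j′))
        where
        entry : ∀ i j′ → (x [ j ]≔ (y ∘ σ)) j′ (lookup (lookup π j′) i)
                           ≡ (x [ j ]≔ y) j′ (lookup (lookup (swapped π) j′) i)
        entry i j′ with j′ ≟ j
        ... | yes ≡.refl = ≡.trans (≡.cong (λ h → h (lookup (lookup π j) i)) (updateAt-updates j x))
          (≡.trans (≡.cong y (≡.sym (≡.trans
            (≡.cong (λ v → lookup v i) (Vecₚ.lookup∘updateAt j π))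
            (Vecₚ.lookup-map i σ (lookup π j)))))
          (≡.cong (λ h → h (lookup (lookup (swapped π) j) i)) (≡.sym (updateAt-updates j x))))
        ... | no j′≢j = ≡.trans (≡.cong (λ h → h (lookup (lookup π j′) i)) (updateAt-minimal j′ j x j′≢j))
          (≡.trans (≡.cong y′ (≡.cong (λ v → lookup v i) (≡.sym (Vecₚ.lookup∘updateAt′ j′ j j′≢j π))))
          (≡.cong (λ h → h (lookup (lookup (swapped π) j′) i)) (≡.sym (updateAt-minimal j′ j x j′≢j))))
          where y′ = x j′

  -- A linear function on 𝕜ⁿ is determined by its values on the basis.
  expand : ∀ {V n f} → IsLinear (𝕜^ n) (⋀ V) f → ∀ x → f x ≈ᴱ sumᴱ (λ k → x k ·ᴱ f (e k))
  expand {V} {zero}  {f} F x = transᴱ (IsLinear.f-cong F {x} {λ i → 0# * x i} λ ())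
    (transᴱ (IsLinear.f-· F 0# x) (·ᴱ-zeroˡ _))
  expand {V} {suc n} {f} F x = transᴱ (IsLinear.f-cong F split) (transᴱ (IsLinear.f-+ F _ _)
    (+ᴱ-cong (IsLinear.f-· F (x zero) (e zero))
      (transᴱ (expand (∘-linear {𝕜^ n} {𝕜^ (suc n)} {⋀ V} F shift-linear) (x ∘ suc))
        (CMSum.sum-cong-≋ (Module.+ᴹ-commutativeMonoid (⋀ V))
          λ k → ·ᴱ-cong refl (IsLinear.f-cong F (shift-e k))))))
    where
    shift : Vector 𝕜 n → Vector 𝕜 (suc n)
    shift y zero    = 0#
    shift y (suc i) = y i
    shift-linear : IsLinear (𝕜^ n) (𝕜^ (suc n)) shift
    shift-linear = record
      { f-cong = λ { p zero → refl ; p (suc i) → p i }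
      ; f-+ = λ { y z zero → sym (+-identityˡ 0#) ; y z (suc i) → refl }
      ; f-· = λ { r y zero → sym (zeroʳ r) ; r y (suc i) → refl }
      }
    shift-e : ∀ k i → shift (e k) i ≈ e (suc k) i
    shift-e k zero    = refl
    shift-e k (suc i) = refl
    split : ∀ i → x i ≈ x zero * e zero i + shift (x ∘ suc) i
    split zero    = sym (trans (+-identityʳ _) (*-identityʳ _))
    split (suc i) = sym (trans (+-congʳ (zeroʳ _)) (+-identityˡ _))

  sumᴱ-single : ∀ {V n} (f : Vector (Exterior V) n) m → (∀ k → k ≢ m → f k ≈ᴱ 0ᴱ) → sumᴱ f ≈ᴱ f m
  sumᴱ-single {V} {suc n} f m h = transᴱ (CMSum.sum-remove CM {i = m} f)
    (transᴱ (+ᴱ-cong reflᴱ (transᴱ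
      (CMSum.sum-cong-≋ CM λ i → h (punchIn m i) (Finₚ.punchInᵢ≢i m i))
      (CMSum.sum-replicate-zero CM n))) (+ᴱ-identityʳ _))
    where CM = Module.+ᴹ-commutativeMonoid (⋀ V)

  column : ∀ {n} → Matrix n → Fin n → Vector 𝕜 n
  column A i = fun (matrixMap A) (e i)

  sum-e : ∀ {n} (t : Vector 𝕜 n) i → sum (λ k → t k * e i k) ≈ t i
  sum-e t zero    = trans (+-cong (*-identityʳ _) (zeros (t ∘ suc))) (+-identityʳ _)
    where
    zeros : ∀ {m} (s : Vector 𝕜 m) → sum (λ k → s k * 0#) ≈ 0#
    zeros {zero}  s = refl
    zeros {suc m} s = trans (+-cong (zeroʳ _) (zeros (s ∘ suc))) (+-identityˡ _)
  sum-e t (suc i) = trans (+-cong (zeroʳ _) (sum-e (t ∘ suc) i)) (+-identityˡ _)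

  column-entry : ∀ {n} (A : Matrix n) i r → column A i r ≈ A r i
  column-entry A i r = sum-e (A r) i

  column-diag : ∀ {n} (a : Fin n → Unit) i r → column (diag a) i r ≈ value (a i) * e i r
  column-diag a i r = trans (column-entry (diag a) i r) (entry (r ≟ i) (i ≟ r))
    where
    entry : (p : Dec (r ≡ i)) (q : Dec (i ≡ r)) →
            (if does p then value (a r) else 0#) ≈ value (a i) * (if does q then 1# else 0#)
    entry (yes ≡.refl) (yes _) = sym (*-identityʳ _)
    entry (yes ≡.refl) (no ¬q) = contradiction ≡.refl ¬q
    entry (no ¬p) (yes ≡.refl) = contradiction ≡.refl ¬p
    entry (no _)  (no _)       = sym (zeroʳ _)

  •-⋀ᵢ : ∀ {d n m} (g : Fin d → Matrix n) (x : Vector (Exterior (V d n)) m) →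
         g • ⋀ᵢ x ≡ ⋀ᵢ λ i → g • x i
  •-⋀ᵢ {m = zero}  g x = ≡.refl
  •-⋀ᵢ {m = suc m} g x = ≡.cong ((g • x zero) ∧_) (•-⋀ᵢ g (x ∘ suc))

  •-Σᴱ : ∀ {d n} {I : Set} (g : Fin d → Matrix n) (L : List I) (f : I → Exterior (V d n)) →
         g • Σᴱ L f ≡ Σᴱ L λ x → g • f x
  •-Σᴱ g []      f = ≡.refl
  •-Σᴱ g (x ∷ L) f = ≡.cong ((g • f x) +ᴱ_) (•-Σᴱ g L f)

  •-ω : ∀ {d n} (g : Fin d → Matrix n) → g • ω d n ≈ᴱ cayleySum λ j → column (g j)
  •-ω {d} {n} g = transᴱ (reflexiveᴱ (•-Σᴱ g (tuples d (permutations n)) _))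
    (Σᴱ-cong (tuples d (permutations n)) λ π → ·ᴱ-cong refl (reflexiveᴱ (•-⋀ᵢ g _)))

  slotwise : ∀ {W : Mod} {m} {Y : Set} (F : Vector Y m → Exterior W) →
    (∀ {x y} → (∀ i → x i ≡ y i) → F x ≈ᴱ F y) →
    (x y : Vector Y m) (s : Vector 𝕜 m) →
    (∀ z i → F (z [ i ]≔ y i) ≈ᴱ s i ·ᴱ F (z [ i ]≔ x i)) →
    F y ≈ᴱ ∏ s ·ᴱ F x
  slotwise {m = zero}  F ext x y s h = transᴱ (ext λ ()) (symᴱ (·ᴱ-identityˡ _))
  slotwise {W} {suc m} {Y} F ext x y s h = begin
    F y                                        ≈⟨ ext (λ { zero → ≡.refl ; (suc i) → ≡.refl }) ⟩
    F (y [ zero ]≔ y zero)                     ≈⟨ h y zero ⟩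
    s zero ·ᴱ F (y [ zero ]≔ x zero)           ≈⟨ ·ᴱ-cong refl (ext λ { zero → ≡.refl ; (suc i) → ≡.refl }) ⟩
    s zero ·ᴱ F (x zero ∷′ (y ∘ suc))          ≈⟨ ·ᴱ-cong refl (slotwise (λ z → F (x zero ∷′ z)) ext′ (x ∘ suc) (y ∘ suc) (s ∘ suc) h′) ⟩
    s zero ·ᴱ (∏ (s ∘ suc) ·ᴱ F (x zero ∷′ (x ∘ suc)))
                                               ≈⟨ ·ᴱ-assoc _ _ _ ⟨
    ∏ s ·ᴱ F (x zero ∷′ (x ∘ suc))             ≈⟨ ·ᴱ-cong refl (ext λ { zero → ≡.refl ; (suc i) → ≡.refl }) ⟩
    ∏ s ·ᴱ F x ∎
    where
    open ≈ᴱ-Reasoning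
    infixr 5 _∷′_
    _∷′_ : Y → Vector Y m → Vector Y (suc m)
    (q ∷′ z) zero    = q
    (q ∷′ z) (suc i) = z i
    ext′ : ∀ {u v : Vector Y m} → (∀ i → u i ≡ v i) → F (x zero ∷′ u) ≈ᴱ F (x zero ∷′ v)
    ext′ p = ext λ { zero → ≡.refl ; (suc i) → p i }
    h′ : ∀ z i → F (x zero ∷′ (z [ i ]≔ y (suc i))) ≈ᴱ s (suc i) ·ᴱ F (x zero ∷′ (z [ i ]≔ x (suc i)))
    h′ z i = transᴱ (ext λ { zero → ≡.refl ; (suc k) → ≡.refl })
      (transᴱ (h (x zero ∷′ z) (suc i))
        (·ᴱ-cong refl (ext λ { zero → ≡.refl ; (suc k) → ≡.refl })))

  cayleySum-ext : ∀ {d n} {x y : Fin d → Fin n → Vector 𝕜 n} → (∀ j → x j ≡ y j) →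
                  cayleySum x ≈ᴱ cayleySum y
  cayleySum-ext {d} p = cayleySum-cong λ j i → ≋-reflexive {d} (≡.cong (λ f → f i) (p j))

  diag-ω : ∀ {d n} (a : Fin d → Fin n → Unit) →
           (λ j → diag (a j)) • ω d n ≈ᴱ ∏ (λ j → ∏ λ i → value (a j i)) ·ᴱ ω d n
  diag-ω {d} {n} a = transᴱ (•-ω (λ j → diag (a j)))
    (slotwise cayleySum cayleySum-ext (λ _ → e) (λ j → column (diag (a j))) _ slot)
    where
    slot : ∀ z j → cayleySum (z [ j ]≔ column (diag (a j)))
                     ≈ᴱ ∏ (λ i → value (a j i)) ·ᴱ cayleySum (z [ j ]≔ e)
    slot z j = slotwise (λ y → cayleySum (z [ j ]≔ y))
      (λ p → cayleySum-cong (≔-cong z j λ i → ≋-reflexive {d} (p i)))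
      e (column (diag (a j))) (λ i → value (a j i))
      λ y i → transᴱ (IsLinear.f-cong (cayleySum-linear z j y i) (column-diag (a j) i))
                     (IsLinear.f-· (cayleySum-linear z j y i) (value (a j i)) (e i))

  module Invariance (½ : 𝕜) (½+½≈1 : ½ + ½ ≈ 1#) where

    self-negative : ∀ {W} {x : Exterior W} → x ≈ᴱ (- 1#) ·ᴱ x → x ≈ᴱ 0ᴱ
    self-negative {W} {x} p = begin
      x                         ≈⟨ ·ᴱ-identityˡ x ⟨
      1# ·ᴱ x                   ≈⟨ ·ᴱ-cong ½+½≈1 reflᴱ ⟨
      (½ + ½) ·ᴱ x              ≈⟨ ·ᴱ-distribʳ x ½ ½ ⟩
      ½ ·ᴱ x +ᴱ ½ ·ᴱ x          ≈⟨ ·ᴱ-distribˡ ½ x x ⟨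
      ½ ·ᴱ (x +ᴱ x)             ≈⟨ ·ᴱ-cong refl (+ᴱ-cong p reflᴱ) ⟩
      ½ ·ᴱ ((- 1#) ·ᴱ x +ᴱ x)   ≈⟨ ·ᴱ-cong refl (Module.-ᴹ‿inverseˡ (⋀ W) x) ⟩
      ½ ·ᴱ 0ᴱ                   ≈⟨ ·ᴱ-zeroʳ ½ ⟩
      0ᴱ ∎
      where open ≈ᴱ-Reasoning

    alternating : ∀ {d n} (x : Fin d → Fin n → Vector 𝕜 n) j g (a b : Fin n) →
      toℕ b ≡ suc (g ℕ.+ toℕ a) → ∀ y → (∀ r → y a r ≈ y b r) → cayleySum (x [ j ]≔ y) ≈ᴱ 0ᴱ
    alternating {d} {suc n} x j zero a (suc b) b≡1+a y p = self-negative
      (transᴱ (symᴱ (cayleySum-cong (≔-cong x j same))) (cayleySum-swap b x j y))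
      where
      a≡lower : a ≡ lower b
      a≡lower = Finₚ.toℕ-injective (≡.trans (≡.sym (ℕₚ.suc-injective b≡1+a)) (≡.sym (Finₚ.toℕ-inject₁ b)))
      same : ∀ i r → y (σ b i) r ≈ y i r
      same i r with i ≟ lower b
      ... | yes ≡.refl rewrite ≡.sym a≡lower = sym (p r)
      ... | no i≢l with i ≟ upper b
      ...   | yes ≡.refl rewrite ≡.sym a≡lower = p r
      ...   | no i≢u = refl
    alternating {d} {suc n} x j (suc g) a (suc b) b≡ y p = begin
      cayleySum (x [ j ]≔ y)
        ≈⟨ ·ᴱ-identityˡ _ ⟨
      1# ·ᴱ cayleySum (x [ j ]≔ y)
        ≈⟨ ·ᴱ-cong (trans (sym (-1*-1* 1#)) (*-congˡ (*-identityʳ (- 1#)))) reflᴱ ⟩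
      ((- 1#) * (- 1#)) ·ᴱ cayleySum (x [ j ]≔ y)
        ≈⟨ ·ᴱ-assoc _ _ _ ⟩
      (- 1#) ·ᴱ ((- 1#) ·ᴱ cayleySum (x [ j ]≔ y))
        ≈⟨ ·ᴱ-cong refl (cayleySum-swap b x j y) ⟨
      (- 1#) ·ᴱ cayleySum (x [ j ]≔ (y ∘ σ b))
        ≈⟨ ·ᴱ-cong refl (alternating x j g a (lower b) lower≡ (y ∘ σ b) p′) ⟩
      (- 1#) ·ᴱ 0ᴱ
        ≈⟨ ·ᴱ-zeroʳ _ ⟩
      0ᴱ ∎
      where
      open ≈ᴱ-Reasoning
      lower≡ : toℕ (lower b) ≡ suc (g ℕ.+ toℕ a)
      lower≡ = ≡.trans (Finₚ.toℕ-inject₁ b) (ℕₚ.suc-injective b≡)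
      a<lower : toℕ a ℕ.< toℕ (lower b)
      a<lower = ℕₚ.≤-trans (ℕ.s≤s (ℕₚ.m≤n+m (toℕ a) g)) (ℕₚ.≤-reflexive (≡.sym lower≡))
      a≢lower : a ≢ lower b
      a≢lower q = ℕₚ.<⇒≢ a<lower (≡.cong toℕ q)
      a≢upper : a ≢ upper b
      a≢upper q = ℕₚ.<⇒≢ (ℕₚ.<-trans a<lower (ℕₚ.≤-reflexive (≡.sym (upper≡1+lower b)))) (≡.cong toℕ q)
      p′ : ∀ r → y (σ b a) r ≈ y (σ b (lower b)) r
      p′ r rewrite σ-fix b a a≢lower a≢upper | σ-lower b = p r

    module _ {d n : ℕ} (x : Fin d → Fin n → Vector 𝕜 n) (j : Fin d)
             (u : Matrix n) (U : IsUpperUnitriangular u) where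
      open IsUpperUnitriangular U

      -- The first t columns are standard basis vectors, the others those of u.
      stage : ℕ → Fin n → Vector 𝕜 n
      stage t i = if does (toℕ i ℕₚ.<? t) then e i else column u i

      stage-≔ : ∀ t (m : Fin n) → toℕ m ≡ t → ∀ w → (∀ r → stage t m r ≈ w r) →
                ∀ i r → stage t i r ≈ (stage (suc t) [ m ]≔ w) i r
      stage-≔ t m m≡t w p i r with i ≟ m
      ... | yes ≡.refl rewrite updateAt-updates m {λ _ → w} (stage (suc t)) = p r
      ... | no i≢m rewrite updateAt-minimal i m {λ _ → w} (stage (suc t)) i≢m =
        reflexive (≡.cong (λ q → (if q then e i else column u i) r) (same (toℕ i ℕₚ.<? t)))
        where
        same : (p : Dec (toℕ i ℕ.< t)) → does p ≡ does (toℕ i ℕₚ.<? suc t)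
        same (yes i<t) = ≡.sym (dec-true (toℕ i ℕₚ.<? suc t) (ℕₚ.m<n⇒m<1+n i<t))
        same (no i≮t) = ≡.sym (dec-false (toℕ i ℕₚ.<? suc t) λ i<1+t →
          i≮t (ℕₚ.≤∧≢⇒< (ℕₚ.≤-pred i<1+t)
            λ i≡t → i≢m (Finₚ.toℕ-injective (≡.trans i≡t (≡.sym m≡t)))))

      stage-step : ∀ t → t ℕ.< n →
        cayleySum (x [ j ]≔ stage t) ≈ᴱ cayleySum (x [ j ]≔ stage (suc t))
      stage-step t t<n = begin
        cayleySum (x [ j ]≔ stage t)
          ≈⟨ cayleySum-cong (≔-cong x j (stage-≔ t m m≡t _ at-m)) ⟩
        f (column u m)
          ≈⟨ expand F (column u m) ⟩
        sumᴱ (λ k → column u m k ·ᴱ f (e k))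
          ≈⟨ sumᴱ-single _ m others ⟩
        column u m m ·ᴱ f (e m)
          ≈⟨ ·ᴱ-cong (trans (column-entry u m m) (on-diagonal m)) reflᴱ ⟩
        1# ·ᴱ f (e m)
          ≈⟨ ·ᴱ-identityˡ _ ⟩
        f (e m)
          ≈⟨ cayleySum-cong (≔-cong x j unchanged) ⟩
        cayleySum (x [ j ]≔ stage (suc t)) ∎
        where
        open ≈ᴱ-Reasoning
        m : Fin n
        m = fromℕ< t<n
        m≡t : toℕ m ≡ t
        m≡t = Finₚ.toℕ-fromℕ< t<n
        f : Vector 𝕜 n → Exterior (V d n)
        f w = cayleySum (x [ j ]≔ (stage (suc t) [ m ]≔ w))
        F : IsLinear (𝕜^ n) (⋀ (V d n)) f
        F = cayleySum-linear x j (stage (suc t)) m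
        at-m : ∀ r → stage t m r ≈ column u m r
        at-m r rewrite dec-false (toℕ m ℕₚ.<? t) (ℕₚ.<-irrefl m≡t) = refl
        done : ∀ k → toℕ k ℕ.< suc t → ∀ r → stage (suc t) k r ≈ e k r
        done k k≤t r rewrite dec-true (toℕ k ℕₚ.<? suc t) k≤t = refl
        unchanged : ∀ i r → (stage (suc t) [ m ]≔ e m) i r ≈ stage (suc t) i r
        unchanged i r with i ≟ m
        ... | yes ≡.refl rewrite updateAt-updates m {λ _ → e m} (stage (suc t)) =
          sym (done m (ℕ.s≤s (ℕₚ.≤-reflexive m≡t)) r)
        ... | no i≢m rewrite updateAt-minimal i m {λ _ → e m} (stage (suc t)) i≢m = refl
        others : ∀ k → k ≢ m → column u m k ·ᴱ f (e k) ≈ᴱ 0ᴱ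
        others k k≢m with toℕ k ℕₚ.<? toℕ m
        ... | yes k<m = transᴱ (·ᴱ-cong refl
          (alternating x j (toℕ m ℕ.∸ suc (toℕ k)) k m gap (stage (suc t) [ m ]≔ e k) repeated))
          (·ᴱ-zeroʳ _)
          where
          gap : toℕ m ≡ suc ((toℕ m ℕ.∸ suc (toℕ k)) ℕ.+ toℕ k)
          gap = ≡.trans (≡.sym (ℕₚ.m∸n+n≡m k<m)) (ℕₚ.+-suc _ (toℕ k))
          repeated : ∀ r → (stage (suc t) [ m ]≔ e k) k r ≈ (stage (suc t) [ m ]≔ e k) m r
          repeated r
            rewrite updateAt-updates m {λ _ → e k} (stage (suc t))
                  | updateAt-minimal k m {λ _ → e k} (stage (suc t)) k≢m =
            done k (ℕₚ.<-trans k<m (ℕ.s≤s (ℕₚ.≤-reflexive m≡t))) r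
        ... | no k≮m = transᴱ (·ᴱ-cong (trans (column-entry u m k)
          (below (ℕₚ.≤∧≢⇒< (ℕₚ.≮⇒≥ k≮m) (λ q → k≢m (Finₚ.toℕ-injective (≡.sym q)))))) reflᴱ)
          (·ᴱ-zeroˡ _)

      stages : ∀ t → t ℕ.≤ n → cayleySum (x [ j ]≔ stage 0) ≈ᴱ cayleySum (x [ j ]≔ stage t)
      stages zero    _   = reflᴱ
      stages (suc t) t<n = transᴱ (stages t (ℕₚ.<⇒≤ t<n)) (stage-step t t<n)

      unitriangular-slot : cayleySum (x [ j ]≔ column u) ≈ᴱ cayleySum (x [ j ]≔ e)
      unitriangular-slot = transᴱ (stages n ℕₚ.≤-refl) (cayleySum-cong (≔-cong x j last))
        where
        last : ∀ i r → stage n i r ≈ e i r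
        last i r rewrite dec-true (toℕ i ℕₚ.<? n) (Finₚ.toℕ<n i) = refl

    unipotent-ω : ∀ {d n} → IsUnipotentInvariant (ω d n)
    unipotent-ω {d} {n} u U = transᴱ (•-ω u) (transᴱ
      (slotwise cayleySum cayleySum-ext (λ _ → e) (λ j → column (u j)) (λ _ → 1#)
        λ z j → transᴱ (unitriangular-slot z j (u j) (U j)) (symᴱ (·ᴱ-identityˡ _)))
      (transᴱ (·ᴱ-cong (ones d) reflᴱ) (·ᴱ-identityˡ _)))
      where
      ones : ∀ m → ∏ {m} (λ _ → 1#) ≈ 1#
      ones zero    = refl
      ones (suc m) = trans (*-identityˡ _) (ones m)

    -- v ↦ ω ∧ v raises the weight by (1,…,1).
    ω∧ : ∀ {d n} {μ μ′ : Fin d → Fin n → ℕ} → (∀ j i → μ′ j i ≡ suc (μ j i)) →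
         HWV d n (λ j i → + μ j i) → HWV d n (λ j i → + μ′ j i)
    ω∧ {d} {n} {μ} {μ′} raise v = record
      { vector = ω d n ∧ vector v
      ; weight = λ a → transᴱ (∧-cong (diag-ω a) (weight v a))
          (transᴱ (·ᴱ-∧ˡ _ _ _) (transᴱ (·ᴱ-cong refl (·ᴱ-∧ʳ _ _ _))
          (transᴱ (symᴱ (·ᴱ-assoc _ _ _)) (·ᴱ-cong (weights a) reflᴱ))))
      ; invariant = λ u U → ∧-cong (unipotent-ω u U) (invariant v u U)
      }
      where
      weights : ∀ (a : Fin d → Fin n → Unit) →
        ∏ (λ j → ∏ λ i → value (a j i)) * ∏ (λ j → ∏ λ i → value (a j i) ^ μ j i)
          ≈ ∏ (λ j → ∏ λ i → value (a j i) ^ μ′ j i)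
      weights a = trans (sym (∏-distrib-* (λ j → ∏ λ i → value (a j i)) (λ j → ∏ λ i → value (a j i) ^ μ j i)))
        (∏-cong λ j → trans (sym (∏-distrib-* (λ i → value (a j i)) (λ i → value (a j i) ^ μ j i)))
          (∏-cong λ i → reflexive (≡.cong (value (a j i) ^_) (≡.sym (raise j i)))))

open Complex public using (ℂ; ℂ-commutativeRing)
open Partitions public
open Multilinear ℂ-commutativeRing public
open Invariance Complex.½ℂ Complex.½+½≈1 public

-- The tuple of partitions μ, each of length at most n, padded to vectors in ℤⁿ.
pad : ∀ {d} n → (Fin d → Partition) → Weight d n
pad n μ j i = + part (μ j) (toℕ i)

L : ∀ {d} n (λs : Fin d → Partition) (λs≤n : ∀ j → PartsAtMost n (λs j)) →
    HWV d n (pad n (λ j → conj (λs j))) →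
    HWV d n (pad n (λ j → conj (ρ n (λs j) (λs≤n j))))
L n λs λs≤n = ω∧ λ j i → conj-ρ n (λs j) (λs≤n j) (toℕ i) (Finₚ.toℕ<n i)

{-# OPTIONS --safe #-}

-- It suffices to pass from n to n + 1 when n bounds all parts of the λ⁽ʲ⁾, so
-- that the weight λ′ is zero at the last coordinate of each tensor slot.  Let
-- P : ⋀V_{n+1} → ⋀V_n forget the last coordinates, and let D be the skew
-- derivation over P (contraction, followed by P) that extends the linear form
-- e*_{n+1} ⊗ ⋯ ⊗ e*_{n+1}.  Each term of ω_{n+1} contains the index n + 1, so
-- P ω_{n+1} = 0; and for d odd all signs agree in D ω_{n+1} = ±(n+1) ω_n.  Hence
-- D (ω_{n+1} ∧ v) = ±(n+1) ω_n ∧ P v, and P v is a highest weight vector of the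
-- same weight.  Finally v is recovered from P v: the action of diag(1,…,1,t) in
-- one slot is polynomial in t and fixes v for t = 1, 2, …, hence also for t = 0.

module Submission where

open import Level using (0ℓ)
open import Algebra.Bundles using (CommutativeMonoid; CommutativeRing)
open import Algebra.Module.Bundles using (Module)
import Algebra.Properties.CommutativeMonoid.Sum as CMSum
import Algebra.Properties.CommutativeSemigroup as CommutativeSemigroupProperties
import Algebra.Properties.Group as GroupProperties
import Algebra.Properties.Semiring.Exp as Exp
import Algebra.Properties.Semiring.Mult as Mult
import Algebra.Properties.Semiring.Sum as SemiringSum
open import Data.Bool.Base using (true; false; if_then_else_)
open import Data.Fin.Base as Fin using (Fin; zero; suc; toℕ; fromℕ; inject₁; punchIn)
open import Data.Fin.Properties as Finₚ using (_≟_; _<?_; fromℕ≢inject₁; inject₁-injective)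
open import Data.Fin.Relation.Unary.Top using (view; ‵fromℕ; ‵inject₁)
open import Data.Integer.Base using (+_)
open import Data.List.Base using (List; []; _∷_; allFin)
open import Data.Nat.Base as ℕ using (ℕ; zero; suc)
import Data.Nat.DivMod as ℕ
import Data.Nat.Properties as ℕₚ
import Data.Nat.Solver as ℕSolver
open import Data.Product.Base using (proj₁; proj₂)
open import Data.Rational.Base as ℚ using (ℚ; 0ℚ; 1ℚ)
import Data.Rational.Properties as ℚₚ
open import Data.Vec.Base as Vec using (Vec; []; _∷_; lookup; insertAt; count)
open import Data.Vec.Functional using (Vector; init; last)
open import Data.Vec.Functional.Properties using (updateAt-updates; updateAt-minimal)
import Data.Vec.Properties as Vecₚ
open import Data.Vec.Relation.Unary.All as VAll using (_∷_) renaming (All to VAll)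
import Data.Vec.Relation.Unary.All.Properties as VAllₚ
open import Data.Vec.Relation.Unary.AllPairs using (_∷_)
open import Data.Vec.Relation.Unary.Unique.Propositional using (Unique)
open import Data.Vec.Relation.Unary.Unique.Propositional.Properties as Uniqueₚ using (lookup-injective)
open import Function.Base using (_∘_; id)
import Relation.Binary.PropositionalEquality as ≡
open import Relation.Binary.PropositionalEquality using (_≡_; _≢_)
import Relation.Binary.Reasoning.Setoid as SetoidReasoning
open import Relation.Nullary using (yes; no; does; ¬_; contradiction)
open import Relation.Nullary.Decidable using (dec-true; dec-false)
import Defs
open Defs using (_[_]≔_)
open Defs.Permutations

-- `⋀` and `TensorPower` consist of terms modulo relations, over a ring without a test for equality.
-- No basis of ⋀V is at hand: a map out of it is a recursion on terms checked against each relation,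
-- and that v avoids the index n + 1 cannot be read off from coordinates. Weight zero only says that
-- diag(1,...,1,t) fixes v for units t. The value t = 0 lies outside the torus and is reached by
-- finite differences along t = 0, 1, 2, ..., for which explicit inverses of the positive integers
-- are enough. Padding with 0 is then a left inverse of truncation on these vectors.
--
-- The signs: if all π_j take the value n + 1 at the same position i (counted from 0), deleting it
-- removes n - i inversions from each π_j, a factor (-1)^(d(n-i)) in total, and contracting factor i
-- contributes (-1)^i. For d odd the product is (-1)^n for every i, so the n + 1 positions add up;
-- for d even they would alternate. Tuples with n + 1 at different positions are killed by the
-- linear form.

infixl 5 _∷ʳ_
_∷ʳ_ : ∀ {A : Set} {n} → Vector A n → A → Vector A (suc n)
_∷ʳ_ {n = zero}  x a _       = a
_∷ʳ_ {n = suc n} x a zero    = x zero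
_∷ʳ_ {n = suc n} x a (suc i) = (x ∘ suc ∷ʳ a) i

∷ʳ-inject₁ : ∀ {A : Set} {n} (x : Vector A n) a i → (x ∷ʳ a) (inject₁ i) ≡ x i
∷ʳ-inject₁ x a zero    = ≡.refl
∷ʳ-inject₁ x a (suc i) = ∷ʳ-inject₁ (x ∘ suc) a i

∷ʳ-fromℕ : ∀ {A : Set} {n} (x : Vector A n) a → (x ∷ʳ a) (fromℕ n) ≡ a
∷ʳ-fromℕ {n = zero}  x a = ≡.refl
∷ʳ-fromℕ {n = suc n} x a = ∷ʳ-fromℕ (x ∘ suc) a

∷ʳ-elim : ∀ {n} {P : Fin (suc n) → Set} → (∀ i → P (inject₁ i)) → P (fromℕ n) → ∀ i → P i
∷ʳ-elim p q i with view i
... | ‵fromℕ     = q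
... | ‵inject₁ j = p j

-- Permutations with the largest value at a given position

insertLast : ∀ {n m} → Fin (suc m) → Vec (Fin n) m → Vec (Fin (suc n)) (suc m)
insertLast {n} i w = insertAt (Vec.map inject₁ w) i (fromℕ n)

insertLast-last : ∀ {n m} i (w : Vec (Fin n) m) → lookup (insertLast i w) i ≡ fromℕ n
insertLast-last i w = Vecₚ.insertAt-lookup (Vec.map inject₁ w) i _

insertLast-punchIn : ∀ {n m} i (w : Vec (Fin n) m) k →
                     lookup (insertLast i w) (punchIn i k) ≡ inject₁ (lookup w k)
insertLast-punchIn i w k = ≡.trans (Vecₚ.insertAt-punchIn (Vec.map inject₁ w) i _ k)
                                   (Vecₚ.lookup-map k inject₁ w)

All-insertAt : ∀ {A : Set} {P : A → Set} {m} {v : Vec A m} i {a} →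
               VAll P v → P a → VAll P (insertAt v i a)
All-insertAt zero    ps       p = p ∷ ps
All-insertAt (suc i) (q ∷ ps) p = q ∷ All-insertAt i ps p

unique-insertLast⁺ : ∀ {n m} i {w : Vec (Fin n) m} → Unique w → Unique (insertLast i w)
unique-insertLast⁺ zero {w} u =
  VAllₚ.map⁺ (VAll.universal (λ _ → fromℕ≢inject₁) w) ∷ Uniqueₚ.map⁺ inject₁-injective u
unique-insertLast⁺ (suc i) {x ∷ w} (x∉ ∷ u) =
  All-insertAt i (VAllₚ.map⁺ (VAll.map (_∘ inject₁-injective) x∉)) (fromℕ≢inject₁ ∘ ≡.sym)
    ∷ unique-insertLast⁺ i u

injective⇒unique : ∀ {A : Set} {m} (v : Vec A m) →
                   (∀ {i j} → lookup v i ≡ lookup v j → i ≡ j) → Unique v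
injective⇒unique v inj = ≡.subst Unique (Vecₚ.tabulate∘lookup v) (Uniqueₚ.tabulate⁺ inj)

unique-insertLast⁻ : ∀ {n m} i {w : Vec (Fin n) m} → Unique (insertLast i w) → Unique w
unique-insertLast⁻ i {w} u = injective⇒unique w λ {k} {l} p →
  Finₚ.punchIn-injective i k l (lookup-injective u _ _
    (≡.trans (insertLast-punchIn i w k)
      (≡.trans (≡.cong inject₁ p) (≡.sym (insertLast-punchIn i w l)))))

unique?-insertLast : ∀ {n m} i (w : Vec (Fin n) m) →
                     does (unique? (insertLast i w)) ≡ does (unique? w)
unique?-insertLast i w with unique? w
... | yes u = dec-true (unique? (insertLast i w)) (unique-insertLast⁺ i u)
... | no ¬u = dec-false (unique? (insertLast i w)) (¬u ∘ unique-insertLast⁻ i)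

insertAt-¬unique : ∀ {A : Set} {m} (w : Vec A m) i {a} k → lookup w k ≡ a → ¬ Unique (insertAt w i a)
insertAt-¬unique w i {a} k p u = Finₚ.punchInᵢ≢i i k (lookup-injective u _ _
  (≡.trans (Vecₚ.insertAt-punchIn w i a k) (≡.trans p (≡.sym (Vecₚ.insertAt-lookup w i a)))))

-- Effect of inserting the largest value on the number of inversions.

Σᵛ-cong : ∀ {A : Set} {f g : A → ℕ} → (∀ x → f x ≡ g x) → ∀ {m} (v : Vec A m) → Σᵛ f v ≡ Σᵛ g v
Σᵛ-cong p []      = ≡.refl
Σᵛ-cong p (x ∷ v) = ≡.cong₂ ℕ._+_ (p x) (Σᵛ-cong p v)

Σᵛ-map : ∀ {A B : Set} (f : B → ℕ) (g : A → B) {m} (v : Vec A m) → Σᵛ f (Vec.map g v) ≡ Σᵛ (f ∘ g) v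
Σᵛ-map f g []      = ≡.refl
Σᵛ-map f g (x ∷ v) = ≡.cong (f (g x) ℕ.+_) (Σᵛ-map f g v)

Σᵛ-insertAt : ∀ {A : Set} (f : A → ℕ) {m} (v : Vec A m) i a → Σᵛ f (insertAt v i a) ≡ f a ℕ.+ Σᵛ f v
Σᵛ-insertAt f v       zero    a = ≡.refl
Σᵛ-insertAt f (x ∷ v) (suc i) a = ≡.trans (≡.cong (f x ℕ.+_) (Σᵛ-insertAt f v i a))
  (solve 3 (λ p q r → p :+ (q :+ r) := q :+ (p :+ r)) ≡.refl (f x) (f a) (Σᵛ f v))
  where open ℕSolver.+-*-Solver

Σᵛ-one : ∀ {A : Set} {m} (v : Vec A m) → Σᵛ (λ _ → 1) v ≡ m
Σᵛ-one []      = ≡.refl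
Σᵛ-one (x ∷ v) = ≡.cong suc (Σᵛ-one v)

inject₁<fromℕ : ∀ {n} (x : Fin n) → inject₁ x Fin.< fromℕ n
inject₁<fromℕ {n} x = ≡.subst₂ ℕ._<_ (≡.sym (Finₚ.toℕ-inject₁ x)) (≡.sym (Finₚ.toℕ-fromℕ n)) (Finₚ.toℕ<n x)

count-inject₁ : ∀ {n m} (x : Fin n) (w : Vec (Fin n) m) →
                count (_<? inject₁ x) (Vec.map inject₁ w) ≡ count (_<? x) w
count-inject₁ x w = begin
  count (_<? inject₁ x) (Vec.map inject₁ w)        ≡⟨ count≡Σᵛ (_<? inject₁ x) (Vec.map inject₁ w) ⟩
  Σᵛ (λ y → ⟦ y <? inject₁ x ⟧) (Vec.map inject₁ w) ≡⟨ Σᵛ-map _ inject₁ w ⟩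
  Σᵛ (λ y → ⟦ inject₁ y <? inject₁ x ⟧) w          ≡⟨ Σᵛ-cong same w ⟩
  Σᵛ (λ y → ⟦ y <? x ⟧) w                          ≡⟨ count≡Σᵛ (_<? x) w ⟨
  count (_<? x) w                                  ∎
  where
  open ≡.≡-Reasoning
  same : ∀ y → ⟦ inject₁ y <? inject₁ x ⟧ ≡ ⟦ y <? x ⟧
  same y = ⟦⟧-⇔ (inject₁ y <? inject₁ x) (y <? x)
    (≡.subst₂ ℕ._<_ (Finₚ.toℕ-inject₁ y) (Finₚ.toℕ-inject₁ x))
    (≡.subst₂ ℕ._<_ (≡.sym (Finₚ.toℕ-inject₁ y)) (≡.sym (Finₚ.toℕ-inject₁ x)))

count-insertLast : ∀ {n m} (x : Fin n) i (w : Vec (Fin n) m) →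
                   count (_<? inject₁ x) (insertLast i w) ≡ count (_<? x) w
count-insertLast {n} x i w = begin
  count (_<? inject₁ x) (insertLast i w)          ≡⟨ count≡Σᵛ (_<? inject₁ x) (insertLast i w) ⟩
  Σᵛ lt (insertLast i w)                          ≡⟨ Σᵛ-insertAt lt (Vec.map inject₁ w) i (fromℕ n) ⟩
  lt (fromℕ n) ℕ.+ Σᵛ lt (Vec.map inject₁ w)      ≡⟨ ≡.cong (ℕ._+ Σᵛ lt (Vec.map inject₁ w)) last≮x ⟩
  Σᵛ lt (Vec.map inject₁ w)                       ≡⟨ count≡Σᵛ (_<? inject₁ x) (Vec.map inject₁ w) ⟨
  count (_<? inject₁ x) (Vec.map inject₁ w)       ≡⟨ count-inject₁ x w ⟩
  count (_<? x) w                                 ∎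
  where
  open ≡.≡-Reasoning
  lt : Fin (suc n) → ℕ
  lt y = ⟦ y <? inject₁ x ⟧
  last≮x : lt (fromℕ n) ≡ 0
  last≮x = ⟦no⟧ (fromℕ n <? inject₁ x) (ℕₚ.<-asym (inject₁<fromℕ x))

count-fromℕ : ∀ {n m} (w : Vec (Fin n) m) → count (_<? fromℕ n) (Vec.map inject₁ w) ≡ m
count-fromℕ {n} {m} w = begin
  count (_<? fromℕ n) (Vec.map inject₁ w)         ≡⟨ count≡Σᵛ (_<? fromℕ n) (Vec.map inject₁ w) ⟩
  Σᵛ (λ y → ⟦ y <? fromℕ n ⟧) (Vec.map inject₁ w) ≡⟨ Σᵛ-map _ inject₁ w ⟩
  Σᵛ (λ y → ⟦ inject₁ y <? fromℕ n ⟧) w           ≡⟨ Σᵛ-cong (λ y → ⟦yes⟧ (inject₁ y <? fromℕ n) (inject₁<fromℕ y)) w ⟩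
  Σᵛ (λ _ → 1) w                                  ≡⟨ Σᵛ-one w ⟩
  m                                               ∎
  where open ≡.≡-Reasoning

inversions-inject₁ : ∀ {n m} (w : Vec (Fin n) m) → inversions (Vec.map inject₁ w) ≡ inversions w
inversions-inject₁ []      = ≡.refl
inversions-inject₁ (x ∷ w) = ≡.cong₂ ℕ._+_ (count-inject₁ x w) (inversions-inject₁ w)

-- The largest value, at position i, forms an inversion with each of the m - i entries behind it and
-- with none before it. The additive form avoids truncated subtraction.
inversions-insertLast : ∀ {n m} i (w : Vec (Fin n) m) →
                        inversions (insertLast i w) ℕ.+ toℕ i ≡ inversions w ℕ.+ m
inversions-insertLast {m = m} zero w = ≡.trans (ℕₚ.+-identityʳ _)
  (≡.trans (≡.cong₂ ℕ._+_ (count-fromℕ w) (inversions-inject₁ w)) (ℕₚ.+-comm m _))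
inversions-insertLast {m = suc m} (suc i) (x ∷ w) = begin
  (count (_<? inject₁ x) (insertLast i w) ℕ.+ I) ℕ.+ suc (toℕ i)
    ≡⟨ ≡.cong (λ c → (c ℕ.+ I) ℕ.+ suc (toℕ i)) (count-insertLast x i w) ⟩
  (C ℕ.+ I) ℕ.+ suc (toℕ i)
    ≡⟨ solve 3 (λ c q r → (c :+ q) :+ (con 1 :+ r) := con 1 :+ (c :+ (q :+ r))) ≡.refl C I (toℕ i) ⟩
  suc (C ℕ.+ (I ℕ.+ toℕ i))
    ≡⟨ ≡.cong (λ q → suc (C ℕ.+ q)) (inversions-insertLast i w) ⟩
  suc (C ℕ.+ (inversions w ℕ.+ m))
    ≡⟨ solve 3 (λ c q r → (c :+ q) :+ (con 1 :+ r) := con 1 :+ (c :+ (q :+ r))) ≡.refl C (inversions w) m ⟨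
  (C ℕ.+ inversions w) ℕ.+ suc m ∎
  where
  open ≡.≡-Reasoning
  open ℕSolver.+-*-Solver
  I = inversions (insertLast i w)
  C = count (_<? x) w

module Stabilisation (K : CommutativeRing 0ℓ 0ℓ) where

  open CommutativeRing K renaming (Carrier to 𝕜) hiding (zero)
  open CommutativeSemigroupProperties (CommutativeMonoid.commutativeSemigroup *-commutativeMonoid)
    using (x∙yz≈y∙xz; xy∙z≈zy∙x) renaming (interchange to *-interchange)
  open Exp semiring using (_^_; ^-homo-*)
  open Mult semiring using (_×_)
  open SemiringSum semiring using (sum-cong-≋; sum-init-last)
  open Defs.Multilinear K
  open Module using (Carrierᴹ)
  open LinearMap using (fun)

  private
    module ∏ = CMSum *-commutativeMonoid
    module ⋀Sum {V : Mod} = CMSum (Module.+ᴹ-commutativeMonoid (⋀ V))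

  -- Zero in the exterior algebra, and functoriality of induced maps.

  ∧-zeroˡ : ∀ {V} (x : Exterior V) → 0ᴱ ∧ x ≈ᴱ 0ᴱ
  ∧-zeroˡ x = transᴱ (∧-cong (symᴱ (·ᴱ-zeroˡ 0ᴱ)) reflᴱ) (transᴱ (·ᴱ-∧ˡ _ _ _) (·ᴱ-zeroˡ _))

  ∧-zeroʳ : ∀ {V} (x : Exterior V) → x ∧ 0ᴱ ≈ᴱ 0ᴱ
  ∧-zeroʳ x = transᴱ (∧-cong reflᴱ (symᴱ (·ᴱ-zeroˡ 0ᴱ))) (transᴱ (·ᴱ-∧ʳ _ _ _) (·ᴱ-zeroˡ _))

  induced : ∀ {d M N} → (Fin d → LinearMap M N) →
            Exterior (TensorPower d M) → Exterior (TensorPower d N)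
  induced f = fun (exteriorMap (tensorMap f))

  module _ {d : ℕ} {L M M′ N : Mod}
    {f : Fin d → LinearMap L M} {g : Fin d → LinearMap M N}
    {f′ : Fin d → LinearMap L M′} {g′ : Fin d → LinearMap M′ N}
    (square : ∀ j x → Module._≈ᴹ_ N (fun (g j) (fun (f j) x)) (fun (g′ j) (fun (f′ j) x))) where

    tensorMap-square : ∀ x → fun (tensorMap g) (fun (tensorMap f) x)
                               ≈ᵀ fun (tensorMap g′) (fun (tensorMap f′) x)
    tensorMap-square (⨂ x)    = ⨂-cong λ j → square j (x j)
    tensorMap-square 0ᵀ       = reflᵀ
    tensorMap-square (x +ᵀ y) = +ᵀ-cong (tensorMap-square x) (tensorMap-square y)
    tensorMap-square (r ·ᵀ x) = ·ᵀ-cong refl (tensorMap-square x)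

    -- Squares rather than composites, because equivariance of truncation compares two composites.
    -- Triangles and extensionality follow by putting `idMap` on one side.
    induced-square : ∀ v → induced g (induced f v) ≈ᴱ induced g′ (induced f′ v)
    induced-square (ι x)    = ι-cong (tensorMap-square x)
    induced-square 0ᴱ       = reflᴱ
    induced-square 1ᴱ       = reflᴱ
    induced-square (v +ᴱ w) = +ᴱ-cong (induced-square v) (induced-square w)
    induced-square (r ·ᴱ v) = ·ᴱ-cong refl (induced-square v)
    induced-square (v ∧ w)  = ∧-cong (induced-square v) (induced-square w)

  idMap : ∀ {M} → LinearMap M M
  idMap {M} = record { fun = id ; isLinear = record
    { f-cong = id ; f-+ = λ _ _ → Module.≈ᴹ-refl M ; f-· = λ _ _ → Module.≈ᴹ-refl M } }

  tensorMap-id : ∀ {d M} x → fun (tensorMap {d} {M} λ _ → idMap) x ≡ x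
  tensorMap-id (⨂ x)    = ≡.refl
  tensorMap-id 0ᵀ       = ≡.refl
  tensorMap-id (x +ᵀ y) = ≡.cong₂ _+ᵀ_ (tensorMap-id x) (tensorMap-id y)
  tensorMap-id (r ·ᵀ x) = ≡.cong (r ·ᵀ_) (tensorMap-id x)

  induced-id : ∀ {d M} v → induced {d} {M} (λ _ → idMap) v ≡ v
  induced-id (ι x)    = ≡.cong ι (tensorMap-id x)
  induced-id 0ᴱ       = ≡.refl
  induced-id 1ᴱ       = ≡.refl
  induced-id (v +ᴱ w) = ≡.cong₂ _+ᴱ_ (induced-id v) (induced-id w)
  induced-id (r ·ᴱ v) = ≡.cong (r ·ᴱ_) (induced-id v)
  induced-id (v ∧ w)  = ≡.cong₂ _∧_ (induced-id v) (induced-id w)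

  induced-triangle : ∀ {d L M N} {f : Fin d → LinearMap L M} {g : Fin d → LinearMap M N}
    {h : Fin d → LinearMap L N} →
    (∀ j x → Module._≈ᴹ_ N (fun (g j) (fun (f j) x)) (fun (h j) x)) →
    ∀ v → induced g (induced f v) ≈ᴱ induced h v
  induced-triangle {f = f} {g} {h} p v =
    transᴱ (induced-square {f = f} {g} {h} {λ _ → idMap} p v) (reflexiveᴱ (induced-id _))

  induced-ext : ∀ {d M N} {f g : Fin d → LinearMap M N} →
    (∀ j x → Module._≈ᴹ_ N (fun (f j) x) (fun (g j) x)) → ∀ v → induced f v ≈ᴱ induced g v
  induced-ext {f = f} {g} p v =
    transᴱ (reflexiveᴱ (≡.sym (induced-id _))) (induced-triangle {f = f} {λ _ → idMap} {g} p v)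

  -- Polynomial functions

  -- Functions ℕ → M some iterated difference of which vanishes; subtraction is
  -- avoided by naming the difference g of f.
  data Polynomial (M : Mod) : (ℕ → Carrierᴹ M) → Set where
    null : ∀ {f} → (∀ t → Module._≈ᴹ_ M (f t) (Module.0ᴹ M)) → Polynomial M f
    step : ∀ {f} g → Polynomial M g →
           (∀ t → Module._≈ᴹ_ M (f (suc t)) (Module._+ᴹ_ M (f t) (g t))) → Polynomial M f

  module _ {M : Mod} where
    open Module M using (_≈ᴹ_; _+ᴹ_; 0ᴹ; ≈ᴹ-refl; ≈ᴹ-sym; ≈ᴹ-trans; ≈ᴹ-setoid; +ᴹ-cong; +ᴹ-assoc; +ᴹ-comm;
      +ᴹ-identityˡ; +ᴹ-identityʳ; +ᴹ-group; +ᴹ-commutativeMonoid)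
    open CommutativeSemigroupProperties (CommutativeMonoid.commutativeSemigroup +ᴹ-commutativeMonoid)
      using (interchange; xy∙z≈xz∙y)

    polynomial-const : ∀ c → Polynomial M λ _ → c
    polynomial-const c = step (λ _ → 0ᴹ) (null λ _ → ≈ᴹ-refl) λ _ → ≈ᴹ-sym (+ᴹ-identityʳ c)

    polynomial-shift : ∀ {f} → Polynomial M f → Polynomial M (f ∘ suc)
    polynomial-shift (null p)     = null (p ∘ suc)
    polynomial-shift (step g q p) = step (g ∘ suc) (polynomial-shift q) (p ∘ suc)

    polynomial-+ : ∀ {f f′} → Polynomial M f → Polynomial M f′ → Polynomial M (λ t → f t +ᴹ f′ t)
    polynomial-+ (null p) (null p′) = null λ t → ≈ᴹ-trans (+ᴹ-cong (p t) (p′ t)) (+ᴹ-identityˡ 0ᴹ)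
    polynomial-+ (null p) (step g′ q′ p′) = step g′ q′ λ t →
      ≈ᴹ-trans (+ᴹ-cong (≈ᴹ-trans (p (suc t)) (≈ᴹ-sym (p t))) (p′ t)) (≈ᴹ-sym (+ᴹ-assoc _ _ _))
    polynomial-+ (step g q p) (null p′) = step g q λ t →
      ≈ᴹ-trans (+ᴹ-cong (p t) (≈ᴹ-trans (p′ (suc t)) (≈ᴹ-sym (p′ t)))) (xy∙z≈xz∙y _ _ _)
    polynomial-+ (step g q p) (step g′ q′ p′) = step _ (polynomial-+ q q′) λ t →
      ≈ᴹ-trans (+ᴹ-cong (p t) (p′ t)) (interchange _ _ _ _)

    -- Induction on the number of differences: if f is constant from 1 on, then g vanishes there,
    -- hence also at 0, and so f 0 = f 1. This replaces the count of zeros of a polynomial and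
    -- divides by nothing.
    polynomial-at-0 : ∀ {f c} → Polynomial M f → (∀ t → f (suc t) ≈ᴹ c) → f 0 ≈ᴹ c
    polynomial-at-0 (null p) h = ≈ᴹ-trans (p 0) (≈ᴹ-trans (≈ᴹ-sym (p 1)) (h 0))
    polynomial-at-0 {f} {c} (step g q p) h =
      ≈ᴹ-trans (≈ᴹ-sym (≈ᴹ-trans (p 0) (≈ᴹ-trans (+ᴹ-cong ≈ᴹ-refl g0≈0) (+ᴹ-identityʳ _)))) (h 0)
      where
      g0≈0 : g 0 ≈ᴹ 0ᴹ
      g0≈0 = polynomial-at-0 q λ t → GroupProperties.∙-cancelˡ +ᴹ-group (f (suc t)) _ _
        (≈ᴹ-trans (≈ᴹ-sym (p (suc t))) (≈ᴹ-trans (h (suc t))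
          (≈ᴹ-trans (≈ᴹ-sym (h t)) (≈ᴹ-sym (+ᴹ-identityʳ _)))))

  polynomial-linear : ∀ {M N F f} → IsLinear M N F → Polynomial M f → Polynomial N (F ∘ f)
  polynomial-linear {M} {N} {F} lin (null p) = null λ t → N.≈ᴹ-trans (f-cong (p t))
      (N.≈ᴹ-trans (f-cong (M.≈ᴹ-sym (M.*ₗ-zeroˡ M.0ᴹ))) (N.≈ᴹ-trans (f-· 0# M.0ᴹ) (N.*ₗ-zeroˡ _)))
    where
    module M = Module M
    module N = Module N
    open IsLinear lin
  polynomial-linear {M} {N} {F} lin (step g q p) =
    step _ (polynomial-linear lin q) λ t → Module.≈ᴹ-trans N (f-cong (p t)) (f-+ _ _)
    where open IsLinear lin

  -- Discrete Leibniz rule: the difference of f ∧ g at t is f(t) ∧ Δg(t) + Δf(t) ∧ g(t+1). The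
  -- shifted factor does not endanger termination, since the first argument has become smaller in
  -- that call.
  polynomial-∧ : ∀ {V f g} → Polynomial (⋀ V) f → Polynomial (⋀ V) g →
                 Polynomial (⋀ V) (λ t → f t ∧ g t)
  polynomial-∧ (null p) _ = null λ t → transᴱ (∧-cong (p t) reflᴱ) (∧-zeroˡ _)
  polynomial-∧ (step _ _ _) (null p) = null λ t → transᴱ (∧-cong reflᴱ (p t)) (∧-zeroʳ _)
  polynomial-∧ P@(step f′ q p) Q@(step g′ q′ p′) =
    step _ (polynomial-+ (polynomial-∧ P q′) (polynomial-∧ q (polynomial-shift Q))) λ t →
      transᴱ (∧-cong (p t) reflᴱ) (transᴱ (∧-distribʳ _ _ _)
        (transᴱ (+ᴱ-cong (transᴱ (∧-cong reflᴱ (p′ t)) (∧-distribˡ _ _ _)) reflᴱ) (+ᴱ-assoc _ _ _)))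

  -- Scaling the last coordinate, polynomially in the scalar.

  scale : ∀ {n} → Vector 𝕜 n → LinearMap (𝕜^ n) (𝕜^ n)
  scale s = record
    { fun = λ x i → s i * x i
    ; isLinear = record
      { f-cong = λ p i → *-congˡ (p i)
      ; f-+ = λ x y i → distribˡ (s i) (x i) (y i)
      ; f-· = λ r x i → trans (sym (*-assoc _ _ _)) (trans (*-congʳ (*-comm _ _)) (*-assoc _ _ _))
      }
    }

  diag-scale : ∀ {n} (a : Fin n → Unit) x i → fun (matrixMap (diag a)) x i ≈ value (a i) * x i
  diag-scale a x i = trans (sum-cong-≋ entry) (sum-e (λ k → value (a i) * x k) i)
    where
    entry : ∀ k → diag a i k * x k ≈ (value (a i) * x k) * e i k
    entry k with i ≟ k
    ... | yes ≡.refl = sym (*-identityʳ _)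
    ... | no _       = trans (zeroˡ _) (sym (zeroʳ _))

  ones : ∀ {n} → Vector 𝕜 n
  ones _ = 1#

  -- `diag` accepts only units, whereas the scalar 0 is the one of interest here.
  scaleLast : ∀ {n} → 𝕜 → LinearMap (𝕜^ (suc n)) (𝕜^ (suc n))
  scaleLast t = scale (ones ∷ʳ t)

  scaleLast-cong : ∀ {n s t} → s ≈ t → ∀ x i → fun (scaleLast {n} s) x i ≈ fun (scaleLast t) x i
  scaleLast-cong {n} {s} {t} p x i = *-congʳ (go i)
    where
    go : ∀ {n} (i : Fin (suc n)) → (ones ∷ʳ s) i ≈ (ones ∷ʳ t) i
    go {zero}  i       = p
    go {suc n} zero    = refl
    go {suc n} (suc i) = go i

  scaleLast-∘ : ∀ {n} s t x i → fun (scaleLast {n} s) (fun (scaleLast t) x) i ≈ fun (scaleLast (s * t)) x i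
  scaleLast-∘ s t x i = trans (sym (*-assoc _ _ _)) (*-congʳ (go i))
    where
    go : ∀ {n} (i : Fin (suc n)) → (ones ∷ʳ s) i * (ones ∷ʳ t) i ≈ (ones ∷ʳ s * t) i
    go {zero}  i       = refl
    go {suc n} zero    = *-identityˡ 1#
    go {suc n} (suc i) = go i

  scaleSlots : ∀ {d n} → Vector 𝕜 d → Exterior (V d (suc n)) → Exterior (V d (suc n))
  scaleSlots s = induced λ j → scaleLast (s j)

  module _ {d n : ℕ} (j : Fin d) where

    private
      slot : ℕ → Vector 𝕜 d
      slot t = ones [ j ]≔ (t × 1#)

    -- A pure tensor is affine in t: only slot j depends on t, and its increment is a constant
    -- vector holding the last coordinate of `x j`. Higher degrees arise only from wedge products.
    polynomial-tensor : ∀ x → Polynomial (V d (suc n)) λ t → fun (tensorMap λ i → scaleLast (slot t i)) x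
    polynomial-tensor (⨂ x) = step (λ _ → ⨂ (y [ j ]≔ Δ)) (polynomial-const {V d (suc n)} _) λ t →
      transᵀ (⨂-cong (at (suc t))) (transᵀ (IsLinear.f-cong (⨂-linear y j) (increment t))
        (transᵀ (⨂-+ y j _ _) (+ᵀ-cong (symᵀ (⨂-cong (at t))) reflᵀ)))
      where
      y : Vector (Vector 𝕜 (suc n)) d
      -- The other slots are scaled by `1#`, a factor that does not disappear by computation.
      y i = fun (scaleLast 1#) (x i)
      Δ : Vector 𝕜 (suc n)
      Δ = (λ _ → 0#) ∷ʳ last (x j)
      at : ∀ t i k → fun (scaleLast (slot t i)) (x i) k ≈ (y [ j ]≔ fun (scaleLast (t × 1#)) (x j)) i k
      at t i k with i ≟ j
      ... | yes ≡.refl rewrite updateAt-updates j {λ _ → t × 1#} (ones {d})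
                             | updateAt-updates j {λ _ → fun (scaleLast (t × 1#)) (x j)} y = refl
      ... | no i≢j rewrite updateAt-minimal i j {λ _ → t × 1#} (ones {d}) i≢j
                         | updateAt-minimal i j {λ _ → fun (scaleLast (t × 1#)) (x j)} y i≢j = refl
      increment : ∀ t k → fun (scaleLast (suc t × 1#)) (x j) k
                            ≈ fun (scaleLast (t × 1#)) (x j) k + Δ k
      increment t = ∷ʳ-elim
        (λ k → trans (*-congʳ (reflexive (∷ʳ-inject₁ ones _ k))) (sym (trans
          (+-cong (*-congʳ (reflexive (∷ʳ-inject₁ ones _ k))) (reflexive (∷ʳ-inject₁ (λ _ → 0#) _ k)))
          (+-identityʳ _))))
        (trans (*-congʳ (reflexive (∷ʳ-fromℕ {n = n} ones _))) (sym (trans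
          (+-cong (*-congʳ (reflexive (∷ʳ-fromℕ {n = n} ones _)))
                  (trans (reflexive (∷ʳ-fromℕ {n = n} (λ _ → 0#) _)) (sym (*-identityˡ _))))
          (trans (+-comm _ _) (sym (distribʳ _ _ _))))))
    polynomial-tensor 0ᵀ       = polynomial-const {V d (suc n)} 0ᵀ
    polynomial-tensor (x +ᵀ y) = polynomial-+ {V d (suc n)} (polynomial-tensor x) (polynomial-tensor y)
    polynomial-tensor (r ·ᵀ x) = polynomial-linear {V d (suc n)} {V d (suc n)} record
      { f-cong = ·ᵀ-cong refl ; f-+ = ·ᵀ-distribˡ r
      ; f-· = λ s y → transᵀ (symᵀ (·ᵀ-assoc r s y))
                        (transᵀ (·ᵀ-cong (*-comm r s) reflᵀ) (·ᵀ-assoc s r y)) } (polynomial-tensor x)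

    polynomial-exterior : ∀ v → Polynomial (⋀ (V d (suc n))) λ t → scaleSlots (slot t) v
    polynomial-exterior (ι x)    = polynomial-linear {V d (suc n)} {⋀ (V d (suc n))} ι-linear (polynomial-tensor x)
    polynomial-exterior 0ᴱ       = polynomial-const {⋀ (V d (suc n))} 0ᴱ
    polynomial-exterior 1ᴱ       = polynomial-const {⋀ (V d (suc n))} 1ᴱ
    polynomial-exterior (v +ᴱ w) = polynomial-+ {⋀ (V d (suc n))} (polynomial-exterior v) (polynomial-exterior w)
    polynomial-exterior (r ·ᴱ v) = polynomial-linear {⋀ (V d (suc n))} {⋀ (V d (suc n))} (·-linear r) (polynomial-exterior v)
    polynomial-exterior (v ∧ w)  = polynomial-∧ (polynomial-exterior v) (polynomial-exterior w)

  -- Sums over words, permutations and tuples of permutations.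

  Σᴱ-zero : ∀ {V} {I : Set} (L : List I) {f : I → Exterior V} → (∀ x → f x ≈ᴱ 0ᴱ) → Σᴱ L f ≈ᴱ 0ᴱ
  Σᴱ-zero []      p = reflᴱ
  Σᴱ-zero (x ∷ L) p = transᴱ (+ᴱ-cong (p x) (Σᴱ-zero L p)) (+ᴱ-identityˡ _)

  Σᴱ-comm : ∀ {V} {I J : Set} (L : List I) (M : List J) (f : I → J → Exterior V) →
            Σᴱ L (λ x → Σᴱ M (f x)) ≈ᴱ Σᴱ M λ y → Σᴱ L λ x → f x y
  Σᴱ-comm []      M f = symᴱ (Σᴱ-zero M λ _ → reflᴱ)
  Σᴱ-comm (x ∷ L) M f = transᴱ (+ᴱ-cong reflᴱ (Σᴱ-comm L M f)) (symᴱ (Σᴱ-+ M (f x) _))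

  Σᴱ-tuples-insertAt : ∀ {V} {I : Set} (L : List I) {m} i (f : Vec I (suc m) → Exterior V) →
    Σᴱ (tuples (suc m) L) f ≈ᴱ Σᴱ L λ x → Σᴱ (tuples m L) λ w → f (insertAt w i x)
  Σᴱ-tuples-insertAt L {m}     zero    f = Σᴱ-product L (tuples m L) f
  Σᴱ-tuples-insertAt L {suc m} (suc i) f = transᴱ (Σᴱ-product L (tuples (suc m) L) f) (transᴱ
    (Σᴱ-cong L λ y → Σᴱ-tuples-insertAt L i (f ∘ (y ∷_))) (transᴱ
    (Σᴱ-comm L L _)
    (Σᴱ-cong L λ x → symᴱ (Σᴱ-product L (tuples m L) λ w → f (insertAt w (suc i) x)))))

  Σᴱ-allFin-last : ∀ {V n} (f : Fin (suc n) → Exterior V) →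
    Σᴱ (allFin (suc n)) f ≈ᴱ Σᴱ (allFin n) (f ∘ inject₁) +ᴱ f (fromℕ n)
  Σᴱ-allFin-last f = transᴱ (reflexiveᴱ (Σᴱ-allFin f)) (transᴱ (⋀Sum.sum-init-last f)
    (+ᴱ-cong (reflexiveᴱ (≡.sym (Σᴱ-allFin (f ∘ inject₁)))) reflᴱ))

  Σᴱ-tuples-inject₁ : ∀ {V n} m (f : Vec (Fin (suc n)) m → Exterior V) →
    (∀ v i → lookup v i ≡ fromℕ n → f v ≈ᴱ 0ᴱ) →
    Σᴱ (tuples m (allFin (suc n))) f ≈ᴱ Σᴱ (tuples m (allFin n)) (f ∘ Vec.map inject₁)
  Σᴱ-tuples-inject₁ zero f h = reflᴱ
  Σᴱ-tuples-inject₁ {n = n} (suc m) f h = begin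
    Σᴱ (tuples (suc m) (allFin (suc n))) f
      ≈⟨ Σᴱ-product (allFin (suc n)) T f ⟩
    Σᴱ (allFin (suc n)) (λ x → Σᴱ T (f ∘ (x ∷_)))
      ≈⟨ Σᴱ-allFin-last _ ⟩
    Σᴱ (allFin n) (λ x → Σᴱ T (f ∘ (inject₁ x ∷_))) +ᴱ Σᴱ T (f ∘ (fromℕ n ∷_))
      ≈⟨ +ᴱ-cong reflᴱ (Σᴱ-zero T λ v → h _ zero ≡.refl) ⟩
    Σᴱ (allFin n) (λ x → Σᴱ T (f ∘ (inject₁ x ∷_))) +ᴱ 0ᴱ
      ≈⟨ +ᴱ-identityʳ _ ⟩
    Σᴱ (allFin n) (λ x → Σᴱ T (f ∘ (inject₁ x ∷_)))
      ≈⟨ Σᴱ-cong (allFin n) (λ x → Σᴱ-tuples-inject₁ m _ λ v i → h _ (suc i)) ⟩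
    Σᴱ (allFin n) (λ x → Σᴱ (tuples m (allFin n)) (f ∘ (inject₁ x ∷_) ∘ Vec.map inject₁))
      ≈⟨ Σᴱ-product (allFin n) (tuples m (allFin n)) (f ∘ Vec.map inject₁) ⟨
    Σᴱ (tuples (suc m) (allFin n)) (f ∘ Vec.map inject₁) ∎
    where
    open ≈ᴱ-Reasoning
    T = tuples m (allFin (suc n))

  -- Deleting n + 1 from position i is a bijection onto S_n. As `permutations` filters a list of
  -- words, the sum is extended by zero to all words, where it splits entry by entry, and is
  -- filtered again at the end.
  Σᴱ-permutations-insertLast : ∀ {V n} i (f : Vec (Fin (suc n)) (suc n) → Exterior V) →
    (∀ v → lookup v i ≢ fromℕ n → f v ≈ᴱ 0ᴱ) →
    Σᴱ (permutations (suc n)) f ≈ᴱ Σᴱ (permutations n) (f ∘ insertLast i)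
  Σᴱ-permutations-insertLast {n = n} i f h = begin
    Σᴱ (permutations (suc n)) f
      ≈⟨ Σᴱ-filter unique? (tuples (suc n) (allFin (suc n))) f ⟩
    Σᴱ (tuples (suc n) (allFin (suc n))) f′
      ≈⟨ Σᴱ-tuples-insertAt (allFin (suc n)) i f′ ⟩
    Σᴱ (allFin (suc n)) (λ x → Σᴱ T λ w → f′ (insertAt w i x))
      ≈⟨ Σᴱ-allFin-last _ ⟩
    Σᴱ (allFin n) (λ x → Σᴱ T λ w → f′ (insertAt w i (inject₁ x))) +ᴱ Σᴱ T (λ w → f′ (insertAt w i (fromℕ n)))
      ≈⟨ +ᴱ-cong (Σᴱ-zero (allFin n) λ x → Σᴱ-zero T λ w → f′-off w x) reflᴱ ⟩
    0ᴱ +ᴱ Σᴱ T (λ w → f′ (insertAt w i (fromℕ n)))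
      ≈⟨ +ᴱ-identityˡ _ ⟩
    Σᴱ T (λ w → f′ (insertAt w i (fromℕ n)))
      -- A word that contains n + 1 a second time is no permutation, so the other entries may be
      -- restricted to smaller values.
      ≈⟨ Σᴱ-tuples-inject₁ n _ (λ w k p → reflexiveᴱ (≡.cong (λ q → if q then f (insertAt w i (fromℕ n)) else 0ᴱ)
           (dec-false (unique? (insertAt w i (fromℕ n))) (insertAt-¬unique w i k p)))) ⟩
    Σᴱ (tuples n (allFin n)) (f′ ∘ insertLast i)
      ≈⟨ Σᴱ-cong (tuples n (allFin n)) (λ w → reflexiveᴱ (≡.cong (λ q → if q then f (insertLast i w) else 0ᴱ)
           (unique?-insertLast i w))) ⟩
    Σᴱ (tuples n (allFin n)) (λ w → if does (unique? w) then f (insertLast i w) else 0ᴱ)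
      ≈⟨ Σᴱ-filter unique? (tuples n (allFin n)) (f ∘ insertLast i) ⟨
    Σᴱ (permutations n) (f ∘ insertLast i) ∎
    where
    open ≈ᴱ-Reasoning
    T = tuples n (allFin (suc n))
    f′ : Vec (Fin (suc n)) (suc n) → Exterior _
    f′ v = if does (unique? v) then f v else 0ᴱ
    f′-off : ∀ w x → f′ (insertAt w i (inject₁ x)) ≈ᴱ 0ᴱ
    f′-off w x with does (unique? (insertAt w i (inject₁ x)))
    ... | true  = h _ λ p → fromℕ≢inject₁ (≡.trans (≡.sym p) (Vecₚ.insertAt-lookup w i (inject₁ x)))
    ... | false = reflᴱ

  -- Carries a reindexing of one slot over to all d slots. `P` is a condition outside of which
  -- summands vanish; for the Cayley form it puts the largest value at position i.
  Σᴱ-tuples-reindex : ∀ {V} {I J : Set} {P : I → Set} {L : List I} {M : List J} (φ : J → I) →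
    (∀ (f : I → Exterior V) → (∀ x → ¬ P x → f x ≈ᴱ 0ᴱ) → Σᴱ L f ≈ᴱ Σᴱ M (f ∘ φ)) →
    ∀ d (f : Vec I d → Exterior V) → (∀ v j → ¬ P (lookup v j) → f v ≈ᴱ 0ᴱ) →
    Σᴱ (tuples d L) f ≈ᴱ Σᴱ (tuples d M) (f ∘ Vec.map φ)
  Σᴱ-tuples-reindex φ r zero f h = reflᴱ
  Σᴱ-tuples-reindex {L = L} {M} φ r (suc d) f h = transᴱ (Σᴱ-product L (tuples d L) f) (transᴱ
    (r _ λ x ¬p → Σᴱ-zero (tuples d L) λ v → h (x ∷ v) zero ¬p) (transᴱ
    (Σᴱ-cong M λ y → Σᴱ-tuples-reindex φ r d (f ∘ (φ y ∷_)) λ v j → h (φ y ∷ v) (suc j))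
    (symᴱ (Σᴱ-product M (tuples d M) (f ∘ Vec.map φ)))))

  Σᴱ-sumᴱ : ∀ {V} {I : Set} {m} (L : List I) (f : I → Fin m → Exterior V) →
            Σᴱ L (λ x → sumᴱ (f x)) ≈ᴱ sumᴱ λ i → Σᴱ L λ x → f x i
  Σᴱ-sumᴱ {m = m} []      f = symᴱ (⋀Sum.sum-replicate-zero m)
  Σᴱ-sumᴱ (x ∷ L) f = transᴱ (+ᴱ-cong reflᴱ (Σᴱ-sumᴱ L f)) (symᴱ (⋀Sum.∑-distrib-+ (f x) _))

  sumᴱ-linear : ∀ {V W m F} → IsLinear (⋀ V) (⋀ W) F → (f : Vector (Exterior V) m) →
                F (sumᴱ f) ≈ᴱ sumᴱ (F ∘ f)
  sumᴱ-linear {m = zero}  lin f = transᴱ (IsLinear.f-cong lin (symᴱ (·ᴱ-zeroˡ 0ᴱ)))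
                                    (transᴱ (IsLinear.f-· lin 0# 0ᴱ) (·ᴱ-zeroˡ _))
  sumᴱ-linear {m = suc m} lin f = transᴱ (IsLinear.f-+ lin _ _) (+ᴱ-cong reflᴱ (sumᴱ-linear lin (f ∘ suc)))

  -- Skew derivations of the exterior algebra

  negation : ∀ {W} → LinearMap W W
  negation {W} = record
    { fun = (- 1#) *ₗ_
    ; isLinear = record
      { f-cong = *ₗ-congˡ
      ; f-+ = *ₗ-distribˡ (- 1#)
      ; f-· = λ r x → ≈ᴹ-trans (≈ᴹ-sym (*ₗ-assoc (- 1#) r x))
                        (≈ᴹ-trans (*ₗ-congʳ (*-comm (- 1#) r)) (*ₗ-assoc r (- 1#) x))
      }
    }
    where open Module W

  module SkewDerivation {V W : Mod} (f : LinearMap V W) (θ : Carrierᴹ V → 𝕜)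
    (θ-cong : ∀ {x y} → Module._≈ᴹ_ V x y → θ x ≈ θ y)
    (θ-+ : ∀ x y → θ (Module._+ᴹ_ V x y) ≈ θ x + θ y)
    (θ-· : ∀ r x → θ (Module._*ₗ_ V r x) ≈ r * θ x) where

    P : Exterior V → Exterior W
    P = fun (exteriorMap f)

    P-cong : ∀ {x y} → x ≈ᴱ y → P x ≈ᴱ P y
    P-cong = LinearMap.f-cong (exteriorMap f)

    -- The grade involution, (-1)^k in degree k. As the algebra map induced by the negation of
    -- vectors it requires no grading.
    α : Exterior W → Exterior W
    α = fun (exteriorMap negation)

    α-cong : ∀ {x y} → x ≈ᴱ y → α x ≈ᴱ α y
    α-cong = LinearMap.f-cong (exteriorMap negation)

    D : Exterior V → Exterior W
    D (ι v)    = θ v ·ᴱ 1ᴱ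
    D 0ᴱ       = 0ᴱ
    D 1ᴱ       = 0ᴱ
    D (x +ᴱ y) = D x +ᴱ D y
    D (r ·ᴱ x) = r ·ᴱ D x
    D (x ∧ y)  = D x ∧ P y +ᴱ α (P x) ∧ D y

    ·1∧ : ∀ {U} r (x : Exterior U) → (r ·ᴱ 1ᴱ) ∧ x ≈ᴱ r ·ᴱ x
    ·1∧ r x = transᴱ (·ᴱ-∧ˡ r 1ᴱ x) (·ᴱ-cong refl (∧-identityˡ x))

    ∧·1 : ∀ {U} r (x : Exterior U) → x ∧ (r ·ᴱ 1ᴱ) ≈ᴱ r ·ᴱ x
    ∧·1 r x = transᴱ (·ᴱ-∧ʳ r x 1ᴱ) (·ᴱ-cong refl (∧-identityʳ x))

    D-∧-cong : ∀ {x x′ y y′} → D x ≈ᴱ D x′ → P x ≈ᴱ P x′ → D y ≈ᴱ D y′ → P y ≈ᴱ P y′ →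
               D (x ∧ y) ≈ᴱ D (x′ ∧ y′)
    D-∧-cong dx px dy py = +ᴱ-cong (∧-cong dx py) (∧-cong (α-cong px) dy)

    -- `∧-assoc` works because `α` and `P` are multiplicative by computation. The sign in `α`
    -- matters for `ι-square`, where θ(v)P(v) and -θ(v)P(v) cancel.
    D-cong : ∀ {x y} → x ≈ᴱ y → D x ≈ᴱ D y
    D-cong reflᴱ               = reflᴱ
    D-cong (symᴱ p)            = symᴱ (D-cong p)
    D-cong (transᴱ p q)        = transᴱ (D-cong p) (D-cong q)
    D-cong (+ᴱ-cong p q)       = +ᴱ-cong (D-cong p) (D-cong q)
    D-cong (·ᴱ-cong r p)       = ·ᴱ-cong r (D-cong p)
    D-cong (∧-cong {x} {x′} {y} {y′} p q) =
      D-∧-cong {x} {x′} {y} {y′} (D-cong p) (P-cong p) (D-cong q) (P-cong q)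
    D-cong (+ᴱ-assoc _ _ _)    = +ᴱ-assoc _ _ _
    D-cong (+ᴱ-comm _ _)       = +ᴱ-comm _ _
    D-cong (+ᴱ-identityˡ _)    = +ᴱ-identityˡ _
    D-cong (·ᴱ-zeroˡ _)        = ·ᴱ-zeroˡ _
    D-cong (·ᴱ-distribʳ _ _ _) = ·ᴱ-distribʳ _ _ _
    D-cong (·ᴱ-distribˡ _ _ _) = ·ᴱ-distribˡ _ _ _
    D-cong (·ᴱ-identityˡ _)    = ·ᴱ-identityˡ _
    D-cong (·ᴱ-assoc _ _ _)    = ·ᴱ-assoc _ _ _
    D-cong (∧-assoc x y z)     = transᴱ
      (+ᴱ-cong (∧-distribʳ _ _ _) reflᴱ) (transᴱ
      (+ᴱ-assoc _ _ _)
      (+ᴱ-cong (∧-assoc _ _ _) (transᴱ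
        (+ᴱ-cong (∧-assoc _ _ _) (∧-assoc _ _ _))
        (symᴱ (∧-distribˡ _ _ _)))))
    D-cong (∧-identityˡ x)     = transᴱ (+ᴱ-cong (∧-zeroˡ _) (∧-identityˡ _)) (+ᴱ-identityˡ _)
    D-cong (∧-identityʳ x)     = transᴱ (+ᴱ-cong (∧-identityʳ _) (∧-zeroʳ _)) (+ᴱ-identityʳ _)
    D-cong (∧-distribˡ x y z)  =
      transᴱ (+ᴱ-cong (∧-distribˡ _ _ _) (∧-distribˡ _ _ _)) (interchangeᴱ _ _ _ _)
    D-cong (∧-distribʳ x y z)  =
      transᴱ (+ᴱ-cong (∧-distribʳ _ _ _) (∧-distribʳ _ _ _)) (interchangeᴱ _ _ _ _)
    D-cong (·ᴱ-∧ˡ r x y)       =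
      transᴱ (+ᴱ-cong (·ᴱ-∧ˡ r _ _) (·ᴱ-∧ˡ r _ _)) (symᴱ (·ᴱ-distribˡ r _ _))
    D-cong (·ᴱ-∧ʳ r x y)       =
      transᴱ (+ᴱ-cong (·ᴱ-∧ʳ r _ _) (·ᴱ-∧ʳ r _ _)) (symᴱ (·ᴱ-distribˡ r _ _))
    D-cong (ι-cong p)          = ·ᴱ-cong (θ-cong p) reflᴱ
    D-cong (ι-+ u v)           = transᴱ (·ᴱ-cong (θ-+ u v) reflᴱ) (·ᴱ-distribʳ _ _ _)
    D-cong (ι-· r v)           = transᴱ (·ᴱ-cong (θ-· r v) reflᴱ) (·ᴱ-assoc _ _ _)
    D-cong (ι-square v)        = transᴱ
      (+ᴱ-cong (·1∧ _ _) (transᴱ (∧·1 _ _) (·ᴱ-cong refl (ι-· (- 1#) _)))) (transᴱ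
      (symᴱ (·ᴱ-distribˡ _ _ _)) (transᴱ
      (·ᴱ-cong refl (Module.-ᴹ‿inverseʳ (⋀ W) _))
      (·ᴱ-zeroʳ _)))

    D-Σᴱ : ∀ {I : Set} (L : List I) (g : I → Exterior V) → D (Σᴱ L g) ≡ Σᴱ L (D ∘ g)
    D-Σᴱ []      g = ≡.refl
    D-Σᴱ (x ∷ L) g = ≡.cong (D (g x) +ᴱ_) (D-Σᴱ L g)

    P-Σᴱ : ∀ {I : Set} (L : List I) (g : I → Exterior V) → P (Σᴱ L g) ≡ Σᴱ L (P ∘ g)
    P-Σᴱ []      g = ≡.refl
    P-Σᴱ (x ∷ L) g = ≡.cong (P (g x) +ᴱ_) (P-Σᴱ L g)

    P-⋀ᵢ : ∀ {m} (x : Vector (Exterior V) m) → P (⋀ᵢ x) ≡ ⋀ᵢ (P ∘ x)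
    P-⋀ᵢ {zero}  x = ≡.refl
    P-⋀ᵢ {suc m} x = ≡.cong (P (x zero) ∧_) (P-⋀ᵢ (x ∘ suc))

    contraction : ∀ {m} → Vector (Carrierᴹ V) (suc m) → Fin (suc m) → Exterior W
    contraction x i = ((- 1#) ^ toℕ i * θ (x i)) ·ᴱ ⋀ᵢ λ k → ι (fun f (x (punchIn i k)))

    -- Before `D` reaches factor i, the twisted Leibniz rule applies `α` to each of the i factors in
    -- front of it, which yields (-1)^i.
    D-⋀ᵢ : ∀ {m} (x : Vector (Carrierᴹ V) (suc m)) → D (⋀ᵢ (ι ∘ x)) ≈ᴱ sumᴱ (contraction x)
    D-⋀ᵢ {m} x = +ᴱ-cong
      (transᴱ (·1∧ _ _) (·ᴱ-cong (sym (*-identityˡ _)) (reflexiveᴱ (P-⋀ᵢ (ι ∘ x ∘ suc)))))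
      (tail m x)
      where
      tail : ∀ m (x : Vector (Carrierᴹ V) (suc m)) →
             α (ι (fun f (x zero))) ∧ D (⋀ᵢ (ι ∘ x ∘ suc)) ≈ᴱ sumᴱ (contraction x ∘ suc)
      -- The remaining wedge is empty, and `D` vanishes on `1ᴱ`.
      tail zero    x = ∧-zeroʳ _
      tail (suc m) x = begin
        α (ι y) ∧ D (⋀ᵢ (ι ∘ x ∘ suc))
          ≈⟨ ∧-cong (ι-· (- 1#) y) (D-⋀ᵢ (x ∘ suc)) ⟩
        ((- 1#) ·ᴱ ι y) ∧ sumᴱ (contraction (x ∘ suc))
          ≈⟨ sumᴱ-linear record { f-cong = ∧-cong reflᴱ ; f-+ = ∧-distribˡ _ ; f-· = λ r z → ·ᴱ-∧ʳ r _ z }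
               (contraction (x ∘ suc)) ⟩
        sumᴱ (λ i → ((- 1#) ·ᴱ ι y) ∧ contraction (x ∘ suc) i)
          ≈⟨ ⋀Sum.sum-cong-≋ {x = λ i → ((- 1#) ·ᴱ ι y) ∧ contraction (x ∘ suc) i} {contraction x ∘ suc} move ⟩
        sumᴱ (contraction x ∘ suc) ∎
        where
        open ≈ᴱ-Reasoning
        y = fun f (x zero)
        move : ∀ i → ((- 1#) ·ᴱ ι y) ∧ contraction (x ∘ suc) i ≈ᴱ contraction x (suc i)
        move i = transᴱ (·ᴱ-∧ʳ _ _ _) (transᴱ (·ᴱ-cong refl (·ᴱ-∧ˡ _ _ _))
          (transᴱ (symᴱ (·ᴱ-assoc _ _ _)) (·ᴱ-cong (trans (*-comm _ _) (sym (*-assoc _ _ _))) reflᴱ)))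

  -- Contraction of the Cayley form

  initMap : ∀ {n} → LinearMap (𝕜^ (suc n)) (𝕜^ n)
  initMap = record
    { fun = init
    ; isLinear = record { f-cong = _∘ inject₁ ; f-+ = λ _ _ _ → refl ; f-· = λ _ _ _ → refl } }

  ∏-≔-+ : ∀ {d n} (x : Vector (Vector 𝕜 n) d) j (u v : Vector 𝕜 n) i →
    ∏ (λ k → (x [ j ]≔ λ l → u l + v l) k i) ≈ ∏ (λ k → (x [ j ]≔ u) k i) + ∏ (λ k → (x [ j ]≔ v) k i)
  ∏-≔-+ x zero    u v i = distribʳ _ _ _
  ∏-≔-+ x (suc j) u v i = trans (*-congˡ (∏-≔-+ (x ∘ suc) j u v i)) (distribˡ _ _ _)

  ∏-≔-· : ∀ {d n} (x : Vector (Vector 𝕜 n) d) j r (u : Vector 𝕜 n) i →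
    ∏ (λ k → (x [ j ]≔ λ l → r * u l) k i) ≈ r * ∏ (λ k → (x [ j ]≔ u) k i)
  ∏-≔-· x zero    r u i = *-assoc _ _ _
  ∏-≔-· x (suc j) r u i = trans (*-congˡ (∏-≔-· (x ∘ suc) j r u i)) (x∙yz≈y∙xz _ _ _)

  -- e*_{n+1} ⊗ ⋯ ⊗ e*_{n+1}
  lastForm : ∀ {d n} → Tensor d (𝕜^ (suc n)) → 𝕜
  lastForm (⨂ x)    = ∏ (last ∘ x)
  lastForm 0ᵀ       = 0#
  lastForm (x +ᵀ y) = lastForm x + lastForm y
  lastForm (r ·ᵀ x) = r * lastForm x

  lastForm-cong : ∀ {d n} {x y : Tensor d (𝕜^ (suc n))} → x ≈ᵀ y → lastForm x ≈ lastForm y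
  lastForm-cong reflᵀ               = refl
  lastForm-cong (symᵀ p)            = sym (lastForm-cong p)
  lastForm-cong (transᵀ p q)        = trans (lastForm-cong p) (lastForm-cong q)
  lastForm-cong (+ᵀ-cong p q)       = +-cong (lastForm-cong p) (lastForm-cong q)
  lastForm-cong (·ᵀ-cong r p)       = *-cong r (lastForm-cong p)
  lastForm-cong (+ᵀ-assoc _ _ _)    = +-assoc _ _ _
  lastForm-cong (+ᵀ-comm _ _)       = +-comm _ _
  lastForm-cong (+ᵀ-identityˡ _)    = +-identityˡ _
  lastForm-cong (·ᵀ-zeroˡ _)        = zeroˡ _
  lastForm-cong (·ᵀ-distribʳ _ _ _) = distribʳ _ _ _
  lastForm-cong (·ᵀ-distribˡ _ _ _) = distribˡ _ _ _
  lastForm-cong (·ᵀ-identityˡ _)    = *-identityˡ _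
  lastForm-cong (·ᵀ-assoc _ _ _)    = *-assoc _ _ _
  lastForm-cong (⨂-cong p)          = ∏-cong λ j → p j (fromℕ _)
  lastForm-cong (⨂-+ x j u v)       = ∏-≔-+ x j u v (fromℕ _)
  lastForm-cong (⨂-· x j r u)       = ∏-≔-· x j r u (fromℕ _)

  module Drop (d n : ℕ) = SkewDerivation {V d (suc n)} {V d n} (tensorMap λ _ → initMap)
    lastForm lastForm-cong (λ _ _ → refl) (λ _ _ → refl)

  ∏-zero : ∀ {d} (x : Vector 𝕜 d) j → x j ≈ 0# → ∏ x ≈ 0#
  ∏-zero x zero    p = trans (*-congʳ p) (zeroˡ _)
  ∏-zero x (suc j) p = trans (*-congˡ (∏-zero (x ∘ suc) j p)) (zeroʳ _)

  ∏-one : ∀ {d} (x : Vector 𝕜 d) → (∀ j → x j ≈ 1#) → ∏ x ≈ 1#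
  ∏-one {d} x p = trans (∏-cong p) (∏.sum-replicate-zero d)

  ⨂-zero : ∀ {d M} (x : Vector (Carrierᴹ M) d) j → Module._≈ᴹ_ M (x j) (Module.0ᴹ M) → ⨂ x ≈ᵀ 0ᵀ {M = M}
  ⨂-zero {d} {M} x j p = transᵀ (⨂-cong pointwise) (transᵀ (⨂-· x j 0# 0ᴹ) (·ᵀ-zeroˡ _))
    where
    open Module M
    pointwise : ∀ i → x i ≈ᴹ (x [ j ]≔ (0# *ₗ 0ᴹ)) i
    pointwise i with i ≟ j
    ... | yes ≡.refl rewrite updateAt-updates j {λ _ → 0# *ₗ 0ᴹ} x = ≈ᴹ-trans p (≈ᴹ-sym (*ₗ-zeroˡ 0ᴹ))
    ... | no i≢j rewrite updateAt-minimal i j {λ _ → 0# *ₗ 0ᴹ} x i≢j = ≈ᴹ-refl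

  ι-zero : ∀ {V x} → Module._≈ᴹ_ V x (Module.0ᴹ V) → ι {V} x ≈ᴱ 0ᴱ
  ι-zero {V} p = transᴱ (ι-cong (Module.≈ᴹ-trans V p (Module.≈ᴹ-sym V (Module.*ₗ-zeroˡ V _))))
    (transᴱ (ι-· 0# (Module.0ᴹ V)) (·ᴱ-zeroˡ _))

  ⋀ᵢ-zero : ∀ {V m} (x : Vector (Exterior V) m) i → x i ≈ᴱ 0ᴱ → ⋀ᵢ x ≈ᴱ 0ᴱ
  ⋀ᵢ-zero x zero    p = transᴱ (∧-cong p reflᴱ) (∧-zeroˡ _)
  ⋀ᵢ-zero x (suc i) p = transᴱ (∧-cong reflᴱ (⋀ᵢ-zero (x ∘ suc) i p))(∧-zeroʳ _)

  e-off : ∀ {n} {i j : Fin n} → i ≢ j → e i j ≈ 0#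
  e-off {i = i} {j} p rewrite dec-false (i ≟ j) p = refl

  e-on : ∀ {n} (i : Fin n) → e i i ≈ 1#
  e-on i rewrite dec-true (i ≟ i) ≡.refl = refl

  e-inject₁ : ∀ {n} (i j : Fin n) → e (inject₁ i) (inject₁ j) ≈ e i j
  e-inject₁ i j with i ≟ j
  ... | yes ≡.refl = e-on (inject₁ i)
  ... | no i≢j     = e-off (i≢j ∘ inject₁-injective)

  -- One slot is enough, and `suc d` provides it: the permutation in slot `zero` takes the value n +
  -- 1 at some position, and truncation kills the basis vector there.
  P-ω : ∀ d n → Drop.P (suc d) n (ω (suc d) (suc n)) ≈ᴱ 0ᴱ
  P-ω d n = transᴱ (reflexiveᴱ (P-Σᴱ L _)) (transᴱ
    (Σᴱ-cong-All (allUnique {suc d} {suc n}) term) (Σᴱ-zero L λ _ → reflᴱ))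
    where
    open Drop (suc d) n
    L = tuples (suc d) (permutations (suc n))
    term : ∀ π → AllUnique {suc d} {suc n} π →
      P (∏ (λ j → sgn (lookup π j)) ·ᴱ cayleyTerm (λ _ → e) π) ≈ᴱ 0ᴱ
    term π u = transᴱ (·ᴱ-cong refl (transᴱ
        (reflexiveᴱ (P-⋀ᵢ (ι ∘ x)))
        (⋀ᵢ-zero (P ∘ ι ∘ x) i (ι-zero (⨂-zero (λ j → init (e (lookup (lookup π j) i))) zero λ k →
          e-off {i = lookup (lookup π zero) i} {inject₁ k} λ q → fromℕ≢inject₁ (≡.trans (≡.sym p) q))))))
      (·ᴱ-zeroʳ _)
      where
      x : Fin (suc n) → Tensor (suc d) (𝕜^ (suc n))
      x i = ⨂ λ j → e (lookup (lookup π j) i)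
      i : Fin (suc n)
      i = proj₁ (unique⇒surjective (u zero) (fromℕ n))
      p : lookup (lookup π zero) i ≡ fromℕ n
      p = proj₂ (unique⇒surjective (u zero) (fromℕ n))

  -1^-square : ∀ i → (- 1#) ^ i * (- 1#) ^ i ≈ 1#
  -1^-square zero    = *-identityˡ 1#
  -1^-square (suc i) = trans (*-interchange _ _ _ _)
    (trans (*-cong (trans (*-congˡ (sym (*-identityʳ _))) (-1*-1* 1#)) (-1^-square i)) (*-identityˡ 1#))

  sgn-insertLast : ∀ {n m} i (w : Vec (Fin n) m) →
                   sgn (insertLast i w) ≈ ((- 1#) ^ toℕ i * (- 1#) ^ m) * sgn w
  sgn-insertLast {m = m} i w = begin
    sgn (insertLast i w)
      ≈⟨ *-identityʳ _ ⟨
    sgn (insertLast i w) * 1#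
      ≈⟨ *-congˡ (-1^-square (toℕ i)) ⟨
    sgn (insertLast i w) * (εᵢ * εᵢ)
      ≈⟨ *-assoc _ _ _ ⟨
    (sgn (insertLast i w) * εᵢ) * εᵢ
      ≈⟨ *-congʳ (^-homo-* (- 1#) (inversions (insertLast i w)) (toℕ i)) ⟨
    (- 1#) ^ (inversions (insertLast i w) ℕ.+ toℕ i) * εᵢ
      ≡⟨ ≡.cong (λ q → (- 1#) ^ q * εᵢ) (inversions-insertLast i w) ⟩
    (- 1#) ^ (inversions w ℕ.+ m) * εᵢ
      ≈⟨ *-congʳ (^-homo-* (- 1#) (inversions w) m) ⟩
    (sgn w * (- 1#) ^ m) * εᵢ
      ≈⟨ xy∙z≈zy∙x _ _ _ ⟩
    (εᵢ * (- 1#) ^ m) * sgn w ∎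
    where
    open SetoidReasoning setoid
    εᵢ = (- 1#) ^ toℕ i

  -- The parity of the number of slots enters here: factors of square 1 cancel in pairs and a single
  -- one remains.
  ∏-odd : ∀ q {c} → c * c ≈ 1# → ∏ {suc (q ℕ.* 2)} (λ _ → c) ≈ c
  ∏-odd zero    p = *-identityʳ _
  ∏-odd (suc q) p = trans (sym (*-assoc _ _ _)) (trans (*-congʳ p) (trans (*-identityˡ _) (∏-odd q p)))

  module _ (q n : ℕ) where

    private
      d : ℕ
      d = suc (q ℕ.* 2)
      open Drop d n
      L = tuples d (permutations (suc n))

    sign-insertLast : ∀ i (π : Vec (Vec (Fin n) n) d) →
      ∏ (λ j → sgn (lookup (Vec.map (insertLast i) π) j)) * (- 1#) ^ toℕ i ≈
      (- 1#) ^ n * ∏ (λ j → sgn (lookup π j))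
    sign-insertLast i π = begin
      ∏ (λ j → sgn (lookup (Vec.map (insertLast i) π) j)) * εᵢ
        ≈⟨ *-congʳ (∏-cong λ j → trans (reflexive (≡.cong sgn (Vecₚ.lookup-map j (insertLast i) π)))
             (sgn-insertLast i (lookup π j))) ⟩
      ∏ (λ j → (εᵢ * εₙ) * sgn (lookup π j)) * εᵢ
        ≈⟨ *-congʳ (∏-distrib-* (λ _ → εᵢ * εₙ) λ j → sgn (lookup π j)) ⟩
      (∏ {d} (λ _ → εᵢ * εₙ) * S) * εᵢ
        ≈⟨ *-congʳ (*-congʳ (∏-odd q (trans (*-interchange _ _ _ _)
             (trans (*-cong (-1^-square (toℕ i)) (-1^-square n)) (*-identityˡ 1#))))) ⟩
      ((εᵢ * εₙ) * S) * εᵢ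
        ≈⟨ *-comm _ _ ⟩
      εᵢ * ((εᵢ * εₙ) * S)
        ≈⟨ *-congˡ (*-assoc _ _ _) ⟩
      εᵢ * (εᵢ * (εₙ * S))
        ≈⟨ *-assoc _ _ _ ⟨
      (εᵢ * εᵢ) * (εₙ * S)
        ≈⟨ *-congʳ (-1^-square (toℕ i)) ⟩
      1# * (εₙ * S)
        ≈⟨ *-identityˡ _ ⟩
      εₙ * S ∎
      where
      open SetoidReasoning setoid
      εᵢ = (- 1#) ^ toℕ i
      εₙ = (- 1#) ^ n
      S = ∏ (λ j → sgn (lookup π j))

    factors : Vec (Vec (Fin (suc n)) (suc n)) d → Fin (suc n) → Tensor d (𝕜^ (suc n))
    factors π i = ⨂ λ j → e (lookup (lookup π j) i)

    contracted : Fin (suc n) → Vec (Vec (Fin (suc n)) (suc n)) d → Exterior (V d n)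
    contracted i π = ∏ (λ j → sgn (lookup π j)) ·ᴱ contraction (factors π) i

    -- `lastForm` multiplies the last coordinates of all slots, so a single slot with another value
    -- at position i annihilates the term.
    contracted-off : ∀ i π j → lookup (lookup π j) i ≢ fromℕ n → contracted i π ≈ᴱ 0ᴱ
    contracted-off i π j p = transᴱ (·ᴱ-cong refl (transᴱ
      (·ᴱ-cong (trans (*-congˡ (∏-zero (λ k → e (lookup (lookup π k) i) (fromℕ n)) j (e-off p))) (zeroʳ _)) reflᴱ)
      (·ᴱ-zeroˡ _))) (·ᴱ-zeroʳ _)

    contracted-insertLast : ∀ i π → contracted i (Vec.map (insertLast i) π) ≈ᴱ
      (- 1#) ^ n ·ᴱ (∏ (λ j → sgn (lookup π j)) ·ᴱ cayleyTerm (λ _ → e) π)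
    contracted-insertLast i π = transᴱ (symᴱ (·ᴱ-assoc _ _ _)) (transᴱ
      (·ᴱ-cong
        (trans (*-congˡ (trans (*-congˡ (∏-one (λ j → e (lookup (lookup π⁺ j) i) (fromℕ n)) at-last)) (*-identityʳ _)))
          (sign-insertLast i π))
        (⋀ᵢ-cong λ k → ι-cong (⨂-cong λ j l → trans
          (reflexive (≡.cong (λ a → e a (inject₁ l)) (elsewhere k j))) (e-inject₁ (lookup (lookup π j) k) l))))
      (·ᴱ-assoc _ _ _))
      where
      π⁺ = Vec.map (insertLast i) π
      at-last : ∀ j → e (lookup (lookup π⁺ j) i) (fromℕ n) ≈ 1#
      at-last j rewrite Vecₚ.lookup-map j (insertLast i) π | insertLast-last i (lookup π j) = e-on (fromℕ n)
      elsewhere : ∀ k j → lookup (lookup π⁺ j) (punchIn i k) ≡ inject₁ (lookup (lookup π j) k)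
      elsewhere k j rewrite Vecₚ.lookup-map j (insertLast i) π = insertLast-punchIn i (lookup π j) k

    D-ω : D (ω d (suc n)) ≈ᴱ ((suc n × 1#) * (- 1#) ^ n) ·ᴱ ω d n
    D-ω = begin
      D (ω d (suc n))
        ≡⟨ D-Σᴱ L _ ⟩
      Σᴱ L (λ π → ∏ (λ j → sgn (lookup π j)) ·ᴱ D (⋀ᵢ (ι ∘ factors π)))
        ≈⟨ Σᴱ-cong L (λ π → transᴱ (·ᴱ-cong refl (D-⋀ᵢ (factors π)))
             (sumᴱ-linear (·-linear _) (contraction (factors π)))) ⟩
      Σᴱ L (λ π → sumᴱ λ i → contracted i π)
        ≈⟨ Σᴱ-sumᴱ L (λ π i → contracted i π) ⟩
      sumᴱ (λ i → Σᴱ L (contracted i))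
        ≈⟨ ⋀Sum.sum-cong-≋ {x = λ i → Σᴱ L (contracted i)} {λ _ → (- 1#) ^ n ·ᴱ ω d n} each ⟩
      sumᴱ {n = suc n} (λ _ → (- 1#) ^ n ·ᴱ ω d n)
        ≈⟨ multiple (suc n) _ ⟩
      (suc n × 1#) ·ᴱ ((- 1#) ^ n ·ᴱ ω d n)
        ≈⟨ ·ᴱ-assoc _ _ _ ⟨
      ((suc n × 1#) * (- 1#) ^ n) ·ᴱ ω d n ∎
      where
      open ≈ᴱ-Reasoning
      each : ∀ i → Σᴱ L (contracted i) ≈ᴱ (- 1#) ^ n ·ᴱ ω d n
      each i = transᴱ (Σᴱ-tuples-reindex {P = λ v → lookup v i ≡ fromℕ n} (insertLast i)
          (Σᴱ-permutations-insertLast i) d (contracted i) (contracted-off i))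
        (transᴱ (Σᴱ-cong (tuples d (permutations n)) (contracted-insertLast i))
          (Σᴱ-· _ (tuples d (permutations n)) _))
      multiple : ∀ m (x : Exterior (V d n)) → sumᴱ {n = m} (λ _ → x) ≈ᴱ (m × 1#) ·ᴱ x
      multiple zero    x = symᴱ (·ᴱ-zeroˡ x)
      multiple (suc m) x = transᴱ (+ᴱ-cong (symᴱ (·ᴱ-identityˡ x)) (multiple m x)) (symᴱ (·ᴱ-distribʳ x _ _))

  -- Restriction of highest weight vectors

  extendMap : ∀ {n} → LinearMap (𝕜^ n) (𝕜^ (suc n))
  extendMap = record
    { fun = _∷ʳ 0#
    ; isLinear = record
      { f-cong = λ p → cong p ; f-+ = λ x y → add x y ; f-· = λ r x → mul r x } }
    where
    cong : ∀ {n} {x y : Vector 𝕜 n} → (∀ i → x i ≈ y i) → ∀ i → (x ∷ʳ 0#) i ≈ (y ∷ʳ 0#) i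
    cong {zero}  p i       = refl
    cong {suc n} p zero    = p zero
    cong {suc n} p (suc i) = cong (p ∘ suc) i
    add : ∀ {n} (x y : Vector 𝕜 n) i → ((λ k → x k + y k) ∷ʳ 0#) i ≈ (x ∷ʳ 0#) i + (y ∷ʳ 0#) i
    add {zero}  x y i       = sym (+-identityˡ 0#)
    add {suc n} x y zero    = refl
    add {suc n} x y (suc i) = add (x ∘ suc) (y ∘ suc) i
    mul : ∀ {n} r (x : Vector 𝕜 n) i → ((λ k → r * x k) ∷ʳ 0#) i ≈ r * (x ∷ʳ 0#) i
    mul {zero}  r x i       = sym (zeroʳ r)
    mul {suc n} r x zero    = refl
    mul {suc n} r x (suc i) = mul r (x ∘ suc) i

  unit : Unit
  unit = record { value = 1# ; inverse = 1# ; value*inverse = *-identityˡ 1# }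

  1^ : ∀ m → 1# ^ m ≈ 1#
  1^ zero    = refl
  1^ (suc m) = trans (*-identityˡ _) (1^ m)

  -- The embedding u ↦ u ⊕ 1 along which truncation is equivariant; it is how invariance under
  -- U(n+1) descends to U(n).
  borderedMatrix : ∀ {n} → Matrix n → Matrix (suc n)
  borderedMatrix u = (λ i → u i ∷ʳ 0#) ∷ʳ ((λ _ → 0#) ∷ʳ 1#)

  module _ {n} (u : Matrix n) where

    bordered-inner : ∀ i j → borderedMatrix u (inject₁ i) (inject₁ j) ≡ u i j
    bordered-inner i j = ≡.trans (≡.cong (λ r → r (inject₁ j)) (∷ʳ-inject₁ (λ i → u i ∷ʳ 0#) _ i))
      (∷ʳ-inject₁ (u i) 0# j)

    bordered-column : ∀ i → borderedMatrix u (inject₁ i) (fromℕ n) ≡ 0#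
    bordered-column i = ≡.trans (≡.cong (λ r → r (fromℕ n)) (∷ʳ-inject₁ (λ i → u i ∷ʳ 0#) _ i))
      (∷ʳ-fromℕ (u i) 0#)

    bordered-row : ∀ j → borderedMatrix u (fromℕ n) (inject₁ j) ≡ 0#
    bordered-row j = ≡.trans (≡.cong (λ r → r (inject₁ j)) (∷ʳ-fromℕ (λ i → u i ∷ʳ 0#) _))
      (∷ʳ-inject₁ {n = n} (λ _ → 0#) 1# j)

    bordered-corner : borderedMatrix u (fromℕ n) (fromℕ n) ≡ 1#
    bordered-corner = ≡.trans (≡.cong (λ r → r (fromℕ n)) (∷ʳ-fromℕ (λ i → u i ∷ʳ 0#) _))
      (∷ʳ-fromℕ {n = n} (λ _ → 0#) 1#)

    bordered-unitriangular : IsUpperUnitriangular u → IsUpperUnitriangular (borderedMatrix u)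
    bordered-unitriangular U = record
      { on-diagonal = ∷ʳ-elim (λ i → trans (reflexive (bordered-inner i i)) (on-diagonal i))
          (reflexive bordered-corner)
      ; below = λ {i} {j} → ∷ʳ-elim {P = λ i → ∀ j → j Fin.< i → borderedMatrix u i j ≈ 0#}
          (λ i → ∷ʳ-elim
            (λ j j<i → trans (reflexive (bordered-inner i j))
              (below (≡.subst₂ ℕ._<_ (Finₚ.toℕ-inject₁ j) (Finₚ.toℕ-inject₁ i) j<i)))
            (λ _ → reflexive (bordered-column i)))
          (∷ʳ-elim (λ j _ → reflexive (bordered-row j)) (λ l<l → contradiction ≡.refl (ℕₚ.<⇒≢ l<l)))
          i j
      }
      where open IsUpperUnitriangular U

    init-bordered : ∀ x i → fun (matrixMap u) (init x) i ≈ init (fun (matrixMap (borderedMatrix u)) x) i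
    init-bordered x i = sym (trans (sum-init-last λ j → borderedMatrix u (inject₁ i) j * x j) (trans
      (+-cong (sum-cong-≋ λ j → *-congʳ (reflexive (bordered-inner i j)))
              (trans (*-congʳ (reflexive (bordered-column i))) (zeroˡ _)))
      (+-identityʳ _)))

  init-diag : ∀ {n} (a : Fin n → Unit) b x i →
    fun (matrixMap (diag a)) (init x) i ≈ init (fun (matrixMap (diag (a ∷ʳ b))) x) i
  init-diag a b x i = trans (diag-scale a (init x) i) (sym (trans (diag-scale (a ∷ʳ b) x (inject₁ i))
    (*-congʳ (reflexive (≡.cong value (∷ʳ-inject₁ a b i))))))

  -- Characteristic zero as explicit data: it makes 1, 2, 3, ... available as torus entries and
  -- permits division by n + 1.
  InvertsNaturals : (ℕ → 𝕜) → Set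
  InvertsNaturals r = ∀ t → (suc t × 1#) * r t ≈ 1#

  -- With weights as functions on ℕ one `m` serves all n. For `m` given by the parts of conjugate
  -- partitions this is `pad n` by computation.
  weightOf : ∀ {d} → (Fin d → ℕ → ℕ) → ∀ n → Weight d n
  weightOf m n j i = + m j (toℕ i)

  module _ (d n : ℕ) (m : Fin d → ℕ → ℕ) (m-last : ∀ j → m j n ≡ 0) where

    open Drop d n using (P; P-cong)

    ∏-init : ∀ (a : Fin (suc n) → Unit) j →
      ∏ (λ i → value (a i) ^ m j (toℕ i)) ≈ ∏ (λ i → value (a (inject₁ i)) ^ m j (toℕ i))
    ∏-init a j = trans (∏.sum-init-last (λ i → value (a i) ^ m j (toℕ i))) (trans
      (*-cong
        (∏-cong λ i → reflexive (≡.cong (λ q → value (a (inject₁ i)) ^ m j q) (Finₚ.toℕ-inject₁ i)))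
        (reflexive (≡.cong (value (a (fromℕ n)) ^_) (≡.trans (≡.cong (m j) (Finₚ.toℕ-fromℕ n)) (m-last j)))))
      (*-identityʳ _))

    restrict : HWV d (suc n) (weightOf m (suc n)) → HWV d n (weightOf m n)
    restrict v = record
      { vector = P (vector v)
      ; weight = λ a → transᴱ
          (induced-square {f = λ _ → initMap} {λ j → matrixMap (diag (a j))}
            {λ j → matrixMap (diag (a j ∷ʳ unit))} {λ _ → initMap}
            (λ j → init-diag (a j) unit) (vector v))
          (transᴱ (P-cong (weight v λ j → a j ∷ʳ unit)) (·ᴱ-cong (∏-cong λ j → trans (∏-init (a j ∷ʳ unit) j)
            (∏-cong λ i → reflexive (≡.cong (λ c → value c ^ m j (toℕ i)) (∷ʳ-inject₁ (a j) unit i)))) reflᴱ))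
      ; invariant = λ u U → transᴱ
          (induced-square {f = λ _ → initMap} {λ j → matrixMap (u j)}
            {λ j → matrixMap (borderedMatrix (u j))} {λ _ → initMap}
            (λ j → init-bordered (u j)) (vector v))
          (P-cong (invariant v (λ j → borderedMatrix (u j)) λ j → bordered-unitriangular (u j) (U j)))
      }

    -- The last entry c of diag(1,...,1,c) enters the character with exponent `m j n`, which is 0.
    scaleSlots-unit : ∀ {v} → IsWeightVector (weightOf m (suc n)) v → ∀ (c : Fin d → Unit) →
      scaleSlots (value ∘ c) v ≈ᴱ v
    scaleSlots-unit {v} w c = transᴱ
      (induced-ext {f = λ j → scaleLast (value (c j))} {λ j → matrixMap (diag (a j))} same v)
      (transᴱ (w a) (transᴱ (·ᴱ-cong one reflᴱ) (·ᴱ-identityˡ _)))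
      where
      a : Fin d → Fin (suc n) → Unit
      a j = (λ _ → unit) ∷ʳ c j
      one : ∏ (λ j → ∏ λ i → value (a j i) ^ m j (toℕ i)) ≈ 1#
      one = ∏-one (λ j → ∏ λ i → value (a j i) ^ m j (toℕ i)) λ j → trans (∏-init (a j) j)
        (∏-one (λ i → value (a j (inject₁ i)) ^ m j (toℕ i)) λ i →
          trans (reflexive (≡.cong (λ b → value b ^ m j (toℕ i)) (∷ʳ-inject₁ (λ _ → unit) (c j) i)))
            (1^ (m j (toℕ i))))
      values : ∀ j (i : Fin (suc n)) → value (((λ _ → unit) ∷ʳ c j) i) ≡ (ones ∷ʳ value (c j)) i
      values j = ∷ʳ-elim
        (λ i → ≡.trans (≡.cong value (∷ʳ-inject₁ (λ _ → unit) (c j) i))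
          (≡.sym (∷ʳ-inject₁ ones (value (c j)) i)))
        (≡.trans (≡.cong value (∷ʳ-fromℕ {n = n} (λ _ → unit) (c j)))
          (≡.sym (∷ʳ-fromℕ {n = n} ones (value (c j)))))
      same : ∀ j x i → fun (scaleLast (value (c j))) x i ≈ fun (matrixMap (diag (a j))) x i
      same j x i = trans (*-congʳ (reflexive (≡.sym (values j i)))) (sym (diag-scale (a j) x i))

    scaleSlots-cong : ∀ {s t : Vector 𝕜 d} → (∀ j → s j ≈ t j) → ∀ v → scaleSlots {n = n} s v ≈ᴱ scaleSlots t v
    scaleSlots-cong {s} {t} p = induced-ext {f = λ j → scaleLast (s j)} {λ j → scaleLast (t j)}
      λ j → scaleLast-cong (p j)

    module _ (reciprocal : ℕ → 𝕜) (inverts : InvertsNaturals reciprocal) where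

      natUnit : ℕ → Unit
      natUnit t = record { value = suc t × 1# ; inverse = reciprocal t ; value*inverse = inverts t }

      scaleSlot-0 : ∀ {v} → IsWeightVector (weightOf m (suc n)) v → ∀ j → scaleSlots (ones [ j ]≔ 0#) v ≈ᴱ v
      scaleSlot-0 {v} w j = polynomial-at-0 (polynomial-exterior j v) λ t →
        transᴱ (scaleSlots-cong (λ i → reflexive (at t j i)) v)
          (scaleSlots-unit w ((λ _ → unit) [ j ]≔ natUnit t))
        where
        at : ∀ {d} t (j i : Fin d) → (ones [ j ]≔ (suc t × 1#)) i ≡ value (((λ _ → unit) [ j ]≔ natUnit t) i)
        at t zero    zero    = ≡.refl
        at t zero    (suc i) = ≡.refl
        at t (suc j) zero    = ≡.refl
        at t (suc j) (suc i) = at t j i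

      -- `slotwise`, with all its scalars equal to 1, changes the entries from 1 to 0 one slot at a
      -- time.
      scaleSlots-0 : ∀ {v} → IsWeightVector (weightOf m (suc n)) v → scaleSlots (λ _ → 0#) v ≈ᴱ v
      scaleSlots-0 {v} w = transᴱ
        (slotwise {W = V d (suc n)} (λ z → scaleSlots z v) (λ p → scaleSlots-cong (λ j → reflexive (p j)) v)
          ones (λ _ → 0#) ones slot)
        (transᴱ (·ᴱ-cong (∏-one {d} ones λ _ → refl) (scaleSlots-unit w (λ _ → unit))) (·ᴱ-identityˡ _))
        where
        slot : ∀ z i → scaleSlots (z [ i ]≔ 0#) v ≈ᴱ 1# ·ᴱ scaleSlots (z [ i ]≔ 1#) v
        slot z i = begin
          scaleSlots (z [ i ]≔ 0#) v
            -- The scaling factors through a 0 in slot i alone, which fixes v, followed by the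
            -- scaling of the other slots.
            ≈⟨ induced-triangle {f = λ j → scaleLast ((ones [ i ]≔ 0#) j)} {λ j → scaleLast ((z [ i ]≔ 1#) j)}
                 {λ j → scaleLast ((z [ i ]≔ 0#) j)} compose v ⟨
          scaleSlots (z [ i ]≔ 1#) (scaleSlots (ones [ i ]≔ 0#) v)
            ≈⟨ LinearMap.f-cong (exteriorMap (tensorMap λ j → scaleLast ((z [ i ]≔ 1#) j))) (scaleSlot-0 w i) ⟩
          scaleSlots (z [ i ]≔ 1#) v
            ≈⟨ ·ᴱ-identityˡ _ ⟨
          1# ·ᴱ scaleSlots (z [ i ]≔ 1#) v ∎
          where
          open ≈ᴱ-Reasoning
          product : ∀ {d} (z : Vector 𝕜 d) i j → (z [ i ]≔ 1#) j * (ones [ i ]≔ 0#) j ≈ (z [ i ]≔ 0#) j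
          product z zero    zero    = zeroʳ _
          product z zero    (suc j) = *-identityʳ _
          product z (suc i) zero    = *-identityʳ _
          product z (suc i) (suc j) = product (z ∘ suc) i j
          compose : ∀ j x k → fun (scaleLast ((z [ i ]≔ 1#) j)) (fun (scaleLast ((ones [ i ]≔ 0#) j)) x) k
                                ≈ fun (scaleLast ((z [ i ]≔ 0#) j)) x k
          compose j x k = trans (scaleLast-∘ _ _ x k) (scaleLast-cong (product z i j) x k)

      -- In each slot, truncating and padding with 0 amounts to scaling the last coordinate by 0.
      -- Hence `P` is injective on vectors of this weight.
      extend-restrict : ∀ {v} → IsWeightVector (weightOf m (suc n)) v → induced (λ _ → extendMap) (P v) ≈ᴱ v
      extend-restrict {v} w = transᴱ
        (induced-triangle {f = λ _ → initMap} {λ _ → extendMap} {λ _ → scaleLast 0#} (λ _ → truncate) v)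
        (scaleSlots-0 w)
        where
        truncate : ∀ x i → (init x ∷ʳ 0#) i ≈ fun (scaleLast 0#) x i
        truncate x = ∷ʳ-elim
          (λ i → trans (reflexive (∷ʳ-inject₁ (init x) 0# i))
            (sym (trans (*-congʳ (reflexive (∷ʳ-inject₁ ones 0# i))) (*-identityˡ _))))
          (trans (reflexive (∷ʳ-fromℕ (init x) 0#))
            (sym (trans (*-congʳ (reflexive (∷ʳ-fromℕ {n = n} ones 0#))) (zeroˡ _))))

  -- Only the underlying vectors of the images are compared, which keeps the target weights and the
  -- bounds in `ρ` out of the induction.
  InjectiveAt : ∀ {d} → (Fin d → ℕ → ℕ) → ℕ → Set
  InjectiveAt {d} m n = ∀ (v w : HWV d n (weightOf m n)) →
    ω d n ∧ vector v ≈ᴱ ω d n ∧ vector w → v ≈ᴴ w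

  -- Injectivity passes from n to n + 1.

  module _ (q n : ℕ) (m : Fin (suc (q ℕ.* 2)) → ℕ → ℕ) (m-last : ∀ j → m j n ≡ 0)
    (reciprocal : ℕ → 𝕜) (inverts : InvertsNaturals reciprocal) where

    private
      d : ℕ
      d = suc (q ℕ.* 2)
      open Drop d n

      c c⁻¹ : 𝕜
      c   = (suc n × 1#) * (- 1#) ^ n
      -- `reciprocal n` inverts n + 1, not n, and (-1)^n is its own inverse.
      c⁻¹ = reciprocal n * (- 1#) ^ n

      c⁻¹*c : c⁻¹ * c ≈ 1#
      c⁻¹*c = trans (*-comm _ _) (trans (*-interchange _ _ _ _)
        (trans (*-cong (inverts n) (-1^-square n)) (*-identityˡ 1#)))

    -- D(ω ∧ v) = c ω ∧ P v because P ω = 0.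
    contract-ω∧ : ∀ v → c⁻¹ ·ᴱ D (ω d (suc n) ∧ v) ≈ᴱ ω d n ∧ P v
    contract-ω∧ v = begin
      c⁻¹ ·ᴱ (D (ω d (suc n)) ∧ P v +ᴱ α (P (ω d (suc n))) ∧ D v)
        ≈⟨ ·ᴱ-cong refl (+ᴱ-cong (transᴱ (∧-cong (D-ω q n) reflᴱ) (·ᴱ-∧ˡ _ _ _))
             (transᴱ (∧-cong (α-cong (P-ω (q ℕ.* 2) n)) reflᴱ) (∧-zeroˡ _))) ⟩
      c⁻¹ ·ᴱ (c ·ᴱ (ω d n ∧ P v) +ᴱ 0ᴱ)
        ≈⟨ ·ᴱ-cong refl (+ᴱ-identityʳ _) ⟩
      c⁻¹ ·ᴱ (c ·ᴱ (ω d n ∧ P v))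
        ≈⟨ ·ᴱ-assoc _ _ _ ⟨
      (c⁻¹ * c) ·ᴱ (ω d n ∧ P v)
        ≈⟨ ·ᴱ-cong c⁻¹*c reflᴱ ⟩
      1# ·ᴱ (ω d n ∧ P v)
        ≈⟨ ·ᴱ-identityˡ _ ⟩
      ω d n ∧ P v ∎
      where open ≈ᴱ-Reasoning

    ω∧-injective-suc : InjectiveAt m n → InjectiveAt m (suc n)
    ω∧-injective-suc inj v w p = begin
      vector v                                      ≈⟨ extend-restrict d n m m-last reciprocal inverts (weight v) ⟨
      induced (λ _ → extendMap) (P (vector v))      ≈⟨ LinearMap.f-cong (exteriorMap (tensorMap λ _ → extendMap)) Pv≈Pw ⟩
      induced (λ _ → extendMap) (P (vector w))      ≈⟨ extend-restrict d n m m-last reciprocal inverts (weight w) ⟩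
      vector w                                      ∎
      where
      open ≈ᴱ-Reasoning
      Pv≈Pw : P (vector v) ≈ᴱ P (vector w)
      Pv≈Pw = inj (restrict d n m m-last v) (restrict d n m m-last w) (begin
        ω d n ∧ P (vector v)                  ≈⟨ contract-ω∧ (vector v) ⟨
        c⁻¹ ·ᴱ D (ω d (suc n) ∧ vector v)     ≈⟨ ·ᴱ-cong refl (D-cong p) ⟩
        c⁻¹ ·ᴱ D (ω d (suc n) ∧ vector w)     ≈⟨ contract-ω∧ (vector w) ⟩
        ω d n ∧ P (vector w)                  ∎)

  -- Iteration from k up to ℓ.

  module _ (reciprocal : ℕ → 𝕜) (inverts : InvertsNaturals reciprocal) where

    ω∧-injective-+ : ∀ q k (m : Fin (suc (q ℕ.* 2)) → ℕ → ℕ) → (∀ j i → k ℕ.≤ i → m j i ≡ 0) →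
      InjectiveAt m k → ∀ i → InjectiveAt m (i ℕ.+ k)
    ω∧-injective-+ q k m short inj zero    = inj
    ω∧-injective-+ q k m short inj (suc i) = ω∧-injective-suc q (i ℕ.+ k) m
      (λ j → short j _ (ℕₚ.m≤n+m k i)) reciprocal inverts (ω∧-injective-+ q k m short inj i)

    -- The oddness of d comes as an equation with d a variable, so that matching on `refl` puts all
    -- types that mention d into the form used above.
    ω∧-injective-< : ∀ q {d} → d ≡ suc (q ℕ.* 2) → ∀ {k ℓ} → k ℕ.< ℓ → (m : Fin d → ℕ → ℕ) →
      (∀ j i → k ℕ.≤ i → m j i ≡ 0) → InjectiveAt m k → InjectiveAt m ℓ
    ω∧-injective-< q ≡.refl {k} {ℓ} k<ℓ m short inj =
      ≡.subst (InjectiveAt m) (ℕₚ.m∸n+n≡m (ℕₚ.<⇒≤ k<ℓ)) (ω∧-injective-+ q k m short inj (ℓ ℕ.∸ k))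

-- Inverses of the positive integers in ℂ.

module ComplexReciprocal where

  open Defs.Complex using (ℂ; ℝ; fromℚ; _+i_; ≗⇒≈; ℂ-commutativeRing)
  open CommutativeRing ℂ-commutativeRing using (_*_; _≈_; 1#; semiring)
  open Mult semiring using (_×_)

  -- Follows the recursion of `_×_`, so that it can be compared with `t × 1#` at each index of the
  -- Cauchy sequence.
  natℚ : ℕ → ℚ
  natℚ zero    = 0ℚ
  natℚ (suc t) = 1ℚ ℚ.+ natℚ t

  nonNegative-natℚ : ∀ t → ℚ.NonNegative (natℚ t)
  nonNegative-natℚ zero    = _
  nonNegative-natℚ (suc t) = ℚₚ.nonNeg+nonNeg⇒nonNeg 1ℚ (natℚ t) {{nonNegative-natℚ t}}

  nonZero-natℚ : ∀ t → ℚ.NonZero (natℚ (suc t))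
  nonZero-natℚ t = ℚₚ.pos⇒nonZero (natℚ (suc t))
    {{ℚₚ.pos+nonNeg⇒pos 1ℚ (natℚ t) {{nonNegative-natℚ t}}}}

  re-× : ∀ t k → ℝ.seq (ℂ.re (t × 1#)) k ≡ natℚ t
  re-× zero    k = ≡.refl
  re-× (suc t) k = ≡.cong (1ℚ ℚ.+_) (re-× t k)

  im-× : ∀ t k → ℝ.seq (ℂ.im (t × 1#)) k ≡ 0ℚ
  im-× zero    k = ≡.refl
  im-× (suc t) k = ≡.cong (0ℚ ℚ.+_) (im-× t k)

  1/natℚ : ℕ → ℚ
  1/natℚ t = (ℚ.1/ natℚ (suc t)) {{nonZero-natℚ t}}

  reciprocal : ℕ → ℂ
  reciprocal t = fromℚ (1/natℚ t) +i fromℚ 0ℚ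

  reciprocal-inverse : Stabilisation.InvertsNaturals ℂ-commutativeRing reciprocal
  reciprocal-inverse t = ≗⇒≈ real-part imaginary-part
    where
    q = natℚ (suc t)
    r = 1/natℚ t
    real-part : ∀ k → ℝ.seq (ℂ.re ((suc t × 1#) * reciprocal t)) k ≡ 1ℚ
    real-part k = ≡.trans
      (≡.cong₂ (λ x y → x ℚ.* r ℚ.+ ℚ.- (y ℚ.* 0ℚ)) (re-× (suc t) k) (im-× (suc t) k))
      (≡.trans (≡.cong (ℚ._+ 0ℚ) (ℚₚ.*-inverseʳ q {{nonZero-natℚ t}})) ≡.refl)
    imaginary-part : ∀ k → ℝ.seq (ℂ.im ((suc t × 1#) * reciprocal t)) k ≡ 0ℚ
    imaginary-part k = ≡.trans
      (≡.cong₂ (λ x y → x ℚ.* 0ℚ ℚ.+ y ℚ.* r) (re-× (suc t) k) (im-× (suc t) k))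
      (≡.cong₂ ℚ._+_ (ℚₚ.*-zeroʳ q) (ℚₚ.*-zeroˡ r))

-- Conjugate partitions as weights.

open import Defs
open import Data.Fin.Base using (Fin)
open import Data.Nat.Base using (ℕ; _≤_; _<_; _^_; _∸_; _%_)
open import Data.Nat.Properties using (≤-trans; <⇒≤)
open import Function.Definitions using (Injective)
open import Relation.Binary.PropositionalEquality using (_≡_)

theorem1p10 : (d : ℕ) → 3 ≤ d → d % 2 ≡ 1 →
    (k : ℕ) → 1 ≤ k →
    (λs : Fin d → Partition) →
    (λs⊆ : ∀ j → λs j ⊆ k ^ (d ∸ 1) × k) →
    Injective _≈ᴴ_ _≈ᴴ_ (L k λs (λ j → parts≤ (λs⊆ j))) →
    (ℓ : ℕ) (k<ℓ : k < ℓ) →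
    Injective _≈ᴴ_ _≈ᴴ_ (L ℓ λs (λ j i → ≤-trans (parts≤ (λs⊆ j) i) (<⇒≤ k<ℓ)))
theorem1p10 d _ odd k _ λs λs⊆ inj ℓ k<ℓ {v} {w} =
  Stabilisation.ω∧-injective-< ℂ-commutativeRing reciprocal reciprocal-inverse (d ℕ./ 2) d≡ k<ℓ
    (λ j → part (conj (λs j)))
    -- The conjugate of λ has at most λ₁ nonzero parts, and λ₁ ≤ k; so its weight is zero in every
    -- coordinate added after the first k.
    (λ j i k≤i → vanishing (conj (λs j)) i (≤-trans (parts≤ (λs⊆ j) 0) k≤i))
    (λ x y → inj {x} {y}) v w
  where
  open ComplexReciprocal
  d≡ : d ≡ suc ((d ℕ./ 2) ℕ.* 2)
  d≡ = ≡.trans (ℕ.m≡m%n+[m/n]*n d 2) (≡.cong (ℕ._+ (d ℕ./ 2) ℕ.* 2) odd)
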